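{- Let $K$ be a finite nonabelian group with trivial center, and let $\rho$ be a faithful irreducible (complex, unitary) representation of $K$ of dimension $d_\rho \ge 2$. Then there is an integer $\kappa_\rho \ge 2$ (depending only on $K$ and $\rho$) such that for every integer $n \ge 1$ and every integer $t > 0$, $$ \Pr_{h^{(1)},\ldots,h^{(t)}}\left[\,\left\|\frac{1}{t}\sum_{m=1}^t \rho^n\bigl(h^{(m)}\bigr)\right\|_{\mathrm{op}} = 1\right] \;\ge\; 1 - n^{\kappa_\rho}\,|K|^t \exp\bigl(-n/|K|^t\bigr), $$ where $h^{(1)},\ldots,h^{(t)}$ are independent and uniformly random elements of $G = K^n$.
   Context: All representations are finite-dimensional, complex and unitary. For a representation $\rho$ of $K$, $\rho^n$ denotes the representation of the direct power $K^n$ given by $\rho^n(g_1,\ldots,g_n) = \rho(g_1)\otimes\cdots\otimes\rho(g_n)$. $\|\cdot\|_{\mathrm{op}}$ is the operator norm induced by the Euclidean (Hermitian) norm. -}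

module Defs where

open import Algebra.Bundles using (Group; RawMonoid)
import Algebra.Definitions.RawMonoid as RawMonoidDefs
open import Data.Bool.Base using (if_then_else_)
open import Data.Fin.Base using (Fin; zero; suc; finToFun; remQuot)
open import Data.Fin.Properties using (_≟_; nonZeroIndex)
open import Data.Fin.Subset using (Subset; _∈_; ∣_∣)
open import Data.Integer.Base as ℤ using (+_)
import Data.Integer.Properties as ℤₚ
open import Data.Nat.Base as ℕ using (ℕ; zero; suc)
import Data.Nat.Coprimality as Coprimality
import Data.Nat.Properties as ℕₚ
open import Data.Product using (∃-syntax; Σ-syntax; _×_; _,_; proj₁; proj₂)
open import Data.Rational.Base as ℚ using (ℚ; 0ℚ; 1ℚ; ½; mkℚ)
open import Data.Rational.Properties as ℚₚ using (module ≤-Reasoning)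
open import Data.Rational.Solver using (module +-*-Solver)
open import Data.Sum.Base using (inj₁; inj₂)
open import Data.Vec.Functional using (Vector; tail)
open import Function.Bundles using (Inverse)
open import Function.Definitions using (Injective)
open import Level using (Level; 0ℓ) renaming (suc to lsuc; _⊔_ to _⊔ℓ_)
open import Relation.Binary.PropositionalEquality
  using (_≡_; refl; sym; trans; cong; cong₂; subst)
  renaming (setoid to ≡-setoid)
open import Relation.Nullary using (¬_; does)
open import Relation.Unary using (Pred)

open +-*-Solver using (solve; _:=_; _:+_; _:*_; _:-_; :-_; con)

private
  variable
    c ℓ : Level
    d m n : ℕ

IsCauchy : (ℕ → ℚ) → Set
IsCauchy x = ∀ ε → 0ℚ ℚ.< ε → ∃[ N ] ∀ i j → N ℕ.≤ i → N ℕ.≤ j →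
  ℚ.∣ x i ℚ.- x j ∣ ℚ.< ε

record ℝ : Set where
  constructor mkℝ
  field
    seq    : ℕ → ℚ
    cauchy : IsCauchy seq

open ℝ public

infix 4 _≈ʳ_ _≤ʳ_ _<ʳ_

record _≈ʳ_ (x y : ℝ) : Set where
  constructor mk≈
  field
    ≈-eventually : ∀ ε → 0ℚ ℚ.< ε → ∃[ N ] ∀ i → N ℕ.≤ i →
      ℚ.∣ seq x i ℚ.- seq y i ∣ ℚ.< ε

record _≤ʳ_ (x y : ℝ) : Set where
  constructor mk≤
  field
    ≤-eventually : ∀ ε → 0ℚ ℚ.< ε → ∃[ N ] ∀ i → N ℕ.≤ i → seq x i ℚ.≤ seq y i ℚ.+ ε

record _<ʳ_ (x y : ℝ) : Set where
  constructor mk<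
  field
    <-eventually : ∃[ ε ] 0ℚ ℚ.< ε × ∃[ N ] ∀ i → N ℕ.≤ i → seq x i ℚ.+ ε ℚ.≤ seq y i

open _≈ʳ_ public
open _≤ʳ_ public
open _<ʳ_ public

½*-pos : ∀ {ε} → 0ℚ ℚ.< ε → 0ℚ ℚ.< ½ ℚ.* ε
½*-pos {ε} 0<ε = subst (ℚ._< ½ ℚ.* ε) (ℚₚ.*-zeroʳ ½) (ℚₚ.*-monoʳ-<-pos ½ 0<ε)

½*+½* : ∀ ε → ½ ℚ.* ε ℚ.+ ½ ℚ.* ε ≡ ε
½*+½* = solve 1 (λ e → con ½ :* e :+ con ½ :* e := e) refl

const-cauchy : ∀ q → IsCauchy (λ _ → q)
const-cauchy q ε 0<ε = 0 , λ _ _ _ _ →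
  subst (λ z → ℚ.∣ z ∣ ℚ.< ε) (sym (ℚₚ.+-inverseʳ q)) 0<ε

+-cauchy : ∀ {x y} → IsCauchy x → IsCauchy y → IsCauchy (λ i → x i ℚ.+ y i)
+-cauchy {x} {y} cx cy ε 0<ε with cx (½ ℚ.* ε) (½*-pos 0<ε) | cy (½ ℚ.* ε) (½*-pos 0<ε)
... | M , bx | N , by = M ℕ.⊔ N , λ i j Mi Mj → begin-strict
  ℚ.∣ (x i ℚ.+ y i) ℚ.- (x j ℚ.+ y j) ∣
    ≡⟨ cong ℚ.∣_∣ (solve 4 (λ a b c d → (a :+ b) :- (c :+ d) := (a :- c) :+ (b :- d))
                     refl (x i) (y i) (x j) (y j)) ⟩
  ℚ.∣ (x i ℚ.- x j) ℚ.+ (y i ℚ.- y j) ∣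
    ≤⟨ ℚₚ.∣p+q∣≤∣p∣+∣q∣ (x i ℚ.- x j) (y i ℚ.- y j) ⟩
  ℚ.∣ x i ℚ.- x j ∣ ℚ.+ ℚ.∣ y i ℚ.- y j ∣
    <⟨ ℚₚ.+-mono-< (bx i j (ℕₚ.m⊔n≤o⇒m≤o M N Mi) (ℕₚ.m⊔n≤o⇒m≤o M N Mj))
                   (by i j (ℕₚ.m⊔n≤o⇒n≤o M N Mi) (ℕₚ.m⊔n≤o⇒n≤o M N Mj)) ⟩
  ½ ℚ.* ε ℚ.+ ½ ℚ.* ε
    ≡⟨ ½*+½* ε ⟩
  ε ∎
  where open ≤-Reasoning

neg-cauchy : ∀ {x} → IsCauchy x → IsCauchy (λ i → ℚ.- x i)
neg-cauchy {x} cx ε 0<ε with cx ε 0<ε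
... | N , b = N , λ i j Ni Nj → subst (ℚ._< ε) (sym (lemma (x i) (x j))) (b i j Ni Nj)
  where
  lemma : ∀ p q → ℚ.∣ ℚ.- p ℚ.- (ℚ.- q) ∣ ≡ ℚ.∣ p ℚ.- q ∣
  lemma p q = trans
    (cong ℚ.∣_∣ (solve 2 (λ a b → (:- a) :- (:- b) := :- (a :- b)) refl p q))
    (ℚₚ.∣-p∣≡∣p∣ (p ℚ.- q))

0<1 : 0ℚ ℚ.< 1ℚ
0<1 = ℚₚ.positive⁻¹ 1ℚ

eventually-bounded : ∀ {x} → IsCauchy x →
  ∃[ B ] 0ℚ ℚ.< B × ∃[ N ] ∀ i → N ℕ.≤ i → ℚ.∣ x i ∣ ℚ.≤ B
eventually-bounded {x} cx with cx 1ℚ 0<1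
... | N , b = ℚ.∣ x N ∣ ℚ.+ 1ℚ
            , ℚₚ.+-mono-≤-< (ℚₚ.0≤∣p∣ (x N)) 0<1
            , N , λ i Ni → begin
  ℚ.∣ x i ∣
    ≡⟨ cong ℚ.∣_∣ (solve 2 (λ a b → a := b :+ (a :- b)) refl (x i) (x N)) ⟩
  ℚ.∣ x N ℚ.+ (x i ℚ.- x N) ∣
    ≤⟨ ℚₚ.∣p+q∣≤∣p∣+∣q∣ (x N) (x i ℚ.- x N) ⟩
  ℚ.∣ x N ∣ ℚ.+ ℚ.∣ x i ℚ.- x N ∣
    ≤⟨ ℚₚ.+-monoʳ-≤ ℚ.∣ x N ∣ (ℚₚ.<⇒≤ (b i N Ni ℕₚ.≤-refl)) ⟩
  ℚ.∣ x N ∣ ℚ.+ 1ℚ ∎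
  where open ≤-Reasoning

bounded-* : ∀ {B δ} p q → 0ℚ ℚ.< B → ℚ.∣ p ∣ ℚ.≤ B → ℚ.∣ q ∣ ℚ.< δ → ℚ.∣ p ℚ.* q ∣ ℚ.< B ℚ.* δ
bounded-* {B} {δ} p q 0<B p≤B q<δ = begin-strict
  ℚ.∣ p ℚ.* q ∣        ≡⟨ ℚₚ.∣p*q∣≡∣p∣*∣q∣ p q ⟩
  ℚ.∣ p ∣ ℚ.* ℚ.∣ q ∣  ≤⟨ ℚₚ.*-monoʳ-≤-nonNeg ℚ.∣ q ∣ {{ℚₚ.∣-∣-nonNeg q}} p≤B ⟩
  B ℚ.* ℚ.∣ q ∣        <⟨ ℚₚ.*-monoʳ-<-pos B {{ℚ.positive 0<B}} q<δ ⟩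
  B ℚ.* δ              ∎
  where open ≤-Reasoning

*-diff-bound : ∀ {A B δ} p q p′ q′ → 0ℚ ℚ.< A → 0ℚ ℚ.< B → ℚ.∣ p ∣ ℚ.≤ A → ℚ.∣ q′ ∣ ℚ.≤ B →
  ℚ.∣ p ℚ.- p′ ∣ ℚ.< δ → ℚ.∣ q ℚ.- q′ ∣ ℚ.< δ →
  ℚ.∣ p ℚ.* q ℚ.- p′ ℚ.* q′ ∣ ℚ.< (A ℚ.+ B) ℚ.* δ
*-diff-bound {A} {B} {δ} p q p′ q′ 0<A 0<B p≤A q′≤B Δp<δ Δq<δ = begin-strict
  ℚ.∣ p ℚ.* q ℚ.- p′ ℚ.* q′ ∣
    ≡⟨ cong ℚ.∣_∣ (solve 4 (λ a b c d → a :* b :- c :* d := a :* (b :- d) :+ d :* (a :- c))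
                     refl p q p′ q′) ⟩
  ℚ.∣ p ℚ.* (q ℚ.- q′) ℚ.+ q′ ℚ.* (p ℚ.- p′) ∣
    ≤⟨ ℚₚ.∣p+q∣≤∣p∣+∣q∣ (p ℚ.* (q ℚ.- q′)) (q′ ℚ.* (p ℚ.- p′)) ⟩
  ℚ.∣ p ℚ.* (q ℚ.- q′) ∣ ℚ.+ ℚ.∣ q′ ℚ.* (p ℚ.- p′) ∣
    <⟨ ℚₚ.+-mono-< (bounded-* p (q ℚ.- q′) 0<A p≤A Δq<δ) (bounded-* q′ (p ℚ.- p′) 0<B q′≤B Δp<δ) ⟩
  A ℚ.* δ ℚ.+ B ℚ.* δ
    ≡⟨ ℚₚ.*-distribʳ-+ δ A B ⟨
  (A ℚ.+ B) ℚ.* δ ∎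
  where open ≤-Reasoning

divide : ∀ {C ε} → 0ℚ ℚ.< C → 0ℚ ℚ.< ε → ∃[ δ ] 0ℚ ℚ.< δ × C ℚ.* δ ≡ ε
divide {C} {ε} 0<C 0<ε = ℚ.1/ C ℚ.* ε
  , ℚₚ.positive⁻¹ _ {{ℚₚ.pos*pos⇒pos (ℚ.1/ C) {{ℚₚ.1/pos⇒pos C}} ε {{ℚ.positive 0<ε}}}}
  , trans (sym (ℚₚ.*-assoc C (ℚ.1/ C) ε))
      (trans (cong (ℚ._* ε) (ℚₚ.*-inverseʳ C)) (ℚₚ.*-identityˡ ε))
  where
  instance
    C-pos : ℚ.Positive C
    C-pos = ℚ.positive 0<C
    C≢0 : ℚ.NonZero C
    C≢0 = ℚₚ.pos⇒nonZero C

*-cauchy : ∀ {x y} → IsCauchy x → IsCauchy y → IsCauchy (λ i → x i ℚ.* y i)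
*-cauchy {x} {y} cx cy ε 0<ε = (M ℕ.⊔ N) ℕ.⊔ (P ℕ.⊔ Q) , bound
  where
  bounded-x = eventually-bounded cx
  bounded-y = eventually-bounded cy
  A = proj₁ bounded-x
  B = proj₁ bounded-y
  M = proj₁ (proj₂ (proj₂ bounded-x))
  N = proj₁ (proj₂ (proj₂ bounded-y))
  0<A : 0ℚ ℚ.< A
  0<A = proj₁ (proj₂ bounded-x)
  0<B : 0ℚ ℚ.< B
  0<B = proj₁ (proj₂ bounded-y)
  quotient : ∃[ δ ] 0ℚ ℚ.< δ × (A ℚ.+ B) ℚ.* δ ≡ ε
  quotient = divide {A ℚ.+ B} {ε} (ℚₚ.+-mono-< {0ℚ} {A} {0ℚ} {B} 0<A 0<B) 0<ε
  δ = proj₁ quotient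
  0<δ : 0ℚ ℚ.< δ
  0<δ = proj₁ (proj₂ quotient)
  P = proj₁ (cx δ 0<δ)
  Q = proj₁ (cy δ 0<δ)
  bound : ∀ i j → (M ℕ.⊔ N) ℕ.⊔ (P ℕ.⊔ Q) ℕ.≤ i → (M ℕ.⊔ N) ℕ.⊔ (P ℕ.⊔ Q) ℕ.≤ j →
    ℚ.∣ x i ℚ.* y i ℚ.- x j ℚ.* y j ∣ ℚ.< ε
  bound i j hi hj = subst (ℚ.∣ x i ℚ.* y i ℚ.- x j ℚ.* y j ∣ ℚ.<_) (proj₂ (proj₂ quotient))
    (*-diff-bound {A} {B} {δ} (x i) (y i) (x j) (y j) 0<A 0<B
      (proj₂ (proj₂ (proj₂ bounded-x)) i (ℕₚ.m⊔n≤o⇒m≤o M N MNi))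
      (proj₂ (proj₂ (proj₂ bounded-y)) j (ℕₚ.m⊔n≤o⇒n≤o M N MNj))
      (proj₂ (cx δ 0<δ) i j (ℕₚ.m⊔n≤o⇒m≤o P Q PQi) (ℕₚ.m⊔n≤o⇒m≤o P Q PQj))
      (proj₂ (cy δ 0<δ) i j (ℕₚ.m⊔n≤o⇒n≤o P Q PQi) (ℕₚ.m⊔n≤o⇒n≤o P Q PQj)))
    where
    MNi = ℕₚ.m⊔n≤o⇒m≤o (M ℕ.⊔ N) (P ℕ.⊔ Q) hi
    MNj = ℕₚ.m⊔n≤o⇒m≤o (M ℕ.⊔ N) (P ℕ.⊔ Q) hj
    PQi = ℕₚ.m⊔n≤o⇒n≤o (M ℕ.⊔ N) (P ℕ.⊔ Q) hi
    PQj = ℕₚ.m⊔n≤o⇒n≤o (M ℕ.⊔ N) (P ℕ.⊔ Q) hj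

-- The Cauchy proofs carried by compound reals are irrelevant to every relation on ℝ;
-- keeping them abstract stops the type checker from unfolding them.
abstract
  fromℚ-cauchy : ∀ q → IsCauchy (λ _ → q)
  fromℚ-cauchy = const-cauchy

  +ʳ-cauchy : ∀ x y → IsCauchy (λ i → seq x i ℚ.+ seq y i)
  +ʳ-cauchy x y = +-cauchy {seq x} {seq y} (cauchy x) (cauchy y)

  *ʳ-cauchy : ∀ x y → IsCauchy (λ i → seq x i ℚ.* seq y i)
  *ʳ-cauchy x y = *-cauchy {seq x} {seq y} (cauchy x) (cauchy y)

  -ʳ-cauchy : ∀ x → IsCauchy (λ i → ℚ.- seq x i)
  -ʳ-cauchy x = neg-cauchy {seq x} (cauchy x)

fromℚ : ℚ → ℝ
fromℚ q = mkℝ (λ _ → q) (fromℚ-cauchy q)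

0ʳ 1ʳ : ℝ
0ʳ = fromℚ 0ℚ
1ʳ = fromℚ 1ℚ

infix  8 -ʳ_
infixl 7 _*ʳ_
infixl 6 _+ʳ_ _-ʳ_

_+ʳ_ _*ʳ_ : ℝ → ℝ → ℝ
x +ʳ y = mkℝ (λ i → seq x i ℚ.+ seq y i) (+ʳ-cauchy x y)
x *ʳ y = mkℝ (λ i → seq x i ℚ.* seq y i) (*ʳ-cauchy x y)

-ʳ_ : ℝ → ℝ
-ʳ x = mkℝ (λ i → ℚ.- seq x i) (-ʳ-cauchy x)

_-ʳ_ : ℝ → ℝ → ℝ
x -ʳ y = x +ʳ (-ʳ y)

ℝ-+-rawMonoid : RawMonoid 0ℓ 0ℓ
ℝ-+-rawMonoid = record { _≈_ = _≈ʳ_ ; _∙_ = _+ʳ_ ; ε = 0ʳ }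

open RawMonoidDefs ℝ-+-rawMonoid public using () renaming (sum to sumʳ)

-- expTerm q j = q^j / j!
expTerm : ℚ → ℕ → ℚ
expTerm q zero    = 1ℚ
expTerm q (suc j) = expTerm q j ℚ.* (q ℚ.* (+ 1 ℚ./ suc j))

expPartial : ℚ → ℕ → ℚ
expPartial q zero    = 0ℚ
expPartial q (suc j) = expPartial q j ℚ.+ expTerm q j

fromℕ : ℕ → ℚ
fromℕ k = mkℚ (+ k) 0 (Coprimality.sym (Coprimality.1-coprimeTo k))

fromℕ-mono-≤ : ∀ {j k} → j ℕ.≤ k → fromℕ j ℚ.≤ fromℕ k
fromℕ-mono-≤ j≤k = ℚ.*≤* (ℤₚ.*-monoʳ-≤-nonNeg (+ 1) (ℤ.+≤+ j≤k))

fromℕ-mono-< : ∀ {j k} → j ℕ.< k → fromℕ j ℚ.< fromℕ k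
fromℕ-mono-< j<k = ℚ.*<* (ℤₚ.*-monoʳ-<-pos (+ 1) (ℤ.+<+ j<k))

archimedean : ∀ q → ∃[ k ] ℚ.∣ q ∣ ℚ.≤ fromℕ k
archimedean (mkℚ p e-1 _) = ℤ.∣ p ∣ , ℚ.*≤*
  (ℤₚ.*-monoˡ-≤-nonNeg (+ ℤ.∣ p ∣) {+ 1} {+ suc e-1} (ℤ.+≤+ (ℕ.s≤s ℕ.z≤n)))

1/suc≡ : ∀ j → + 1 ℚ./ suc j ≡ ℚ.1/ fromℕ (suc j)
1/suc≡ j = ℚₚ.normalize-coprime (Coprimality.1-coprimeTo (suc j))

*-1/suc : ∀ j → fromℕ (suc j) ℚ.* (+ 1 ℚ./ suc j) ≡ 1ℚ
*-1/suc j = trans (cong (fromℕ (suc j) ℚ.*_) (1/suc≡ j)) (ℚₚ.*-inverseʳ (fromℕ (suc j)))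

1/suc-nonNeg : ∀ j → ℚ.NonNegative (+ 1 ℚ./ suc j)
1/suc-nonNeg j = subst ℚ.NonNegative (sym (1/suc≡ j)) _

1/suc-pos : ∀ j → ℚ.Positive (+ 1 ℚ./ suc j)
1/suc-pos j = subst ℚ.Positive (sym (1/suc≡ j)) _

2ℚ : ℚ
2ℚ = + 2 ℚ./ 1

module _ (q : ℚ) where
  open ≤-Reasoning

  private
    t e : ℕ → ℚ
    t = expTerm q
    e = expPartial q

    M : ℕ
    M = proj₁ (archimedean (2ℚ ℚ.* q))

  ∣expTerm∣ : ∀ j → ℚ.∣ t (suc j) ∣ ≡ ℚ.∣ t j ∣ ℚ.* (ℚ.∣ q ∣ ℚ.* (+ 1 ℚ./ suc j))
  ∣expTerm∣ j = trans (ℚₚ.∣p*q∣≡∣p∣*∣q∣ (t j) _) (cong (ℚ.∣ t j ∣ ℚ.*_)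
    (trans (ℚₚ.∣p*q∣≡∣p∣*∣q∣ q _) (cong (ℚ.∣ q ∣ ℚ.*_)
      (ℚₚ.0≤p⇒∣p∣≡p (ℚₚ.nonNegative⁻¹ _ {{1/suc-nonNeg j}})))))

  expTerm-halves : ∀ {j} → M ℕ.≤ j → 2ℚ ℚ.* ℚ.∣ t (suc j) ∣ ℚ.≤ ℚ.∣ t j ∣
  expTerm-halves {j} M≤j = begin
    2ℚ ℚ.* ℚ.∣ t (suc j) ∣
      ≡⟨ cong (2ℚ ℚ.*_) (∣expTerm∣ j) ⟩
    2ℚ ℚ.* (ℚ.∣ t j ∣ ℚ.* (ℚ.∣ q ∣ ℚ.* r))
      ≡⟨ solve 4 (λ a b c s → a :* (b :* (c :* s)) := b :* ((a :* c) :* s))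
           refl 2ℚ ℚ.∣ t j ∣ ℚ.∣ q ∣ r ⟩
    ℚ.∣ t j ∣ ℚ.* ((2ℚ ℚ.* ℚ.∣ q ∣) ℚ.* r)
      ≡⟨ cong (λ z → ℚ.∣ t j ∣ ℚ.* (z ℚ.* r)) (sym (ℚₚ.∣p*q∣≡∣p∣*∣q∣ 2ℚ q)) ⟩
    ℚ.∣ t j ∣ ℚ.* (ℚ.∣ 2ℚ ℚ.* q ∣ ℚ.* r)
      ≤⟨ ℚₚ.*-monoˡ-≤-nonNeg ℚ.∣ t j ∣ {{ℚₚ.∣-∣-nonNeg (t j)}}
           (ℚₚ.*-monoʳ-≤-nonNeg r {{1/suc-nonNeg j}}
             (ℚₚ.≤-trans (proj₂ (archimedean (2ℚ ℚ.* q))) (fromℕ-mono-≤ (ℕₚ.m≤n⇒m≤1+n M≤j)))) ⟩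
    ℚ.∣ t j ∣ ℚ.* (fromℕ (suc j) ℚ.* r)
      ≡⟨ cong (ℚ.∣ t j ∣ ℚ.*_) (*-1/suc j) ⟩
    ℚ.∣ t j ∣ ℚ.* 1ℚ
      ≡⟨ ℚₚ.*-identityʳ ℚ.∣ t j ∣ ⟩
    ℚ.∣ t j ∣ ∎
    where r = + 1 ℚ./ suc j

  ∣p∣≤2∣p∣ : ∀ p → ℚ.∣ p ∣ ℚ.≤ 2ℚ ℚ.* ℚ.∣ p ∣
  ∣p∣≤2∣p∣ p = begin
    ℚ.∣ p ∣             ≡⟨ ℚₚ.+-identityʳ ℚ.∣ p ∣ ⟨
    ℚ.∣ p ∣ ℚ.+ 0ℚ      ≤⟨ ℚₚ.+-monoʳ-≤ ℚ.∣ p ∣ (ℚₚ.0≤∣p∣ p) ⟩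
    ℚ.∣ p ∣ ℚ.+ ℚ.∣ p ∣ ≡⟨ solve 1 (λ a → a :+ a := con 2ℚ :* a) refl ℚ.∣ p ∣ ⟩
    2ℚ ℚ.* ℚ.∣ p ∣      ∎

  expTerm-antitone : ∀ k → ℚ.∣ t (k ℕ.+ M) ∣ ℚ.≤ ℚ.∣ t M ∣
  expTerm-antitone zero    = ℚₚ.≤-refl
  expTerm-antitone (suc k) = begin
    ℚ.∣ t (suc (k ℕ.+ M)) ∣        ≤⟨ ∣p∣≤2∣p∣ (t (suc (k ℕ.+ M))) ⟩
    2ℚ ℚ.* ℚ.∣ t (suc (k ℕ.+ M)) ∣ ≤⟨ expTerm-halves (ℕₚ.m≤n+m M k) ⟩
    ℚ.∣ t (k ℕ.+ M) ∣              ≤⟨ expTerm-antitone k ⟩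
    ℚ.∣ t M ∣                      ∎

  expPartial-tail : ∀ {N} → M ℕ.≤ N → ∀ k →
    ℚ.∣ e (k ℕ.+ N) ℚ.- e N ∣ ℚ.+ 2ℚ ℚ.* ℚ.∣ t (k ℕ.+ N) ∣ ℚ.≤ 2ℚ ℚ.* ℚ.∣ t N ∣
  expPartial-tail {N} M≤N zero = begin
    ℚ.∣ e N ℚ.- e N ∣ ℚ.+ 2ℚ ℚ.* ℚ.∣ t N ∣
      ≡⟨ cong (λ z → ℚ.∣ z ∣ ℚ.+ 2ℚ ℚ.* ℚ.∣ t N ∣) (ℚₚ.+-inverseʳ (e N)) ⟩
    0ℚ ℚ.+ 2ℚ ℚ.* ℚ.∣ t N ∣
      ≡⟨ ℚₚ.+-identityˡ _ ⟩
    2ℚ ℚ.* ℚ.∣ t N ∣ ∎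
  expPartial-tail {N} M≤N (suc k) = begin
    ℚ.∣ (e i ℚ.+ t i) ℚ.- e N ∣ ℚ.+ 2ℚ ℚ.* ℚ.∣ t (suc i) ∣
      ≤⟨ ℚₚ.+-mono-≤
           (ℚₚ.≤-trans
             (ℚₚ.≤-reflexive (cong ℚ.∣_∣
               (solve 3 (λ a b c → (a :+ b) :- c := (a :- c) :+ b) refl (e i) (t i) (e N))))
             (ℚₚ.∣p+q∣≤∣p∣+∣q∣ (e i ℚ.- e N) (t i)))
           (expTerm-halves (ℕₚ.≤-trans M≤N (ℕₚ.m≤n+m N k))) ⟩
    (ℚ.∣ e i ℚ.- e N ∣ ℚ.+ ℚ.∣ t i ∣) ℚ.+ ℚ.∣ t i ∣
      ≡⟨ solve 2 (λ a b → (a :+ b) :+ b := a :+ con 2ℚ :* b) refl ℚ.∣ e i ℚ.- e N ∣ ℚ.∣ t i ∣ ⟩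
    ℚ.∣ e i ℚ.- e N ∣ ℚ.+ 2ℚ ℚ.* ℚ.∣ t i ∣
      ≤⟨ expPartial-tail M≤N k ⟩
    2ℚ ℚ.* ℚ.∣ t N ∣ ∎
    where i = k ℕ.+ N

  expPartial-diff : ∀ {N} → M ℕ.≤ N → ∀ {i} → N ℕ.≤ i → ℚ.∣ e i ℚ.- e N ∣ ℚ.≤ 2ℚ ℚ.* ℚ.∣ t N ∣
  expPartial-diff {N} M≤N {i} N≤i =
    subst (λ z → ℚ.∣ e z ℚ.- e N ∣ ℚ.≤ 2ℚ ℚ.* ℚ.∣ t N ∣) (ℕₚ.m∸n+n≡m N≤i) (begin
      ℚ.∣ D ∣              ≡⟨ ℚₚ.+-identityʳ ℚ.∣ D ∣ ⟨
      ℚ.∣ D ∣ ℚ.+ 0ℚ       ≤⟨ ℚₚ.+-monoʳ-≤ ℚ.∣ D ∣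
                               (ℚₚ.≤-trans (ℚₚ.0≤∣p∣ T) (∣p∣≤2∣p∣ T)) ⟩
      ℚ.∣ D ∣ ℚ.+ 2ℚ ℚ.* ℚ.∣ T ∣ ≤⟨ expPartial-tail M≤N (i ℕ.∸ N) ⟩
      2ℚ ℚ.* ℚ.∣ t N ∣     ∎)
    where
    D = e (i ℕ.∸ N ℕ.+ N) ℚ.- e N
    T = t (i ℕ.∸ N ℕ.+ N)

  expPartial-cauchy : IsCauchy e
  expPartial-cauchy ε 0<ε = suc K , λ i j Ni Nj → begin-strict
    ℚ.∣ e i ℚ.- e j ∣
      ≡⟨ cong ℚ.∣_∣ (solve 3 (λ a b c → a :- b := (a :- c) :- (b :- c))
                       refl (e i) (e j) (e (suc K))) ⟩
    ℚ.∣ (e i ℚ.- e (suc K)) ℚ.- (e j ℚ.- e (suc K)) ∣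
      ≤⟨ ℚₚ.∣p-q∣≤∣p∣+∣q∣ (e i ℚ.- e (suc K)) (e j ℚ.- e (suc K)) ⟩
    ℚ.∣ e i ℚ.- e (suc K) ∣ ℚ.+ ℚ.∣ e j ℚ.- e (suc K) ∣
      ≤⟨ ℚₚ.+-mono-≤ (expPartial-diff M≤1+K Ni) (expPartial-diff M≤1+K Nj) ⟩
    2ℚ ℚ.* ℚ.∣ t (suc K) ∣ ℚ.+ 2ℚ ℚ.* ℚ.∣ t (suc K) ∣
      ≡⟨ cong (λ z → 2ℚ ℚ.* z ℚ.+ 2ℚ ℚ.* z) (∣expTerm∣ K) ⟩
    2ℚ ℚ.* (ℚ.∣ t K ∣ ℚ.* (ℚ.∣ q ∣ ℚ.* r)) ℚ.+ 2ℚ ℚ.* (ℚ.∣ t K ∣ ℚ.* (ℚ.∣ q ∣ ℚ.* r))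
      ≡⟨ solve 3 (λ a b c → con 2ℚ :* (a :* (b :* c)) :+ con 2ℚ :* (a :* (b :* c))
                    := a :* (con 4ℚ :* b :* c)) refl ℚ.∣ t K ∣ ℚ.∣ q ∣ r ⟩
    ℚ.∣ t K ∣ ℚ.* (4ℚ ℚ.* ℚ.∣ q ∣ ℚ.* r)
      ≤⟨ ℚₚ.*-monoʳ-≤-nonNeg (4ℚ ℚ.* ℚ.∣ q ∣ ℚ.* r) {{4qr-nonNeg}} tK≤tM ⟩
    ℚ.∣ t M ∣ ℚ.* (4ℚ ℚ.* ℚ.∣ q ∣ ℚ.* r)
      ≡⟨ solve 3 (λ a b c → a :* (con 4ℚ :* b :* c) := (a :* (con 4ℚ :* b)) :* c)
           refl ℚ.∣ t M ∣ ℚ.∣ q ∣ r ⟩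
    C ℚ.* r
      ≡⟨ cong (ℚ._* r) (ℚₚ.*-identityʳ C) ⟨
    C ℚ.* 1ℚ ℚ.* r
      ≡⟨ cong (λ z → C ℚ.* z ℚ.* r) (ℚₚ.*-inverseʳ ε) ⟨
    C ℚ.* (ε ℚ.* ℚ.1/ ε) ℚ.* r
      ≡⟨ solve 4 (λ a b c f → a :* (b :* c) :* f := b :* ((a :* c) :* f)) refl C ε (ℚ.1/ ε) r ⟩
    ε ℚ.* ((C ℚ.* ℚ.1/ ε) ℚ.* r)
      <⟨ ℚₚ.*-monoʳ-<-pos ε (ℚₚ.*-monoˡ-<-pos r {{1/suc-pos K}} C/ε<1+K) ⟩
    ε ℚ.* (fromℕ (suc K) ℚ.* r)
      ≡⟨ cong (ε ℚ.*_) (*-1/suc K) ⟩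
    ε ℚ.* 1ℚ
      ≡⟨ ℚₚ.*-identityʳ ε ⟩
    ε ∎
    where
    instance
      ε-pos : ℚ.Positive ε
      ε-pos = ℚ.positive 0<ε
      ε≢0 : ℚ.NonZero ε
      ε≢0 = ℚₚ.pos⇒nonZero ε
    4ℚ = + 4 ℚ./ 1
    C  = ℚ.∣ t M ∣ ℚ.* (4ℚ ℚ.* ℚ.∣ q ∣)
    L  = proj₁ (archimedean (C ℚ.* ℚ.1/ ε))
    K  = M ℕ.⊔ L
    r  = + 1 ℚ./ suc K
    M≤1+K : M ℕ.≤ suc K
    M≤1+K = ℕₚ.m≤n⇒m≤1+n (ℕₚ.m≤m⊔n M L)
    tK≤tM : ℚ.∣ t K ∣ ℚ.≤ ℚ.∣ t M ∣
    tK≤tM = subst (λ z → ℚ.∣ t z ∣ ℚ.≤ ℚ.∣ t M ∣) (ℕₚ.m∸n+n≡m (ℕₚ.m≤m⊔n M L))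
      (expTerm-antitone (K ℕ.∸ M))
    4qr-nonNeg : ℚ.NonNegative (4ℚ ℚ.* ℚ.∣ q ∣ ℚ.* r)
    4qr-nonNeg = subst ℚ.NonNegative
      (trans (ℚₚ.∣p*q∣≡∣p∣*∣q∣ (4ℚ ℚ.* q) r) (cong₂ ℚ._*_ (ℚₚ.∣p*q∣≡∣p∣*∣q∣ 4ℚ q)
        (ℚₚ.0≤p⇒∣p∣≡p (ℚₚ.nonNegative⁻¹ r {{1/suc-nonNeg K}}))))
      (ℚₚ.∣-∣-nonNeg (4ℚ ℚ.* q ℚ.* r))
    p≤∣p∣ : ∀ p → p ℚ.≤ ℚ.∣ p ∣
    p≤∣p∣ p with ℚₚ.≤-total 0ℚ p
    ... | inj₁ 0≤p = ℚₚ.≤-reflexive (sym (ℚₚ.0≤p⇒∣p∣≡p 0≤p))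
    ... | inj₂ p≤0 = ℚₚ.≤-trans p≤0 (ℚₚ.0≤∣p∣ p)
    C/ε<1+K : C ℚ.* ℚ.1/ ε ℚ.< fromℕ (suc K)
    C/ε<1+K = begin-strict
      C ℚ.* ℚ.1/ ε           ≤⟨ p≤∣p∣ _ ⟩
      ℚ.∣ C ℚ.* ℚ.1/ ε ∣     ≤⟨ proj₂ (archimedean (C ℚ.* ℚ.1/ ε)) ⟩
      fromℕ L                <⟨ fromℕ-mono-< (ℕ.s≤s (ℕₚ.m≤n⊔m M L)) ⟩
      fromℕ (suc K)          ∎

abstract
  expℚ-cauchy : ∀ q → IsCauchy (expPartial q)
  expℚ-cauchy = expPartial-cauchy

expℚ : ℚ → ℝ
expℚ q = mkℝ (expPartial q) (expℚ-cauchy q)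

record ℂ : Set where
  constructor _+i_
  field
    re im : ℝ

open ℂ public

infix  4 _≈ᶜ_
infixl 7 _*ᶜ_
infixl 6 _+ᶜ_

_≈ᶜ_ : ℂ → ℂ → Set
z ≈ᶜ w = re z ≈ʳ re w × im z ≈ʳ im w

_+ᶜ_ _*ᶜ_ : ℂ → ℂ → ℂ
z +ᶜ w = (re z +ʳ re w) +i (im z +ʳ im w)
z *ᶜ w = (re z *ʳ re w -ʳ im z *ʳ im w) +i (re z *ʳ im w +ʳ im z *ʳ re w)

conj : ℂ → ℂ
conj z = re z +i (-ʳ im z)

0ᶜ 1ᶜ : ℂ
0ᶜ = 0ʳ +i 0ʳ
1ᶜ = 1ʳ +i 0ʳ

ℂ-+-rawMonoid : RawMonoid 0ℓ 0ℓ
ℂ-+-rawMonoid = record { _≈_ = _≈ᶜ_ ; _∙_ = _+ᶜ_ ; ε = 0ᶜ }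

open RawMonoidDefs ℂ-+-rawMonoid public using () renaming (sum to sumᶜ)

ℂ^ : ℕ → Set
ℂ^ n = Vector ℂ n

_≈ᵛ_ : ℂ^ n → ℂ^ n → Set
v ≈ᵛ w = ∀ i → v i ≈ᶜ w i

_+ᵛ_ : ℂ^ n → ℂ^ n → ℂ^ n
(v +ᵛ w) i = v i +ᶜ w i

_·ᵛ_ : ℂ → ℂ^ n → ℂ^ n
(z ·ᵛ v) i = z *ᶜ v i

0ᵛ : ℂ^ n
0ᵛ _ = 0ᶜ

‖_‖² : ℂ^ n → ℝ
‖ v ‖² = sumʳ (λ i → re (v i) *ʳ re (v i) +ʳ im (v i) *ʳ im (v i))

Matrix : ℕ → Set
Matrix n = Fin n → Fin n → ℂ

infix  4 _≈ᴹ_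
infixl 7 _*ᴹ_ _⊗_
infix  8 _†

_≈ᴹ_ : Matrix n → Matrix n → Set
A ≈ᴹ B = ∀ i j → A i j ≈ᶜ B i j

1ᴹ : Matrix n
1ᴹ i j = if does (i ≟ j) then 1ᶜ else 0ᶜ

_*ᴹ_ : Matrix n → Matrix n → Matrix n
(A *ᴹ B) i k = sumᶜ (λ j → A i j *ᶜ B j k)

_† : Matrix n → Matrix n
(A †) i j = conj (A j i)

_*ᵛ_ : Matrix n → ℂ^ n → ℂ^ n
(A *ᵛ v) i = sumᶜ (λ j → A i j *ᶜ v j)

-- The tensor product of operators, in the product basis e_a ⊗ e_b
-- enumerated by combine a b.
_⊗_ : Matrix m → Matrix n → Matrix (m ℕ.* n)
_⊗_ {m} {n} A B i j = A a a′ *ᶜ B b b′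
  where
  a  = proj₁ (remQuot {m} n i)
  b  = proj₂ (remQuot {m} n i)
  a′ = proj₁ (remQuot {m} n j)
  b′ = proj₂ (remQuot {m} n j)

average : ∀ t .{{_ : ℕ.NonZero t}} → (Fin t → Matrix n) → Matrix n
average t A i j = (fromℚ (+ 1 ℚ./ t) +i 0ʳ) *ᶜ sumᶜ (λ m → A m i j)

-- b ≥ 0 and ‖Av‖ ≤ b‖v‖ for all v, with both sides squared.
BoundedBy : Matrix n → ℝ → Set
BoundedBy A b = 0ʳ ≤ʳ b × (∀ v → ‖ A *ᵛ v ‖² ≤ʳ (b *ʳ b) *ʳ ‖ v ‖²)

-- ‖A‖_op = c, the operator norm being the least b with ‖Av‖ ≤ b‖v‖ for all v.
IsOpNorm : Matrix n → ℝ → Set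
IsOpNorm A c = BoundedBy A c × (∀ b → BoundedBy A b → c ≤ʳ b)

record FiniteGroup c ℓ : Set (lsuc (c ⊔ℓ ℓ)) where
  field
    group : Group c ℓ

  open Group group public

  field
    order       : ℕ
    enumeration : Inverse (Group.setoid group) (≡-setoid (Fin order))

  instance
    order≢0 : ℕ.NonZero order
    order≢0 = nonZeroIndex (Inverse.to enumeration ε)

  element : Fin order → Carrier
  element = Inverse.from enumeration

  NonAbelian : Set (c ⊔ℓ ℓ)
  NonAbelian = ¬ (∀ x y → x ∙ y ≈ y ∙ x)

  TrivialCenter : Set (c ⊔ℓ ℓ)
  TrivialCenter = ∀ z → (∀ x → z ∙ x ≈ x ∙ z) → z ≈ ε

record UnitaryRep (K : FiniteGroup c ℓ) (d : ℕ) : Set (c ⊔ℓ ℓ) where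
  open FiniteGroup K
  field
    ⟦_⟧     : Carrier → Matrix d
    ⟦⟧-cong : ∀ {x y} → x ≈ y → ⟦ x ⟧ ≈ᴹ ⟦ y ⟧
    homo    : ∀ x y → ⟦ x ∙ y ⟧ ≈ᴹ ⟦ x ⟧ *ᴹ ⟦ y ⟧
    ε-homo  : ⟦ ε ⟧ ≈ᴹ 1ᴹ
    unitary : ∀ x → ⟦ x ⟧ † *ᴹ ⟦ x ⟧ ≈ᴹ 1ᴹ × ⟦ x ⟧ *ᴹ ⟦ x ⟧ † ≈ᴹ 1ᴹ

-- Predicates at the lowest level suffice: orbit spans live there.
record IsSubspace (W : Pred (ℂ^ n) 0ℓ) : Set where
  field
    resp : ∀ {v w} → v ≈ᵛ w → W v → W w
    0∈   : W 0ᵛ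
    +∈   : ∀ {v w} → W v → W w → W (v +ᵛ w)
    ·∈   : ∀ z {v} → W v → W (z ·ᵛ v)

module _ {K : FiniteGroup c ℓ} (ρ : UnitaryRep K d) where
  open FiniteGroup K
  open UnitaryRep ρ

  Faithful : Set (c ⊔ℓ ℓ)
  Faithful = Injective _≈_ _≈ᴹ_ ⟦_⟧

  -- The dichotomy "W = 0 or W = ℂ^d" is phrased as "if W ≠ 0 then W = ℂ^d", with
  -- v ≠ 0 as 0 < ‖v‖²: quantified over all W, the disjunction would be equivalent
  -- to excluded middle and no representation could be shown irreducible.
  Irreducible : Set (lsuc 0ℓ ⊔ℓ c)
  Irreducible = 0 ℕ.< d × (∀ W → IsSubspace W → (∀ x {v} → W v → W (⟦ x ⟧ *ᵛ v)) →
    (∃[ v ] W v × 0ʳ <ʳ ‖ v ‖²) → ∀ w → W w)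

  tensorPower : ∀ n → Vector Carrier n → Matrix (d ℕ.^ n)
  tensorPower zero    g = 1ᴹ
  tensorPower (suc n) g = ⟦ g zero ⟧ ⊗ tensorPower n (tail g)

-- Pr[E] ≥ p for the uniform distribution on Fin N. As E need not be decidable, it is
-- measured from inside: some set of outcomes contained in E has proportion at least p.
Pr[_]≥_ : ∀ {N} .{{_ : ℕ.NonZero N}} → Pred (Fin N) ℓ → ℝ → Set ℓ
Pr[_]≥_ {N = N} E p = ∃[ S ] (∀ {ω} → ω ∈ S → E ω) × p ≤ʳ fromℚ (+ ∣ S ∣ ℚ./ N)

-- Outcomes of t elements of K^n: since element and finToFun are bijections, a uniform
-- ω makes the t tuples independent and uniform.
module Sampling (K : FiniteGroup c ℓ) (t n : ℕ) where
  open FiniteGroup K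

  Outcome : Set
  Outcome = Fin ((order ℕ.^ n) ℕ.^ t)

  instance
    order^n≢0 : ℕ.NonZero (order ℕ.^ n)
    order^n≢0 = ℕₚ.m^n≢0 order n

    outcomes≢0 : ℕ.NonZero ((order ℕ.^ n) ℕ.^ t)
    outcomes≢0 = ℕₚ.m^n≢0 (order ℕ.^ n) t

    order^t≢0 : ℕ.NonZero (order ℕ.^ t)
    order^t≢0 = ℕₚ.m^n≢0 order t

  sample : Outcome → Fin t → Vector Carrier n
  sample ω m i = element (finToFun (finToFun ω m) i)

-- Write the t elements of K^n as a t × n array over K. If every column u ∈ K^t occurs at least
-- k times, for a suitable k depending only on |K|, then ρ^n contains a nonzero vector fixed by all
-- t elements, and the average, a contraction, has norm 1. Indeed let K^(K^t) act on the i-th tensor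
-- factor through the coordinate named by the i-th column: all t elements act through this group,
-- and the sum of its operators has trace ∏_u a(c_u), where c_u is the multiplicity of the column u
-- and a(k) = ∑_x χ(x)^k. So it suffices that a(k) ≠ 0 for all large k.
--
-- As K is centerless and ρ faithful, |χ(x)| < d for x ≠ 1 (equality in Cauchy–Schwarz makes ρ(x)
-- scalar), hence χ(x)^m ≠ d^m, and a Vandermonde argument gives in each progression c + m e a term
-- e ≤ |K| with a(c + m e) ≠ 0. Moreover {k : a(k) ≠ 0} is closed under addition, so it contains
-- every k ≥ (|K| + 1)². This explicit threshold is what makes κ constructive: everything else in
-- the argument is a negative statement, or follows from one because ≈ and ≤ on ℝ are ¬¬-stable.
--
-- With M = |K|^t, fewer than k occurrences of a given column happen in at most (n + 1)^k (M − 1)^n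
-- of the M^n arrays, and (1 − 1/M)^n ≤ exp(−n/M) follows from the addition formula for exp.

module Submission where

open import Defs
import Algebra.Properties.CommutativeMonoid.Sum as CommutativeMonoidSum
import Algebra.Properties.CommutativeSemiring.Exp as CommutativeSemiringExp
import Algebra.Properties.Group as GroupProperties
import Algebra.Properties.Semiring.Exp as SemiringExp
import Algebra.Properties.Semiring.Mult as SemiringMult
import Algebra.Properties.Semiring.Sum as SemiringSum
import Algebra.Solver.Ring.NaturalCoefficients.Default as NaturalCoefficients
open import Algebra.Bundles using (CommutativeMonoid; CommutativeRing)
open import Data.Bool.Base using (Bool; true; false; not; if_then_else_)
open import Data.Fin.Base
  using (Fin; zero; suc; combine; finToFun; funToFin; remainder; remQuot; _↑ˡ_; _↑ʳ_)
open import Data.Fin.Permutation as Perm using (Permutation; permutation; _⟨$⟩ˡ_; _⟨$⟩ʳ_)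
import Data.Fin.Properties as Finₚ
open import Data.Fin.Subset using (Subset; _∈_; ∣_∣)
import Data.Integer.Base as ℤ
import Data.Integer.Solver as ℤSolver
open import Data.Nat.Base as ℕ using (ℕ; zero; suc)
import Data.Nat.DivMod as DivMod
import Data.Nat.Properties as ℕₚ
import Data.Nat.Solver as ℕSolver
open import Data.Product using (∃-syntax; _×_; _,_; proj₁; proj₂)
open import Data.Rational.Base as ℚ using (ℚ; 0ℚ; 1ℚ; ½)
import Data.Rational.Properties as ℚₚ
open import Data.Rational.Solver using (module +-*-Solver)
import Data.Rational.Unnormalised.Base as ℚᵘ
import Data.Rational.Unnormalised.Properties as ℚᵘₚ
open import Data.Sum.Base using (_⊎_; inj₁; inj₂; [_,_])
import Data.Vec.Base as Vec
open import Data.Vec.Functional using (Vector; tail; _++_)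
import Data.Vec.Properties as Vecₚ
open import Function.Base using (_∘_; id)
open import Function.Bundles using (Inverse)
open import Level using (Level; 0ℓ)
open import Relation.Binary.PropositionalEquality
  using (_≡_; _≢_; refl; sym; trans; cong; cong₂; subst; module ≡-Reasoning)
import Relation.Binary.Reasoning.Setoid
open import Relation.Nullary using (¬_; Dec; does; yes; no; contradiction)

open +-*-Solver using (solve; _:=_; _:+_; _:*_; _:-_; :-_; con)

-- A nonzero fixed vector cannot be exhibited: from a matrix that is not zero, no nonzero column can
-- be selected without deciding equality on ℝ. So fixed vectors enter only through "not all of them
-- vanish". This suffices for the lower bound on the norm, because a bound b < 1 would give ‖v‖² ≤
-- b²‖v‖² for every fixed v and thereby make all of them zero.
--
-- The closure of {k : a(k) ≠ 0} under addition says that a tensor product of invariant tensors is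
-- invariant. Here a(k) is |K| times the dimension of the invariants of ρ^⊗k; it is treated as the
-- trace of an unnormalised projection, so that neither dimensions nor bases of invariants are
-- needed. Its vanishing forces the whole projection to vanish because the projection is
-- self-adjoint and the Hermitian form is definite.
--
-- Neither a good modulus m nor a good exponent in a residue class is ever computed. Only the bounds
-- on them matter, and these alone determine the threshold.

private
  module ℕS = ℕSolver.+-*-Solver
  module ℤS = ℤSolver.+-*-Solver

-- Real and complex numbers

infix 4 _≋_

-- Termwise equality of the representing sequences. The ring laws hold at this level, so they are
-- inherited from ℚ without any ε.
_≋_ : ℝ → ℝ → Set
x ≋ y = ∀ i → seq x i ≡ seq y i

≋⇒≈ʳ : ∀ {x y} → x ≋ y → x ≈ʳ y
≋⇒≈ʳ {x} {y} x≋y = mk≈ λ ε 0<ε → 0 , λ i _ →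
  subst (λ z → ℚ.∣ z ∣ ℚ.< ε)
    (trans (sym (ℚₚ.+-inverseʳ (seq y i))) (cong (ℚ._- seq y i) (sym (x≋y i)))) 0<ε

≈ʳ-refl : ∀ {x} → x ≈ʳ x
≈ʳ-refl = ≋⇒≈ʳ (λ _ → refl)

∣p-q∣≡∣q-p∣ : ∀ p q → ℚ.∣ p ℚ.- q ∣ ≡ ℚ.∣ q ℚ.- p ∣
∣p-q∣≡∣q-p∣ p q = trans (sym (ℚₚ.∣-p∣≡∣p∣ (p ℚ.- q)))
    (cong ℚ.∣_∣ (solve 2 (λ a b → :- (a :- b) := b :- a) refl p q))

≈ʳ-sym : ∀ {x y} → x ≈ʳ y → y ≈ʳ x
≈ʳ-sym {x} {y} (mk≈ x≈y) = mk≈ λ ε 0<ε → let N , b = x≈y ε 0<ε in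
  N , λ i N≤i → subst (ℚ._< ε) (∣p-q∣≡∣q-p∣ (seq x i) (seq y i)) (b i N≤i)

∣p-r∣<ε : ∀ {ε} p q r → ℚ.∣ p ℚ.- q ∣ ℚ.< ½ ℚ.* ε → ℚ.∣ q ℚ.- r ∣ ℚ.< ½ ℚ.* ε → ℚ.∣ p ℚ.- r ∣ ℚ.< ε
∣p-r∣<ε {ε} p q r h₁ h₂ = begin-strict
  ℚ.∣ p ℚ.- r ∣
    ≡⟨ cong ℚ.∣_∣ (solve 3 (λ a b c → a :- c := (a :- b) :+ (b :- c)) refl p q r) ⟩
  ℚ.∣ (p ℚ.- q) ℚ.+ (q ℚ.- r) ∣       ≤⟨ ℚₚ.∣p+q∣≤∣p∣+∣q∣ (p ℚ.- q) (q ℚ.- r) ⟩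
  ℚ.∣ p ℚ.- q ∣ ℚ.+ ℚ.∣ q ℚ.- r ∣     <⟨ ℚₚ.+-mono-< h₁ h₂ ⟩
  ½ ℚ.* ε ℚ.+ ½ ℚ.* ε                 ≡⟨ ½*+½* ε ⟩
  ε ∎
  where open ℚₚ.≤-Reasoning

≈ʳ-trans : ∀ {x y z} → x ≈ʳ y → y ≈ʳ z → x ≈ʳ z
≈ʳ-trans {x} {y} {z} (mk≈ x≈y) (mk≈ y≈z) = mk≈ λ ε 0<ε →
  let M , b = x≈y (½ ℚ.* ε) (½*-pos 0<ε)
      N , c = y≈z (½ ℚ.* ε) (½*-pos 0<ε)
  in M ℕ.⊔ N , λ i h → ∣p-r∣<ε (seq x i) (seq y i) (seq z i)
       (b i (ℕₚ.m⊔n≤o⇒m≤o M N h)) (c i (ℕₚ.m⊔n≤o⇒n≤o M N h))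

+ʳ-cong : ∀ {x y u v} → x ≈ʳ y → u ≈ʳ v → x +ʳ u ≈ʳ y +ʳ v
+ʳ-cong {x} {y} {u} {v} (mk≈ x≈y) (mk≈ u≈v) = mk≈ λ ε 0<ε →
  let M , b = x≈y (½ ℚ.* ε) (½*-pos 0<ε)
      N , c = u≈v (½ ℚ.* ε) (½*-pos 0<ε)
  in M ℕ.⊔ N , λ i h → ∣p-r∣<ε (seq x i ℚ.+ seq u i) (seq y i ℚ.+ seq u i) (seq y i ℚ.+ seq v i)
       (subst (ℚ._< ½ ℚ.* ε) (cong ℚ.∣_∣
          (solve 3 (λ a b c → a :- b := (a :+ c) :- (b :+ c)) refl (seq x i) (seq y i) (seq u i)))
          (b i (ℕₚ.m⊔n≤o⇒m≤o M N h)))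
       (subst (ℚ._< ½ ℚ.* ε) (cong ℚ.∣_∣
          (solve 3 (λ a b c → a :- b := (c :+ a) :- (c :+ b)) refl (seq u i) (seq v i) (seq y i)))
          (c i (ℕₚ.m⊔n≤o⇒n≤o M N h)))

-ʳ-cong : ∀ {x y} → x ≈ʳ y → -ʳ x ≈ʳ -ʳ y
-ʳ-cong {x} {y} (mk≈ x≈y) = mk≈ λ ε 0<ε → let N , b = x≈y ε 0<ε in
  N , λ i N≤i → subst (ℚ._< ε)
    (trans (∣p-q∣≡∣q-p∣ (seq x i) (seq y i))
      (cong ℚ.∣_∣ (solve 2 (λ a b → b :- a := (:- a) :- (:- b)) refl (seq x i) (seq y i))))
    (b i N≤i)

*ʳ-cong : ∀ {x y u v} → x ≈ʳ y → u ≈ʳ v → x *ʳ u ≈ʳ y *ʳ v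
*ʳ-cong {x} {y} {u} {v} (mk≈ x≈y) (mk≈ u≈v) = mk≈ λ ε 0<ε →
  let A , 0<A , M , bx = eventually-bounded {seq x} (cauchy x)
      B , 0<B , N , bv = eventually-bounded {seq v} (cauchy v)
      δ , 0<δ , eq     = divide {A ℚ.+ B} {ε} (ℚₚ.+-mono-< {0ℚ} {A} {0ℚ} {B} 0<A 0<B) 0<ε
      P , bxy = x≈y δ 0<δ
      Q , buv = u≈v δ 0<δ
  in (M ℕ.⊔ N) ℕ.⊔ (P ℕ.⊔ Q) , λ i h →
     let MN = ℕₚ.m⊔n≤o⇒m≤o (M ℕ.⊔ N) (P ℕ.⊔ Q) h
         PQ = ℕₚ.m⊔n≤o⇒n≤o (M ℕ.⊔ N) (P ℕ.⊔ Q) h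
     in subst (ℚ.∣ seq x i ℚ.* seq u i ℚ.- seq y i ℚ.* seq v i ∣ ℚ.<_) eq
          (*-diff-bound {A} {B} {δ} (seq x i) (seq u i) (seq y i) (seq v i) 0<A 0<B
            (bx i (ℕₚ.m⊔n≤o⇒m≤o M N MN)) (bv i (ℕₚ.m⊔n≤o⇒n≤o M N MN))
            (bxy i (ℕₚ.m⊔n≤o⇒m≤o P Q PQ)) (buv i (ℕₚ.m⊔n≤o⇒n≤o P Q PQ)))

ℝ-commutativeRing : CommutativeRing 0ℓ 0ℓ
ℝ-commutativeRing = record
  { Carrier = ℝ ; _≈_ = _≈ʳ_ ; _+_ = _+ʳ_ ; _*_ = _*ʳ_ ; -_ = -ʳ_ ; 0# = 0ʳ ; 1# = 1ʳ
  ; isCommutativeRing = record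
    { isRing = record
      { +-isAbelianGroup = record
        { isGroup = record
          { isMonoid = record
            { isSemigroup = record
              { isMagma = record
                { isEquivalence = record { refl = ≈ʳ-refl ; sym = ≈ʳ-sym ; trans = ≈ʳ-trans }
                ; ∙-cong = +ʳ-cong }
              ; assoc = λ x y z → ≋⇒≈ʳ (λ i → ℚₚ.+-assoc (seq x i) (seq y i) (seq z i)) }
            ; identity = (λ x → ≋⇒≈ʳ (λ i → ℚₚ.+-identityˡ (seq x i)))
                       , (λ x → ≋⇒≈ʳ (λ i → ℚₚ.+-identityʳ (seq x i))) }
          ; inverse = (λ x → ≋⇒≈ʳ (λ i → ℚₚ.+-inverseˡ (seq x i)))
                    , (λ x → ≋⇒≈ʳ (λ i → ℚₚ.+-inverseʳ (seq x i)))
          ; ⁻¹-cong = -ʳ-cong }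
        ; comm = λ x y → ≋⇒≈ʳ (λ i → ℚₚ.+-comm (seq x i) (seq y i)) }
      ; *-cong = *ʳ-cong
      ; *-assoc = λ x y z → ≋⇒≈ʳ (λ i → ℚₚ.*-assoc (seq x i) (seq y i) (seq z i))
      ; *-identity = (λ x → ≋⇒≈ʳ (λ i → ℚₚ.*-identityˡ (seq x i)))
                   , (λ x → ≋⇒≈ʳ (λ i → ℚₚ.*-identityʳ (seq x i)))
      ; distrib = (λ x y z → ≋⇒≈ʳ (λ i → ℚₚ.*-distribˡ-+ (seq x i) (seq y i) (seq z i)))
                , (λ x y z → ≋⇒≈ʳ (λ i → ℚₚ.*-distribʳ-+ (seq x i) (seq y i) (seq z i))) }
    ; *-comm = λ x y → ≋⇒≈ʳ (λ i → ℚₚ.*-comm (seq x i) (seq y i)) } }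

-- A real is eventually within ε of 0 or bounded away from 0: its modulus of convergence
-- at ε/4 decides which.
small-or-apart : ∀ x ε → 0ℚ ℚ.< ε →
  (∃[ N ] ∀ i → N ℕ.≤ i → ℚ.∣ seq x i ∣ ℚ.< ε) ⊎
  (∃[ δ ] 0ℚ ℚ.< δ × ∃[ N ] ∀ i → N ℕ.≤ i → δ ℚ.≤ ℚ.∣ seq x i ∣)
small-or-apart x ε 0<ε = go (cauchy x (½ ℚ.* (½ ℚ.* ε)) 0<ε/4)
  where
  open ℚₚ.≤-Reasoning
  0<ε/4 = ½*-pos (½*-pos 0<ε)
  go : (∃[ N ] ∀ i j → N ℕ.≤ i → N ℕ.≤ j → ℚ.∣ seq x i ℚ.- seq x j ∣ ℚ.< ½ ℚ.* (½ ℚ.* ε)) → _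
  go (N , b) with ℚ.∣ seq x N ∣ ℚₚ.<? (½ ℚ.* ε)
  ... | yes small = inj₁ (N , λ i N≤i → begin-strict
    ℚ.∣ seq x i ∣
      ≡⟨ cong ℚ.∣_∣ (solve 2 (λ a b → a := (a :- b) :+ b) refl (seq x i) (seq x N)) ⟩
    ℚ.∣ (seq x i ℚ.- seq x N) ℚ.+ seq x N ∣     ≤⟨ ℚₚ.∣p+q∣≤∣p∣+∣q∣ (seq x i ℚ.- seq x N) (seq x N) ⟩
    ℚ.∣ seq x i ℚ.- seq x N ∣ ℚ.+ ℚ.∣ seq x N ∣ <⟨ ℚₚ.+-mono-< (b i N N≤i ℕₚ.≤-refl) small ⟩
    ½ ℚ.* (½ ℚ.* ε) ℚ.+ ½ ℚ.* ε
      ≤⟨ ℚₚ.+-monoʳ-≤ (½ ℚ.* (½ ℚ.* ε)) (ℚₚ.≤-trans (ℚₚ.≤-reflexive (sym (ℚₚ.+-identityˡ _)))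
          (ℚₚ.+-monoˡ-≤ (½ ℚ.* ε) (ℚₚ.<⇒≤ 0<ε/4))) ⟩
    ½ ℚ.* (½ ℚ.* ε) ℚ.+ (½ ℚ.* (½ ℚ.* ε) ℚ.+ ½ ℚ.* ε)
      ≡⟨ solve 1 (λ e → con ½ :* (con ½ :* e) :+ (con ½ :* (con ½ :* e) :+ con ½ :* e) := e) refl ε ⟩
    ε ∎)
  ... | no ¬small = inj₂ (½ ℚ.* (½ ℚ.* ε) , 0<ε/4 , N , λ i N≤i → begin
    ½ ℚ.* (½ ℚ.* ε)
      ≡⟨ solve 1 (λ e → con ½ :* (con ½ :* e) := con ½ :* e :- con ½ :* (con ½ :* e)) refl ε ⟩
    ½ ℚ.* ε ℚ.- ½ ℚ.* (½ ℚ.* ε)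
      ≤⟨ ℚₚ.+-mono-≤ (ℚₚ.≮⇒≥ ¬small) (ℚₚ.neg-antimono-≤ (ℚₚ.<⇒≤ (b N i ℕₚ.≤-refl N≤i))) ⟩
    ℚ.∣ seq x N ∣ ℚ.- ℚ.∣ seq x N ℚ.- seq x i ∣
      ≤⟨ ℚₚ.+-monoˡ-≤ (ℚ.- ℚ.∣ seq x N ℚ.- seq x i ∣) (ℚₚ.≤-trans (ℚₚ.≤-reflexive (cong ℚ.∣_∣
           (solve 2 (λ a b → b := a :+ (b :- a)) refl (seq x i) (seq x N))))
           (ℚₚ.∣p+q∣≤∣p∣+∣q∣ (seq x i) (seq x N ℚ.- seq x i))) ⟩
    (ℚ.∣ seq x i ∣ ℚ.+ ℚ.∣ seq x N ℚ.- seq x i ∣) ℚ.- ℚ.∣ seq x N ℚ.- seq x i ∣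
      ≡⟨ solve 2 (λ a b → (a :+ b) :- b := a) refl ℚ.∣ seq x i ∣ ℚ.∣ seq x N ℚ.- seq x i ∣ ⟩
    ℚ.∣ seq x i ∣ ∎)

-0ℚ : ∀ p → p ℚ.- 0ℚ ≡ p
-0ℚ = solve 1 (λ a → a :- con 0ℚ := a) refl

≈0-intro : ∀ x → (∀ ε → 0ℚ ℚ.< ε → ∃[ N ] ∀ i → N ℕ.≤ i → ℚ.∣ seq x i ∣ ℚ.< ε) → x ≈ʳ 0ʳ
≈0-intro x h = mk≈ λ ε 0<ε → let N , b = h ε 0<ε in
  N , λ i N≤i → subst (ℚ._< ε) (cong ℚ.∣_∣ (sym (-0ℚ (seq x i)))) (b i N≤i)

≈0-elim : ∀ x → x ≈ʳ 0ʳ → ∀ ε → 0ℚ ℚ.< ε → ∃[ N ] ∀ i → N ℕ.≤ i → ℚ.∣ seq x i ∣ ℚ.< ε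
≈0-elim x (mk≈ h) ε 0<ε = let N , b = h ε 0<ε in
  N , λ i N≤i → subst (ℚ._< ε) (cong ℚ.∣_∣ (-0ℚ (seq x i))) (b i N≤i)

apart⇒≉0 : ∀ x → (∃[ δ ] 0ℚ ℚ.< δ × ∃[ N ] ∀ i → N ℕ.≤ i → δ ℚ.≤ ℚ.∣ seq x i ∣) → ¬ x ≈ʳ 0ʳ
apart⇒≉0 x (δ , 0<δ , N , b) x≈0 with ≈0-elim x x≈0 δ 0<δ
... | M , c = ℚₚ.<-irrefl refl (ℚₚ.<-≤-trans (c (M ℕ.⊔ N) (ℕₚ.m≤m⊔n M N)) (b (M ℕ.⊔ N) (ℕₚ.m≤n⊔m M N)))

-- Being zero is a statement about each ε separately, and at each ε `small-or-apart` decides; its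
-- second alternative is refuted by the double negation.
≈0-stable : ∀ x → ¬ ¬ x ≈ʳ 0ʳ → x ≈ʳ 0ʳ
≈0-stable x ¬¬x≈0 = ≈0-intro x λ ε 0<ε → [ id , (λ a → contradiction (apart⇒≉0 x a) ¬¬x≈0) ]
    (small-or-apart x ε 0<ε)

*-apart⇒≈0 : ∀ x y → (∃[ δ ] 0ℚ ℚ.< δ × ∃[ N ] ∀ i → N ℕ.≤ i → δ ℚ.≤ ℚ.∣ seq x i ∣) →
  x *ʳ y ≈ʳ 0ʳ → y ≈ʳ 0ʳ
*-apart⇒≈0 x y (δ , 0<δ , N , b) xy≈0 = ≈0-intro y λ ε 0<ε →
  let M , c = ≈0-elim (x *ʳ y) xy≈0 (δ ℚ.* ε)
                (ℚₚ.positive⁻¹ _ {{ℚₚ.pos*pos⇒pos δ {{ℚ.positive 0<δ}} ε {{ℚ.positive 0<ε}}}})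
  in M ℕ.⊔ N , λ i h → ℚₚ.*-cancelˡ-<-nonNeg δ {{ℚ.nonNegative (ℚₚ.<⇒≤ 0<δ)}} (begin-strict
       δ ℚ.* ℚ.∣ seq y i ∣
         ≤⟨ ℚₚ.*-monoʳ-≤-nonNeg ℚ.∣ seq y i ∣ {{ℚₚ.∣-∣-nonNeg (seq y i)}} (b i (ℕₚ.m⊔n≤o⇒n≤o M N h)) ⟩
       ℚ.∣ seq x i ∣ ℚ.* ℚ.∣ seq y i ∣ ≡⟨ ℚₚ.∣p*q∣≡∣p∣*∣q∣ (seq x i) (seq y i) ⟨
       ℚ.∣ seq x i ℚ.* seq y i ∣       <⟨ c i (ℕₚ.m⊔n≤o⇒m≤o M N h) ⟩
       δ ℚ.* ε                         ∎)
  where open ℚₚ.≤-Reasoning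

-- `x ≉ 0` yields no positive lower bound on |x|, so nothing can be divided out. Instead, for every
-- ε either x is small or it is apart from 0, and the latter would force y ≈ 0; hence x ≈ 0 after
-- all.
*ʳ-≉0 : ∀ {x y} → ¬ x ≈ʳ 0ʳ → ¬ y ≈ʳ 0ʳ → ¬ x *ʳ y ≈ʳ 0ʳ
*ʳ-≉0 {x} {y} x≉0 y≉0 xy≈0 = x≉0 (≈0-intro x λ ε 0<ε →
  [ id , (λ a → contradiction (*-apart⇒≈0 x y a xy≈0) y≉0) ] (small-or-apart x ε 0<ε))

0≤p*p : ∀ p → 0ℚ ℚ.≤ p ℚ.* p
0≤p*p p = ℚₚ.≤-trans (ℚₚ.≤-reflexive (sym (ℚₚ.*-zeroʳ ℚ.∣ p ∣)))
  (ℚₚ.≤-trans (ℚₚ.*-monoˡ-≤-nonNeg ℚ.∣ p ∣ {{ℚₚ.∣-∣-nonNeg p}} (ℚₚ.0≤∣p∣ p))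
    (ℚₚ.≤-reflexive (∣p∣*∣p∣ p)))
  where
  ∣p∣*∣p∣ : ∀ p → ℚ.∣ p ∣ ℚ.* ℚ.∣ p ∣ ≡ p ℚ.* p
  ∣p∣*∣p∣ p with ℚₚ.∣p∣≡p∨∣p∣≡-p p
  ... | inj₁ eq = cong₂ ℚ._*_ eq eq
  ... | inj₂ eq = trans (cong₂ ℚ._*_ eq eq) (solve 1 (λ a → (:- a) :* (:- a) := a :* a) refl p)

≤-squeeze : ∀ {x y} → (∀ i → ℚ.∣ seq x i ∣ ℚ.≤ ℚ.∣ seq y i ∣) → y ≈ʳ 0ʳ → x ≈ʳ 0ʳ
≤-squeeze {x} {y} x≤y y≈0 = ≈0-intro x λ ε 0<ε → let N , b = ≈0-elim y y≈0 ε 0<ε in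
  N , λ i N≤i → ℚₚ.≤-<-trans (x≤y i) (b i N≤i)

square-≈0 : ∀ {x} → x *ʳ x ≈ʳ 0ʳ → x ≈ʳ 0ʳ
square-≈0 {x} xx≈0 = ≈0-stable x λ x≉0 → *ʳ-≉0 x≉0 x≉0 xx≈0

≋⇒≈ᶜ : ∀ {z w} → re z ≋ re w → im z ≋ im w → z ≈ᶜ w
≋⇒≈ᶜ p q = ≋⇒≈ʳ p , ≋⇒≈ʳ q

≈ᶜ-refl : ∀ {z} → z ≈ᶜ z
≈ᶜ-refl = ≈ʳ-refl , ≈ʳ-refl

≈ᶜ-sym : ∀ {z w} → z ≈ᶜ w → w ≈ᶜ z
≈ᶜ-sym (p , q) = ≈ʳ-sym p , ≈ʳ-sym q

≈ᶜ-trans : ∀ {z w v} → z ≈ᶜ w → w ≈ᶜ v → z ≈ᶜ v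
≈ᶜ-trans (p , q) (r , s) = ≈ʳ-trans p r , ≈ʳ-trans q s

*ᶜ-cong : ∀ {z w u v} → z ≈ᶜ w → u ≈ᶜ v → z *ᶜ u ≈ᶜ w *ᶜ v
*ᶜ-cong (p , q) (r , s) =
  +ʳ-cong (*ʳ-cong p r) (-ʳ-cong (*ʳ-cong q s)) , +ʳ-cong (*ʳ-cong p s) (*ʳ-cong q r)

*ᶜ-assoc : ∀ z w v → (z *ᶜ w) *ᶜ v ≈ᶜ z *ᶜ (w *ᶜ v)
*ᶜ-assoc z w v = ≋⇒≈ᶜ
  (λ i → solve 6 (λ a b c d e f → (a :* c :- b :* d) :* e :- (a :* d :+ b :* c) :* f
                               := a :* (c :* e :- d :* f) :- b :* (c :* f :+ d :* e)) refl
           (seq (re z) i) (seq (im z) i) (seq (re w) i) (seq (im w) i) (seq (re v) i) (seq (im v) i))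
  (λ i → solve 6 (λ a b c d e f → (a :* c :- b :* d) :* f :+ (a :* d :+ b :* c) :* e
                               := a :* (c :* f :+ d :* e) :+ b :* (c :* e :- d :* f)) refl
           (seq (re z) i) (seq (im z) i) (seq (re w) i) (seq (im w) i) (seq (re v) i) (seq (im v) i))

*ᶜ-comm : ∀ z w → z *ᶜ w ≈ᶜ w *ᶜ z
*ᶜ-comm z w = ≋⇒≈ᶜ
  (λ i → solve 4 (λ a b c d → a :* c :- b :* d := c :* a :- d :* b) refl
           (seq (re z) i) (seq (im z) i) (seq (re w) i) (seq (im w) i))
  (λ i → solve 4 (λ a b c d → a :* d :+ b :* c := c :* b :+ d :* a) refl
           (seq (re z) i) (seq (im z) i) (seq (re w) i) (seq (im w) i))

*ᶜ-identityˡ : ∀ z → 1ᶜ *ᶜ z ≈ᶜ z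
*ᶜ-identityˡ z = ≋⇒≈ᶜ
  (λ i → solve 2 (λ a b → con 1ℚ :* a :- con 0ℚ :* b := a) refl (seq (re z) i) (seq (im z) i))
  (λ i → solve 2 (λ a b → con 1ℚ :* b :+ con 0ℚ :* a := b) refl (seq (re z) i) (seq (im z) i))

*ᶜ-distribˡ : ∀ z w v → z *ᶜ (w +ᶜ v) ≈ᶜ z *ᶜ w +ᶜ z *ᶜ v
*ᶜ-distribˡ z w v = ≋⇒≈ᶜ
  (λ i → solve 6 (λ a b c d e f → a :* (c :+ e) :- b :* (d :+ f)
                               := (a :* c :- b :* d) :+ (a :* e :- b :* f)) refl
           (seq (re z) i) (seq (im z) i) (seq (re w) i) (seq (im w) i) (seq (re v) i) (seq (im v) i))
  (λ i → solve 6 (λ a b c d e f → a :* (d :+ f) :+ b :* (c :+ e)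
                               := (a :* d :+ b :* c) :+ (a :* f :+ b :* e)) refl
           (seq (re z) i) (seq (im z) i) (seq (re w) i) (seq (im w) i) (seq (re v) i) (seq (im v) i))

ℂ-commutativeRing : CommutativeRing 0ℓ 0ℓ
ℂ-commutativeRing = record
  { Carrier = ℂ ; _≈_ = _≈ᶜ_ ; _+_ = _+ᶜ_ ; _*_ = _*ᶜ_ ; 0# = 0ᶜ ; 1# = 1ᶜ
  ; -_ = λ z → (-ʳ re z) +i (-ʳ im z)
  ; isCommutativeRing = record
    { isRing = record
      { +-isAbelianGroup = record
        { isGroup = record
          { isMonoid = record
            { isSemigroup = record
              { isMagma = record
                { isEquivalence = record { refl = ≈ᶜ-refl ; sym = ≈ᶜ-sym ; trans = ≈ᶜ-trans }
                ; ∙-cong = λ (p , q) (r , s) → +ʳ-cong p r , +ʳ-cong q s }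
              ; assoc = λ z w v → ℝR.+-assoc (re z) (re w) (re v) , ℝR.+-assoc (im z) (im w) (im v) }
            ; identity = (λ z → ℝR.+-identityˡ (re z) , ℝR.+-identityˡ (im z))
                       , (λ z → ℝR.+-identityʳ (re z) , ℝR.+-identityʳ (im z)) }
          ; inverse = (λ z → ℝR.-‿inverseˡ (re z) , ℝR.-‿inverseˡ (im z))
                    , (λ z → ℝR.-‿inverseʳ (re z) , ℝR.-‿inverseʳ (im z))
          ; ⁻¹-cong = λ (p , q) → -ʳ-cong p , -ʳ-cong q }
        ; comm = λ z w → ℝR.+-comm (re z) (re w) , ℝR.+-comm (im z) (im w) }
      ; *-cong = *ᶜ-cong
      ; *-assoc = *ᶜ-assoc
      ; *-identity = *ᶜ-identityˡ , (λ z → ≈ᶜ-trans (*ᶜ-comm z 1ᶜ) (*ᶜ-identityˡ z))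
      ; distrib = *ᶜ-distribˡ
                , (λ z w v → ≈ᶜ-trans (*ᶜ-comm (w +ᶜ v) z) (≈ᶜ-trans (*ᶜ-distribˡ z w v)
                    (+ᶜ-cong (*ᶜ-comm z w) (*ᶜ-comm z v)))) }
    ; *-comm = *ᶜ-comm } }
  where
  module ℝR = CommutativeRing ℝ-commutativeRing
  +ᶜ-cong : ∀ {z w u v} → z ≈ᶜ w → u ≈ᶜ v → z +ᶜ u ≈ᶜ w +ᶜ v
  +ᶜ-cong (p , q) (r , s) = +ʳ-cong p r , +ʳ-cong q s

module ℂR = CommutativeRing ℂ-commutativeRing
open SemiringExp ℂR.semiring using () renaming (_^_ to _^ᶜ_)
open SemiringMult ℂR.semiring using () renaming (_×_ to _×ᶜ_)

conj-cong : ∀ {z w} → z ≈ᶜ w → conj z ≈ᶜ conj w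
conj-cong (p , q) = p , -ʳ-cong q

conj-+ : ∀ z w → conj (z +ᶜ w) ≈ᶜ conj z +ᶜ conj w
conj-+ z w = ≋⇒≈ᶜ (λ _ → refl) (λ i → ℚₚ.neg-distrib-+ (seq (im z) i) (seq (im w) i))

conj-* : ∀ z w → conj (z *ᶜ w) ≈ᶜ conj z *ᶜ conj w
conj-* z w = ≋⇒≈ᶜ
  (λ i → solve 4 (λ a b c d → a :* c :- b :* d := a :* c :- (:- b) :* (:- d)) refl
           (seq (re z) i) (seq (im z) i) (seq (re w) i) (seq (im w) i))
  (λ i → solve 4 (λ a b c d → :- (a :* d :+ b :* c) := a :* (:- d) :+ (:- b) :* c) refl
           (seq (re z) i) (seq (im z) i) (seq (re w) i) (seq (im w) i))

conj-involutive : ∀ z → conj (conj z) ≈ᶜ z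
conj-involutive z = ≋⇒≈ᶜ (λ _ → refl)
  (λ i → solve 1 (λ a → :- (:- a) := a) refl (seq (im z) i))

abs² : ℂ → ℝ
abs² z = re z *ʳ re z +ʳ im z *ʳ im z

re-*-conj : ∀ z → re (z *ᶜ conj z) ≋ abs² z
re-*-conj z i = solve 2 (λ a b → a :* a :- b :* (:- b) := a :* a :+ b :* b) refl
  (seq (re z) i) (seq (im z) i)

im-*-conj : ∀ z → im (z *ᶜ conj z) ≋ 0ʳ
im-*-conj z i = solve 2 (λ a b → a :* (:- b) :+ b :* a := con 0ℚ) refl
  (seq (re z) i) (seq (im z) i)

0≤p+q : ∀ {p q} → 0ℚ ℚ.≤ p → 0ℚ ℚ.≤ q → 0ℚ ℚ.≤ p ℚ.+ q
0≤p+q = ℚₚ.+-mono-≤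

0≤q-p : ∀ {p q} → p ℚ.≤ q → 0ℚ ℚ.≤ q ℚ.- p
0≤q-p {p} {q} p≤q = ℚₚ.≤-trans (ℚₚ.≤-reflexive (sym (ℚₚ.+-inverseʳ p))) (ℚₚ.+-monoˡ-≤ (ℚ.- p) p≤q)

p≤p+q : ∀ {p q} → 0ℚ ℚ.≤ q → p ℚ.≤ p ℚ.+ q
p≤p+q {p} 0≤q = ℚₚ.≤-trans (ℚₚ.≤-reflexive (sym (ℚₚ.+-identityʳ p))) (ℚₚ.+-monoʳ-≤ p 0≤q)

p≤q+p : ∀ {p q} → 0ℚ ℚ.≤ q → p ℚ.≤ q ℚ.+ p
p≤q+p {p} {q} 0≤q = ℚₚ.≤-trans (p≤p+q 0≤q) (ℚₚ.≤-reflexive (ℚₚ.+-comm p q))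

0≤abs² : ∀ z i → 0ℚ ℚ.≤ seq (abs² z) i
0≤abs² z i = 0≤p+q (0≤p*p (seq (re z) i)) (0≤p*p (seq (im z) i))

-- Termwise, hence stronger than `0ʳ ≤ʳ x`. Sums of squares have this property, and it passes
-- through sums with no ε.
Nonneg : ℝ → Set
Nonneg x = ∀ i → 0ℚ ℚ.≤ seq x i

sumʳ-nonneg : ∀ {n} (f : Vector ℝ n) → (∀ j → Nonneg (f j)) → Nonneg (sumʳ f)
sumʳ-nonneg {zero}  f 0≤f i = ℚₚ.≤-refl
sumʳ-nonneg {suc n} f 0≤f i = 0≤p+q (0≤f zero i) (sumʳ-nonneg (f ∘ suc) (0≤f ∘ suc) i)

term≤sumʳ : ∀ {n} (f : Vector ℝ n) → (∀ j → Nonneg (f j)) → ∀ j i → seq (f j) i ℚ.≤ seq (sumʳ f) i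
term≤sumʳ f 0≤f zero    i = p≤p+q (sumʳ-nonneg (f ∘ suc) (0≤f ∘ suc) i)
term≤sumʳ f 0≤f (suc j) i = ℚₚ.≤-trans (term≤sumʳ (f ∘ suc) (0≤f ∘ suc) j i) (p≤q+p (0≤f zero i))

p≤∣p∣ : ∀ p → p ℚ.≤ ℚ.∣ p ∣
p≤∣p∣ p with ℚₚ.≤-total 0ℚ p
... | inj₁ 0≤p = ℚₚ.≤-reflexive (sym (ℚₚ.0≤p⇒∣p∣≡p 0≤p))
... | inj₂ p≤0 = ℚₚ.≤-trans p≤0 (ℚₚ.0≤∣p∣ p)

∣∣-mono : ∀ {p q} → 0ℚ ℚ.≤ p → p ℚ.≤ q → ℚ.∣ p ∣ ℚ.≤ ℚ.∣ q ∣
∣∣-mono {p} {q} 0≤p p≤q = ℚₚ.≤-trans (ℚₚ.≤-reflexive (ℚₚ.0≤p⇒∣p∣≡p 0≤p))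
  (ℚₚ.≤-trans p≤q (ℚₚ.≤-reflexive (sym (ℚₚ.0≤p⇒∣p∣≡p (ℚₚ.≤-trans 0≤p p≤q)))))

abs²≈0⇒≈0 : ∀ z → abs² z ≈ʳ 0ʳ → z ≈ᶜ 0ᶜ
abs²≈0⇒≈0 z h =
  square-≈0 (≤-squeeze (λ i → ∣∣-mono (0≤p*p (seq (re z) i)) (p≤p+q (0≤p*p (seq (im z) i)))) h) ,
  square-≈0 (≤-squeeze (λ i → ∣∣-mono (0≤p*p (seq (im z) i)) (p≤q+p (0≤p*p (seq (re z) i)))) h)

re-sumᶜ : ∀ {n} (f : Vector ℂ n) → re (sumᶜ f) ≡ sumʳ (re ∘ f)
re-sumᶜ {zero}  f = refl
re-sumᶜ {suc n} f = cong (re (f zero) +ʳ_) (re-sumᶜ (f ∘ suc))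

sumʳ-cong-≋ : ∀ {n} {f g : Vector ℝ n} → (∀ j → f j ≋ g j) → sumʳ f ≋ sumʳ g
sumʳ-cong-≋ {zero}  f≋g i = refl
sumʳ-cong-≋ {suc n} f≋g i = cong₂ ℚ._+_ (f≋g zero i) (sumʳ-cong-≋ (f≋g ∘ suc) i)

‖‖²-≋ : ∀ {n} (v : ℂ^ n) → re (sumᶜ (λ j → v j *ᶜ conj (v j))) ≋ ‖ v ‖²
‖‖²-≋ v i = trans (cong (λ x → seq x i) (re-sumᶜ (λ j → v j *ᶜ conj (v j))))
  (sumʳ-cong-≋ (λ j → re-*-conj (v j)) i)

‖‖²≈0⇒≈0 : ∀ {n} (v : ℂ^ n) → ‖ v ‖² ≈ʳ 0ʳ → ∀ j → v j ≈ᶜ 0ᶜ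
‖‖²≈0⇒≈0 v h j = abs²≈0⇒≈0 (v j)
  (≤-squeeze (λ i → ∣∣-mono (0≤abs² (v j) i) (term≤sumʳ (abs² ∘ v) (λ k → 0≤abs² (v k)) j i)) h)

ℂ-definite : ∀ {n} (v : ℂ^ n) → sumᶜ (λ j → v j *ᶜ conj (v j)) ≈ᶜ 0ᶜ → ∀ j → v j ≈ᶜ 0ᶜ
ℂ-definite v (h , _) = ‖‖²≈0⇒≈0 v (≈ʳ-trans (≈ʳ-sym (≋⇒≈ʳ (‖‖²-≋ v))) h)

ℂ-stable : ∀ {z} → ¬ ¬ z ≈ᶜ 0ᶜ → z ≈ᶜ 0ᶜ
ℂ-stable {z} h = ≈0-stable (re z) (λ k → h (k ∘ proj₁)) , ≈0-stable (im z) (λ k → h (k ∘ proj₂))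

-- Reduces to ℝ by |zw|² = |z|²|w|².
ℂ-*-≉0 : ∀ {z w} → ¬ z ≈ᶜ 0ᶜ → ¬ w ≈ᶜ 0ᶜ → ¬ z *ᶜ w ≈ᶜ 0ᶜ
ℂ-*-≉0 {z} {w} z≉0 w≉0 zw≈0 =
  *ʳ-≉0 {abs² z} {abs² w} (z≉0 ∘ abs²≈0⇒≈0 z) (w≉0 ∘ abs²≈0⇒≈0 w)
    (≈ʳ-trans (≋⇒≈ʳ {abs² z *ʳ abs² w} {abs² (z *ᶜ w)} λ i →
        solve 4 (λ a b c d → (a :* a :+ b :* b) :* (c :* c :+ d :* d)
           := (a :* c :- b :* d) :* (a :* c :- b :* d)
             :+ (a :* d :+ b :* c) :* (a :* d :+ b :* c)) refl
          (seq (re z) i) (seq (im z) i) (seq (re w) i) (seq (im w) i))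
      (≈ʳ-trans (+ʳ-cong (*ʳ-cong (proj₁ zw≈0) (proj₁ zw≈0)) (*ʳ-cong (proj₂ zw≈0) (proj₂ zw≈0)))
        (≋⇒≈ʳ {0ʳ *ʳ 0ʳ +ʳ 0ʳ *ʳ 0ʳ} λ _ → refl)))

-- Powers of rationals and uniqueness of nonnegative roots

module ℚ^ = SemiringExp (CommutativeRing.semiring ℚₚ.+-*-commutativeRing)
open ℚ^ using () renaming (_^_ to _^ℚ_)

1≤^ℚ : ∀ {p} → 1ℚ ℚ.≤ p → ∀ m → 1ℚ ℚ.≤ p ^ℚ m
1≤^ℚ 1≤p zero    = ℚₚ.≤-refl
1≤^ℚ {p} 1≤p (suc m) = ℚₚ.≤-trans 1≤p (ℚₚ.≤-trans (ℚₚ.≤-reflexive (sym (ℚₚ.*-identityʳ p)))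
  (ℚₚ.*-monoˡ-≤-nonNeg p {{ℚ.nonNegative (ℚₚ.≤-trans (ℚₚ.<⇒≤ 0<1) 1≤p)}} (1≤^ℚ 1≤p m)))

0≤p*q : ∀ {p q} → 0ℚ ℚ.≤ p → 0ℚ ℚ.≤ q → 0ℚ ℚ.≤ p ℚ.* q
0≤p*q {p} {q} 0≤p 0≤q = ℚₚ.≤-trans (ℚₚ.≤-reflexive (sym (ℚₚ.*-zeroʳ p)))
  (ℚₚ.*-monoˡ-≤-nonNeg p {{ℚ.nonNegative 0≤p}} 0≤q)

*-mono-≤ℚ : ∀ {p q r s} → 0ℚ ℚ.≤ p → 0ℚ ℚ.≤ r → p ℚ.≤ q → r ℚ.≤ s → p ℚ.* r ℚ.≤ q ℚ.* s
*-mono-≤ℚ {p} {q} {r} {s} 0≤p 0≤r p≤q r≤s =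
  ℚₚ.≤-trans (ℚₚ.*-monoʳ-≤-nonNeg r {{ℚ.nonNegative 0≤r}} p≤q)
             (ℚₚ.*-monoˡ-≤-nonNeg q {{ℚ.nonNegative (ℚₚ.≤-trans 0≤p p≤q)}} r≤s)

0≤^ℚ : ∀ {p} → 0ℚ ℚ.≤ p → ∀ m → 0ℚ ℚ.≤ p ^ℚ m
0≤^ℚ 0≤p zero    = ℚₚ.<⇒≤ 0<1
0≤^ℚ 0≤p (suc m) = 0≤p*q 0≤p (0≤^ℚ 0≤p m)

^ℚ-mono : ∀ {p q} → 0ℚ ℚ.≤ p → p ℚ.≤ q → ∀ m → p ^ℚ m ℚ.≤ q ^ℚ m
^ℚ-mono 0≤p p≤q zero    = ℚₚ.≤-refl
^ℚ-mono 0≤p p≤q (suc m) = *-mono-≤ℚ 0≤p (0≤^ℚ 0≤p m) p≤q (^ℚ-mono 0≤p p≤q m)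

-- q^(m+1) - p^(m+1) ≥ (q - p) q^m ≥ q - p, the last step by q ≥ 1.
diff≤diff-^ℚ : ∀ {p q} → 0ℚ ℚ.≤ p → 1ℚ ℚ.≤ q → p ℚ.≤ q → ∀ m →
  q ℚ.- p ℚ.≤ q ^ℚ suc m ℚ.- p ^ℚ suc m
diff≤diff-^ℚ {p} {q} 0≤p 1≤q p≤q m = begin
  q ℚ.- p                            ≡⟨ ℚₚ.*-identityʳ (q ℚ.- p) ⟨
  (q ℚ.- p) ℚ.* 1ℚ
    ≤⟨ ℚₚ.*-monoˡ-≤-nonNeg (q ℚ.- p) {{ℚ.nonNegative (0≤q-p p≤q)}} (1≤^ℚ 1≤q m) ⟩
  (q ℚ.- p) ℚ.* q ^ℚ m
    ≡⟨ solve 3 (λ a b c → (a :- b) :* c := a :* c :- b :* c) refl q p (q ^ℚ m) ⟩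
  q ℚ.* q ^ℚ m ℚ.- p ℚ.* q ^ℚ m      ≤⟨ ℚₚ.+-monoʳ-≤ (q ℚ.* q ^ℚ m) (ℚₚ.neg-antimono-≤
                                          (ℚₚ.*-monoˡ-≤-nonNeg p {{ℚ.nonNegative 0≤p}} (^ℚ-mono 0≤p p≤q m))) ⟩
  q ℚ.* q ^ℚ m ℚ.- p ℚ.* p ^ℚ m      ∎
  where open ℚₚ.≤-Reasoning

∣diff∣≤∣diff-^ℚ∣ : ∀ {p q} → 0ℚ ℚ.≤ p → 1ℚ ℚ.≤ q → ∀ m →
  ℚ.∣ p ℚ.- q ∣ ℚ.≤ ℚ.∣ p ^ℚ suc m ℚ.- q ^ℚ suc m ∣
∣diff∣≤∣diff-^ℚ∣ {p} {q} 0≤p 1≤q m with ℚₚ.≤-total p q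
... | inj₂ q≤p = ∣∣-mono (0≤q-p q≤p)
                   (diff≤diff-^ℚ (ℚₚ.≤-trans (ℚₚ.<⇒≤ 0<1) 1≤q) (ℚₚ.≤-trans 1≤q q≤p) q≤p m)
... | inj₁ p≤q = subst (ℚ._≤ ℚ.∣ p ^ℚ suc m ℚ.- q ^ℚ suc m ∣) (∣p-q∣≡∣q-p∣ q p)
                   (subst (ℚ.∣ q ℚ.- p ∣ ℚ.≤_) (∣p-q∣≡∣q-p∣ (q ^ℚ suc m) (p ^ℚ suc m))
                     (∣∣-mono (0≤q-p p≤q) (diff≤diff-^ℚ 0≤p 1≤q p≤q m)))

im≋0-^ : ∀ z → im z ≋ 0ʳ → ∀ m i → seq (re (z ^ᶜ m)) i ≡ seq (re z) i ^ℚ m × seq (im (z ^ᶜ m)) i ≡ 0ℚ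
im≋0-^ z im≡0 zero    i = refl , refl
im≋0-^ z im≡0 (suc m) i = let p , q = im≋0-^ z im≡0 m i in
  trans (cong₂ ℚ._-_ (cong (seq (re z) i ℚ.*_) p) (cong₂ ℚ._*_ (im≡0 i) q)) (-0ℚ _) ,
  trans (cong₂ ℚ._+_ (cong (seq (re z) i ℚ.*_) q) (cong (ℚ._* seq (re (z ^ᶜ m)) i) (im≡0 i)))
    (solve 2 (λ a b → a :* con 0ℚ :+ con 0ℚ :* b := con 0ℚ) refl (seq (re z) i) (seq (re (z ^ᶜ m)) i))

-- Raising to a power brings no nonnegative number closer to one that is at least 1, so the modulus
-- of convergence for the powers serves for the bases as well. Near 0 powers contract, whence the
-- lower bound on w.
nonneg-root-unique : ∀ z w → im z ≋ 0ʳ → im w ≋ 0ʳ → Nonneg (re z) → (∀ i → 1ℚ ℚ.≤ seq (re w) i) →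
  ∀ m → z ^ᶜ suc m ≈ᶜ w ^ᶜ suc m → z ≈ᶜ w
nonneg-root-unique z w imz imw 0≤z 1≤w m (mk≈ h , _) =
  mk≈ (λ ε 0<ε → let N , b = h ε 0<ε in N , λ i N≤i →
    ℚₚ.≤-<-trans (∣diff∣≤∣diff-^ℚ∣ (0≤z i) (1≤w i) m)
      (subst (ℚ._< ε) (cong ℚ.∣_∣ (cong₂ ℚ._-_ (proj₁ (im≋0-^ z imz (suc m) i))
          (proj₁ (im≋0-^ w imw (suc m) i)))) (b i N≤i))) ,
  ≋⇒≈ʳ (λ i → trans (imz i) (sym (imw i)))

×ᶜ-re : ∀ n i → 1ℚ ℚ.≤ seq (re (suc n ×ᶜ 1ᶜ)) i
×ᶜ-re zero    i = ℚₚ.≤-refl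
×ᶜ-re (suc n) i = ℚₚ.≤-trans (×ᶜ-re n i) (p≤q+p (ℚₚ.<⇒≤ 0<1))

×ᶜ-im : ∀ n → im (n ×ᶜ 1ᶜ) ≋ 0ʳ
×ᶜ-im zero    i = refl
×ᶜ-im (suc n) i = trans (ℚₚ.+-identityˡ _) (×ᶜ-im n i)

ℂ-root-unique : ∀ z n m → (z *ᶜ conj z) ^ᶜ suc m ≈ᶜ (suc n ×ᶜ 1ᶜ) ^ᶜ suc m → z *ᶜ conj z ≈ᶜ suc n ×ᶜ 1ᶜ
ℂ-root-unique z n = nonneg-root-unique (z *ᶜ conj z) (suc n ×ᶜ 1ᶜ) (im-*-conj z) (×ᶜ-im (suc n))
  (λ i → subst (0ℚ ℚ.≤_) (sym (re-*-conj z i)) (0≤abs² z i)) (×ᶜ-re n)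

×ᶜ-≉0 : ∀ n → ¬ suc n ×ᶜ 1ᶜ ≈ᶜ 0ᶜ
×ᶜ-≉0 n (h , _) = apart⇒≉0 (re (suc n ×ᶜ 1ᶜ)) (1ℚ , 0<1 , 0 , λ i _ →
  ℚₚ.≤-trans (×ᶜ-re n i) (p≤∣p∣ _)) h

-- Finite sums, products and tensor powers

funToFin-cong : ∀ {m n} {f g : Fin m → Fin n} → (∀ i → f i ≡ g i) → funToFin f ≡ funToFin g
funToFin-cong {zero}  f≗g = refl
funToFin-cong {suc m} f≗g = cong₂ combine (f≗g zero) (funToFin-cong (f≗g ∘ suc))

finToFun-injective : ∀ {m n} (i j : Fin (m ℕ.^ n)) → (∀ l → finToFun {m} {n} i l ≡ finToFun {m} {n} j l) → i ≡ j
finToFun-injective {m} {n} i j h =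
  trans (sym (Finₚ.funToFin-finToFin {n} {m} i))
      (trans (funToFin-cong {n} {m} h) (Finₚ.funToFin-finToFin {n} {m} j))

-- Acts digit by digit; it serves to translate each coordinate of K^m by its own group element.
lift-permutation : ∀ {m} n → (Fin n → Permutation m m) → Permutation (m ℕ.^ n) (m ℕ.^ n)
lift-permutation {m} n π = permutation (act (λ u → π u ⟨$⟩ʳ_)) (act (λ u → π u ⟨$⟩ˡ_))
  (act-inverse (λ u → π u ⟨$⟩ʳ_) (λ u → π u ⟨$⟩ˡ_) (λ u i → Perm.inverseʳ (π u)))
  (act-inverse (λ u → π u ⟨$⟩ˡ_) (λ u → π u ⟨$⟩ʳ_) (λ u i → Perm.inverseˡ (π u)))
  where
  act : (Fin n → Fin m → Fin m) → Fin (m ℕ.^ n) → Fin (m ℕ.^ n)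
  act g i = funToFin (λ u → g u (finToFun {m} {n} i u))
  act-inverse : ∀ g h → (∀ u i → g u (h u i) ≡ i) → ∀ i → act g (act h i) ≡ i
  act-inverse g h gh i = trans
    (funToFin-cong {n} {m} (λ u → trans (cong (g u) (Finₚ.finToFun-funToFin {n} {m} _ u)) (gh u _)))
    (Finₚ.funToFin-finToFin {n} {m} i)

module FiniteSums {a ℓ : Level} (M : CommutativeMonoid a ℓ) where
  open CommutativeMonoid M renaming
    ( _∙_ to _+_ ; ε to 0# ; ∙-cong to +-cong ; ∙-congˡ to +-congˡ
    ; identityˡ to +-identityˡ ; identityʳ to +-identityʳ ; assoc to +-assoc
    ; refl to ≈-refl ; sym to ≈-sym ; trans to ≈-trans ; reflexive to ≈-reflexive)
  open CommutativeMonoidSum M public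

  sum-cong : ∀ {n} {f g : Vector Carrier n} → (∀ i → f i ≈ g i) → sum f ≈ sum g
  sum-cong {zero}  f≈g = ≈-refl
  sum-cong {suc n} f≈g = +-cong (f≈g zero) (sum-cong (f≈g ∘ suc))

  sum-zero : ∀ {n} (f : Vector Carrier n) → (∀ i → f i ≈ 0#) → sum f ≈ 0#
  sum-zero {n} f f≈0 = ≈-trans (sum-cong f≈0) (sum-replicate-zero n)

  sum-single : ∀ {n} (f : Vector Carrier n) i → (∀ j → j ≢ i → f j ≈ 0#) → sum f ≈ f i
  sum-single f zero f≈0 =
    ≈-trans (+-congˡ (sum-zero (f ∘ suc) (λ j → f≈0 (suc j) λ ()))) (+-identityʳ (f zero))
  sum-single f (suc i) f≈0 = ≈-trans
    (+-cong (f≈0 zero λ ()) (sum-single (f ∘ suc) i (λ j j≢i → f≈0 (suc j) (j≢i ∘ Finₚ.suc-injective))))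
    (+-identityˡ (f (suc i)))

  sum-+ : ∀ m {n} (f : Vector Carrier (m ℕ.+ n)) → sum f ≈ sum (λ i → f (i ↑ˡ n)) + sum (λ j → f (m ↑ʳ j))
  sum-+ zero    f = ≈-sym (+-identityˡ (sum f))
  sum-+ (suc m) f = ≈-trans (+-congˡ (sum-+ m (f ∘ suc))) (≈-sym (+-assoc _ _ _))

  remQuot-↑ʳ : ∀ {m} n (k : Fin (m ℕ.* n)) →
    remQuot {suc m} n (n ↑ʳ k) ≡ (suc (proj₁ (remQuot {m} n k)) , proj₂ (remQuot {m} n k))
  remQuot-↑ʳ {m} n k rewrite Finₚ.splitAt-↑ʳ n (m ℕ.* n) k = refl

  sum-remQuot : ∀ m n (f : Fin m × Fin n → Carrier) →
    sum (λ i → f (remQuot {m} n i)) ≈ sum (λ i → sum (λ j → f (i , j)))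
  sum-remQuot zero    n f = ≈-refl
  sum-remQuot (suc m) n f = ≈-trans (sum-+ n {m ℕ.* n} (λ i → f (remQuot {suc m} n i))) (+-cong
    (sum-cong (λ j → ≈-reflexive (cong f (Finₚ.remQuot-combine {suc m} {n} zero j))))
    (≈-trans (sum-cong (λ k → ≈-reflexive (cong f (remQuot-↑ʳ n k))))
      (sum-remQuot m n (λ (i , j) → f (suc i , j)))))

-- The properties of ℂ on which the character theory rests; no limits appear beyond this interface.
-- `stable` and `*-≉0` take the place of decidable equality and inverses, `definite` is positivity
-- of the Hermitian form, `×1-≉0` is characteristic 0. `root-unique` compares only |x|² with a
-- positive integer, the one case in which roots are taken.
record StarRing : Set₁ where
  field
    commutativeRing : CommutativeRing 0ℓ 0ℓ
  open CommutativeRing commutativeRing public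
  field
    star        : Carrier → Carrier
    star-cong   : ∀ {x y} → x ≈ y → star x ≈ star y
    star-+      : ∀ x y → star (x + y) ≈ star x + star y
    star-*      : ∀ x y → star (x * y) ≈ star x * star y
    star-involutive : ∀ x → star (star x) ≈ x
    stable      : ∀ {x} → ¬ ¬ x ≈ 0# → x ≈ 0#
    *-≉0        : ∀ {x y} → ¬ x ≈ 0# → ¬ y ≈ 0# → ¬ x * y ≈ 0#
  open SemiringSum semiring public using (sum)
  open SemiringMult semiring public using () renaming (_×_ to _⨯_)
  open SemiringExp semiring public using () renaming (_^_ to _↑_)
  field
    definite    : ∀ {n} (v : Vector Carrier n) → sum (λ i → v i * star (v i)) ≈ 0# → ∀ i → v i ≈ 0#
    root-unique : ∀ x n m → (x * star x) ↑ suc m ≈ (suc n ⨯ 1#) ↑ suc m → x * star x ≈ suc n ⨯ 1#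
    ×1-≉0       : ∀ n → ¬ suc n ⨯ 1# ≈ 0#

ℂ-starRing : StarRing
ℂ-starRing = record
  { commutativeRing = ℂ-commutativeRing
  ; star = conj ; star-cong = conj-cong ; star-+ = conj-+ ; star-* = conj-* ; star-involutive = conj-involutive
  ; stable = ℂ-stable ; *-≉0 = λ {z} {w} → ℂ-*-≉0 {z} {w} ; definite = ℂ-definite
  ; root-unique = ℂ-root-unique ; ×1-≉0 = ×ᶜ-≉0 }

-- Linear algebra over a ring with positive involution

module StarRingProperties (S : StarRing) where
  open StarRing S hiding (sum; zero) renaming
      (refl to ≈-refl; sym to ≈-sym; trans to ≈-trans; reflexive to ≈-reflexive)
  open SemiringSum semiring public using (*-distribˡ-sum; *-distribʳ-sum)
  open FiniteSums +-commutativeMonoid public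
  module Π = FiniteSums *-commutativeMonoid
  open Π public using () renaming (sum to prod)
  module ≈-Reasoning = Relation.Binary.Reasoning.Setoid setoid
  open SemiringExp semiring public using (^-homo-*; ^-assocʳ; ^-congˡ)
  open CommutativeSemiringExp commutativeSemiring public using (^-distrib-*)
  open SemiringMult semiring public using (×1-homo-*)
  module RS = NaturalCoefficients commutativeSemiring

  1≉0 : ¬ 1# ≈ 0#
  1≉0 h = ×1-≉0 0 (≈-trans (+-identityʳ 1#) h)

  prod-≉0 : ∀ {n} (f : Vector Carrier n) → (∀ i → ¬ f i ≈ 0#) → ¬ prod f ≈ 0#
  prod-≉0 {zero}  f f≉0 = 1≉0
  prod-≉0 {suc n} f f≉0 = *-≉0 (f≉0 zero) (prod-≉0 (f ∘ suc) (f≉0 ∘ suc))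

  ^-≉0 : ∀ {x} → ¬ x ≈ 0# → ∀ n → ¬ x ↑ n ≈ 0#
  ^-≉0 x≉0 zero    = 1≉0
  ^-≉0 x≉0 (suc n) = *-≉0 x≉0 (^-≉0 x≉0 n)

  prod-zero : ∀ {n} (f : Vector Carrier n) i → f i ≈ 0# → prod f ≈ 0#
  prod-zero f zero    h = ≈-trans (*-congʳ h) (zeroˡ _)
  prod-zero f (suc i) h = ≈-trans (*-congˡ (prod-zero (f ∘ suc) i h)) (zeroʳ (f zero))

  -- Replaces division: x (y - z) ≈ 0 refutes y - z ≉ 0, and equality with 0 is stable.
  *-cancel : ∀ {x y z} → ¬ x ≈ 0# → x * y ≈ x * z → y ≈ z
  *-cancel {x} {y} {z} x≉0 h = begin
    y                  ≈⟨ +-identityʳ y ⟨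
    y + 0#             ≈⟨ +-congˡ (-‿inverseˡ z) ⟨
    y + (- z + z)      ≈⟨ +-assoc y (- z) z ⟨
    (y + - z) + z      ≈⟨ +-congʳ (stable (λ ≉0 → *-≉0 x≉0 ≉0 x[y-z]≈0)) ⟩
    0# + z             ≈⟨ +-identityˡ z ⟩
    z                  ∎
    where
    open ≈-Reasoning
    x[y-z]≈0 : x * (y + - z) ≈ 0#
    x[y-z]≈0 = begin
      x * (y + - z)     ≈⟨ distribˡ x y (- z) ⟩
      x * y + x * - z   ≈⟨ +-congʳ h ⟩
      x * z + x * - z   ≈⟨ distribˡ x z (- z) ⟨
      x * (z + - z)     ≈⟨ *-congˡ (-‿inverseʳ z) ⟩
      x * 0#            ≈⟨ zeroʳ x ⟩
      0#                ∎

  *-≈0ʳ : ∀ {x y} → ¬ x ≈ 0# → x * y ≈ 0# → y ≈ 0#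
  *-≈0ʳ {x} x≉0 h = *-cancel x≉0 (≈-trans h (≈-sym (zeroʳ x)))

  star-0 : star 0# ≈ 0#
  star-0 = begin
    star 0#                                 ≈⟨ star-cong (zeroˡ (star 0#)) ⟨
    star (0# * star 0#)                     ≈⟨ star-* 0# (star 0#) ⟩
    star 0# * star (star 0#)                ≈⟨ *-congˡ (star-involutive 0#) ⟩
    star 0# * 0#                            ≈⟨ zeroʳ (star 0#) ⟩
    0#                                      ∎
    where open ≈-Reasoning

  star-1 : star 1# ≈ 1#
  star-1 = begin
    star 1#                  ≈⟨ star-involutive (star 1#) ⟨
    star (star (star 1#))    ≈⟨ star-cong (star-cong (*-identityʳ (star 1#))) ⟨
    star (star (star 1# * 1#)) ≈⟨ star-cong (star-* (star 1#) 1#) ⟩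
    star (star (star 1#) * star 1#) ≈⟨ star-cong (*-congʳ (star-involutive 1#)) ⟩
    star (1# * star 1#)      ≈⟨ star-cong (*-identityˡ (star 1#)) ⟩
    star (star 1#)           ≈⟨ star-involutive 1# ⟩
    1#                       ∎
    where open ≈-Reasoning

  star-sum : ∀ {n} (f : Vector Carrier n) → star (sum f) ≈ sum (star ∘ f)
  star-sum {zero}  f = star-0
  star-sum {suc n} f = ≈-trans (star-+ (f zero) (sum (f ∘ suc))) (+-congˡ (star-sum (f ∘ suc)))

  star-prod : ∀ {n} (f : Vector Carrier n) → star (prod f) ≈ prod (star ∘ f)
  star-prod {zero}  f = star-1
  star-prod {suc n} f = ≈-trans (star-* (f zero) (prod (f ∘ suc))) (*-congˡ (star-prod (f ∘ suc)))

  star-^ : ∀ x n → star (x ↑ n) ≈ star x ↑ n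
  star-^ x zero    = star-1
  star-^ x (suc n) = ≈-trans (star-* x (x ↑ n)) (*-congˡ (star-^ x n))

  star-× : ∀ n → star (n ⨯ 1#) ≈ n ⨯ 1#
  star-× zero    = star-0
  star-× (suc n) = ≈-trans (star-+ 1# (n ⨯ 1#)) (+-cong star-1 (star-× n))

  prod-const : ∀ n x → prod {n} (λ _ → x) ≈ x ↑ n
  prod-const n x = Π.sum-replicate n

  sum-const : ∀ n x → sum {n} (λ _ → x) ≈ (n ⨯ 1#) * x
  sum-const zero    x = ≈-sym (zeroˡ x)
  sum-const (suc n) x = begin
    x + sum {n} (λ _ → x)       ≈⟨ +-cong (≈-sym (*-identityˡ x)) (sum-const n x) ⟩
    1# * x + (n ⨯ 1#) * x       ≈⟨ distribʳ x 1# (n ⨯ 1#) ⟨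
    (1# + n ⨯ 1#) * x           ∎
    where open ≈-Reasoning

  sum-* : ∀ {m n} (f : Vector Carrier m) (g : Vector Carrier n) → sum f * sum g ≈ sum (λ i → sum (λ j → f i * g j))
  sum-* f g = ≈-trans (*-distribʳ-sum (sum g) f) (sum-cong (λ i → *-distribˡ-sum (f i) g))

  -- Expanding a product of sums: the choice functions Fin n → Fin d are enumerated by finToFun.
  sum-finToFun : ∀ {d} n (F : Fin n → Fin d → Carrier) →
    sum (λ (i : Fin (d ℕ.^ n)) → prod (λ l → F l (finToFun {d} {n} i l))) ≈ prod (λ l → sum (F l))
  sum-finToFun zero F = +-identityʳ 1#
  sum-finToFun {d} (suc n) F = begin
    sum (λ i → g (remQuot {d} (d ℕ.^ n) i))
      ≈⟨ sum-remQuot d (d ℕ.^ n) g ⟩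
    sum (λ a → sum (λ b → F zero a * prod (λ l → F (suc l) (finToFun {d} {n} b l))))
      ≈⟨ sum-* (F zero) (λ (b : Fin (d ℕ.^ n)) → prod (λ l → F (suc l) (finToFun {d} {n} b l))) ⟨
    sum (F zero) * sum (λ (b : Fin (d ℕ.^ n)) → prod (λ l → F (suc l) (finToFun {d} {n} b l)))
      ≈⟨ *-congˡ (sum-finToFun n (F ∘ suc)) ⟩
    sum (F zero) * prod (λ l → sum (F (suc l))) ∎
    where
    open ≈-Reasoning
    g : Fin d × Fin (d ℕ.^ n) → Carrier
    g (a , b) = F zero a * prod (λ l → F (suc l) (finToFun {d} {n} b l))

  -- Written with the same test as `1ᴹ`, so that over ℂ the two agree by definition and `starRep`
  -- can take over the fields of `UnitaryRep`.
  δ : ∀ {n} → Fin n → Fin n → Carrier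
  δ i j = if does (i Finₚ.≟ j) then 1# else 0#

  δ-refl : ∀ {n} (i : Fin n) → δ i i ≈ 1#
  δ-refl i with i Finₚ.≟ i
  ... | yes _  = ≈-refl
  ... | no i≢i = contradiction refl i≢i

  δ-≢ : ∀ {n} {i j : Fin n} → i ≢ j → δ i j ≈ 0#
  δ-≢ {i = i} {j} i≢j with i Finₚ.≟ j
  ... | yes i≡j = contradiction i≡j i≢j
  ... | no _    = ≈-refl

  δ-sym : ∀ {n} (i j : Fin n) → δ i j ≈ δ j i
  δ-sym i j with i Finₚ.≟ j
  ... | yes refl = ≈-sym (δ-refl i)
  ... | no i≢j   = ≈-sym (δ-≢ (i≢j ∘ sym))

  star-δ : ∀ {n} (i j : Fin n) → star (δ i j) ≈ δ i j
  star-δ i j with i Finₚ.≟ j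
  ... | yes _ = star-1
  ... | no _  = star-0

  sum-δˡ : ∀ {n} i (v : Vector Carrier n) → sum (λ j → δ i j * v j) ≈ v i
  sum-δˡ i v = ≈-trans
    (sum-single (λ j → δ i j * v j) i (λ j j≢i → ≈-trans (*-congʳ (δ-≢ (j≢i ∘ sym))) (zeroˡ (v j))))
    (≈-trans (*-congʳ (δ-refl i)) (*-identityˡ (v i)))

  Mat : ℕ → Set
  Mat n = Fin n → Fin n → Carrier

  infix 4 _≈ₘ_
  infixl 7 _∙_

  _≈ₘ_ : ∀ {n} → Mat n → Mat n → Set
  A ≈ₘ B = ∀ i j → A i j ≈ B i j

  _∙_ : ∀ {n} → Mat n → Mat n → Mat n
  (A ∙ B) i k = sum (λ j → A i j * B j k)

  ∙-cong : ∀ {n} {A A′ B B′ : Mat n} → A ≈ₘ A′ → B ≈ₘ B′ → A ∙ B ≈ₘ A′ ∙ B′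
  ∙-cong p q i k = sum-cong (λ j → *-cong (p i j) (q j k))

  ∙-assoc : ∀ {n} (A B C : Mat n) → (A ∙ B) ∙ C ≈ₘ A ∙ (B ∙ C)
  ∙-assoc A B C i l = begin
    sum (λ k → sum (λ j → A i j * B j k) * C k l)
      ≈⟨ sum-cong (λ k → *-distribʳ-sum (C k l) (λ j → A i j * B j k)) ⟩
    sum (λ k → sum (λ j → A i j * B j k * C k l))
      ≈⟨ ∑-comm (λ k j → A i j * B j k * C k l) ⟩
    sum (λ j → sum (λ k → A i j * B j k * C k l))
      ≈⟨ sum-cong (λ j → ≈-trans (sum-cong (λ k → *-assoc (A i j) (B j k) (C k l)))
          (≈-sym (*-distribˡ-sum (A i j) (λ k → B j k * C k l)))) ⟩
    sum (λ j → A i j * sum (λ k → B j k * C k l)) ∎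
    where open ≈-Reasoning

  ∙-identityˡ : ∀ {n} (A : Mat n) → δ ∙ A ≈ₘ A
  ∙-identityˡ A i k = sum-δˡ i (λ j → A j k)

  ∙-identityʳ : ∀ {n} (A : Mat n) → A ∙ δ ≈ₘ A
  ∙-identityʳ A i k = ≈-trans
    (sum-cong (λ j → ≈-trans (*-comm (A i j) (δ j k)) (*-congʳ (δ-sym j k)))) (sum-δˡ k (A i))

  adj : ∀ {n} → Mat n → Mat n
  adj A i j = star (A j i)

  tr : ∀ {n} → Mat n → Carrier
  tr A = sum (λ i → A i i)

  -- The tensor product A₀ ⊗ ⋯ ⊗ Aₙ₋₁, in the basis of ⊗ enumerated by finToFun.
  ⨂ : ∀ {d} n → (Fin n → Mat d) → Mat (d ℕ.^ n)
  ⨂ {d} n A i j = prod (λ l → A l (finToFun {d} {n} i l) (finToFun {d} {n} j l))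

  ⨂-cong : ∀ {d} n {A B : Fin n → Mat d} → (∀ l → A l ≈ₘ B l) → ⨂ n A ≈ₘ ⨂ n B
  ⨂-cong {d} n p i j = Π.sum-cong (λ l → p l (finToFun {d} {n} i l) (finToFun {d} {n} j l))

  ⨂-∙ : ∀ {d} n (A B : Fin n → Mat d) → ⨂ n A ∙ ⨂ n B ≈ₘ ⨂ n (λ l → A l ∙ B l)
  ⨂-∙ {d} n A B i k = ≈-trans
    (sum-cong (λ j → ≈-sym (Π.∑-distrib-+ (λ l → A l (finToFun {d} {n} i l) (finToFun {d} {n} j l))
        (λ l → B l (finToFun {d} {n} j l) (finToFun {d} {n} k l)))))
    (sum-finToFun n (λ l j → A l (finToFun {d} {n} i l) j * B l j (finToFun {d} {n} k l)))

  -- Distinct indices differ in some digit, and the factor at that digit is 0.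
  ⨂-δ : ∀ {d} n → ⨂ n (λ _ → δ) ≈ₘ δ {d ℕ.^ n}
  ⨂-δ {d} n i j with i Finₚ.≟ j
  ... | yes refl = ≈-trans (Π.sum-cong {n} (λ l → δ-refl (finToFun {d} {n} i l))) (Π.sum-replicate-zero n)
  ... | no i≢j   = let l , il≢jl = Finₚ.¬∀⟶∃¬ n _ (λ l → finToFun {d} {n} i l Finₚ.≟ finToFun {d} {n} j l) (i≢j ∘ finToFun-injective {d} {n} i j)
                   in prod-zero (λ l → δ (finToFun {d} {n} i l) (finToFun {d} {n} j l)) l (δ-≢ il≢jl)

  ⨂-adj : ∀ {d} n (A : Fin n → Mat d) → adj (⨂ n A) ≈ₘ ⨂ n (adj ∘ A)
  ⨂-adj {d} n A i j = star-prod (λ l → A l (finToFun {d} {n} j l) (finToFun {d} {n} i l))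

  ⨂-tr : ∀ {d} n (A : Fin n → Mat d) → tr (⨂ n A) ≈ prod (tr ∘ A)
  ⨂-tr n A = sum-finToFun n (λ l a → A l a a)

  isometry : ∀ {n} (A : Mat n) → adj A ∙ A ≈ₘ δ → ∀ (v : Vector Carrier n) →
    let w = λ i → sum (λ j → A i j * v j) in sum (λ i → w i * star (w i)) ≈ sum (λ i → v i * star (v i))
  isometry A A*A v = begin
    sum (λ i → w i * star (w i))
      ≈⟨ sum-cong (λ i → *-congˡ {w i} (≈-trans (star-sum (λ j → A i j * v j))
          (sum-cong (λ j → star-* (A i j) (v j))))) ⟩
    sum (λ i → w i * sum (λ k → adj A k i * star (v k)))
      ≈⟨ sum-cong (λ i → *-distribˡ-sum (w i) (λ k → adj A k i * star (v k))) ⟩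
    sum (λ i → sum (λ k → w i * (adj A k i * star (v k))))
      ≈⟨ ∑-comm (λ i k → w i * (adj A k i * star (v k))) ⟩
    sum (λ k → sum (λ i → w i * (adj A k i * star (v k))))
      ≈⟨ sum-cong (λ k → ≈-trans
           (sum-cong (λ i → RS.solve 3 (λ w a s → w RS.:* (a RS.:* s) RS.:= a RS.:* w RS.:* s) ≈-refl (w i)
               (adj A k i) (star (v k))))
           (≈-sym (*-distribʳ-sum (star (v k)) (λ i → adj A k i * w i)))) ⟩
    sum (λ k → sum (λ i → adj A k i * w i) * star (v k))
      ≈⟨ sum-cong (λ k → *-congʳ (A*w k)) ⟩
    sum (λ k → v k * star (v k)) ∎
    where
    open ≈-Reasoning
    w = λ i → sum (λ j → A i j * v j)
    A*w : ∀ k → sum (λ i → adj A k i * w i) ≈ v k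
    A*w k = begin
      sum (λ i → adj A k i * sum (λ j → A i j * v j))
        ≈⟨ sum-cong (λ i → *-distribˡ-sum (adj A k i) (λ j → A i j * v j)) ⟩
      sum (λ i → sum (λ j → adj A k i * (A i j * v j)))    ≈⟨ ∑-comm (λ i j → adj A k i * (A i j * v j)) ⟩
      sum (λ j → sum (λ i → adj A k i * (A i j * v j)))    ≈⟨ sum-cong (λ j → ≈-trans
                                                                (sum-cong (λ i → ≈-sym (*-assoc (adj A k i)
                                                                    (A i j) (v j))))
                                                                (≈-sym (*-distribʳ-sum (v j) (λ i
                                                                    → adj A k i * A i j)))) ⟩
      sum (λ j → (adj A ∙ A) k j * v j)                    ≈⟨ sum-cong (λ j → *-congʳ (A*A k j)) ⟩
      sum (λ j → δ k j * v j)                              ≈⟨ sum-δˡ k v ⟩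
      v k                                                  ∎

-- Characters and invariants

module PowerSums (S : StarRing) where
  open StarRing S hiding (sum; zero) renaming
      (refl to ≈-refl; sym to ≈-sym; trans to ≈-trans; reflexive to ≈-reflexive)
  open StarRingProperties S

  -- A weight w orthogonal to the powers of z up to s is orthogonal to every polynomial in z of
  -- degree s. The polynomial is given by its roots, which are absorbed into the weight one at a
  -- time; each absorption uses up one power.
  sum-*-prod≈0 : ∀ {N} s (z w : Vector Carrier N) (y : Vector Carrier s) →
    (∀ e → e ℕ.≤ s → sum (λ x → w x * z x ↑ e) ≈ 0#) →
    sum (λ x → w x * prod (λ l → z x + - y l)) ≈ 0#
  sum-*-prod≈0 zero    z w y h = h 0 ℕ.z≤n
  sum-*-prod≈0 (suc s) z w y h = ≈-trans
    (sum-cong (λ x → ≈-sym (*-assoc (w x) (z x + - y zero) _)))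
    (sum-*-prod≈0 s z (λ x → w x * (z x + - y zero)) (y ∘ suc) (λ e e≤s → begin
      sum (λ x → w x * (z x + - y zero) * z x ↑ e)
        ≈⟨ sum-cong (λ x → RS.solve 4 (λ a b c f → a RS.:* (b RS.:+ c) RS.:* f
                        RS.:= a RS.:* (b RS.:* f) RS.:+ c RS.:* (a RS.:* f)) ≈-refl (w x) (z x) (- y zero)
                            (z x ↑ e)) ⟩
      sum (λ x → w x * z x ↑ suc e + - y zero * (w x * z x ↑ e))
        ≈⟨ ∑-distrib-+ (λ x → w x * z x ↑ suc e) (λ x → - y zero * (w x * z x ↑ e)) ⟩
      sum (λ x → w x * z x ↑ suc e) + sum (λ x → - y zero * (w x * z x ↑ e))
        ≈⟨ +-cong (h (suc e) (ℕ.s≤s e≤s)) (≈-sym (*-distribˡ-sum (- y zero) (λ x → w x * z x ↑ e))) ⟩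
      0# + - y zero * sum (λ x → w x * z x ↑ e)
        ≈⟨ +-identityˡ _ ⟩
      - y zero * sum (λ x → w x * z x ↑ e)
        ≈⟨ *-congˡ (h e (ℕₚ.m≤n⇒m≤1+n e≤s)) ⟩
      - y zero * 0#
        ≈⟨ zeroʳ (- y zero) ⟩
      0# ∎))
    where open ≈-Reasoning

  x-y≈0⇒x≈y : ∀ {x y} → x + - y ≈ 0# → x ≈ y
  x-y≈0⇒x≈y {x} {y} h = begin
    x               ≈⟨ +-identityʳ x ⟨
    x + 0#          ≈⟨ +-congˡ (-‿inverseˡ y) ⟨
    x + (- y + y)   ≈⟨ +-assoc x (- y) y ⟨
    (x + - y) + y   ≈⟨ +-congʳ h ⟩
    0# + y          ≈⟨ +-identityˡ y ⟩
    y               ∎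
    where open ≈-Reasoning

  -- The polynomial ∏ₗ (Z - yₗ) with yₗ = zₗ + δₗₒ vanishes at every zₓ except zₒ.
  some-power-sum-≉0 : ∀ {N} (z w : Vector Carrier N) o → ¬ w o ≈ 0# → (∀ x → x ≢ o → ¬ z x ≈ z o) →
    ¬ (∀ e → e ℕ.≤ N → sum (λ x → w x * z x ↑ e) ≈ 0#)
  some-power-sum-≉0 {N} z w o wo≉0 z≉zo h = *-≉0 wo≉0 (prod-≉0 (λ l → z o + - y l) factor≉0) (begin
    w o * prod (λ l → z o + - y l)
      ≈⟨ sum-single (λ x → w x * prod (λ l → z x + - y l)) o (λ x x≢o →
           ≈-trans (*-congˡ (prod-zero (λ l → z x + - y l) x (root x x≢o))) (zeroʳ (w x))) ⟨
    sum (λ x → w x * prod (λ l → z x + - y l))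
      ≈⟨ sum-*-prod≈0 N z w y h ⟩
    0# ∎)
    where
    open ≈-Reasoning
    y : Vector Carrier N
    y l = z l + δ l o
    root : ∀ x → x ≢ o → z x + - y x ≈ 0#
    root x x≢o = begin
      z x + - (z x + δ x o)  ≈⟨ +-congˡ (-‿cong (≈-trans (+-congˡ (δ-≢ x≢o)) (+-identityʳ (z x)))) ⟩
      z x + - z x            ≈⟨ -‿inverseʳ (z x) ⟩
      0#                     ∎
    factor≉0 : ∀ l → ¬ z o + - y l ≈ 0#
    factor≉0 l eq with l Finₚ.≟ o | x-y≈0⇒x≈y eq
    ... | no l≢o   | zo≈ = z≉zo l l≢o (≈-trans (≈-sym (+-identityʳ (z l))) (≈-sym zo≈))
    ... | yes refl | zo≈ = 1≉0 (begin
      1#                     ≈⟨ +-identityˡ 1# ⟨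
      0# + 1#                ≈⟨ +-congʳ (-‿inverseˡ (z o)) ⟨
      - z o + z o + 1#       ≈⟨ +-assoc (- z o) (z o) 1# ⟩
      - z o + (z o + 1#)     ≈⟨ +-congˡ zo≈ ⟨
      - z o + z o            ≈⟨ -‿inverseˡ (z o) ⟩
      0#                     ∎)

record StarRep (S : StarRing) {c ℓ : Level} (K : FiniteGroup c ℓ) (d : ℕ) : Set (c Level.⊔ ℓ) where
  open FiniteGroup K using (Carrier; _≈_; ε) renaming (_∙_ to _·_)
  open StarRingProperties S using (Mat; _≈ₘ_; _∙_; δ; adj)
  field
    ⟦_⟧     : Carrier → Mat d
    ⟦⟧-cong : ∀ {x y} → x ≈ y → ⟦ x ⟧ ≈ₘ ⟦ y ⟧
    ⟦⟧-∙    : ∀ x y → ⟦ x · y ⟧ ≈ₘ ⟦ x ⟧ ∙ ⟦ y ⟧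
    ⟦⟧-ε    : ⟦ ε ⟧ ≈ₘ δ
    adjˡ    : ∀ x → adj ⟦ x ⟧ ∙ ⟦ x ⟧ ≈ₘ δ
    adjʳ    : ∀ x → ⟦ x ⟧ ∙ adj ⟦ x ⟧ ≈ₘ δ

module Characters (S : StarRing) {c ℓ : Level} (K : FiniteGroup c ℓ) (d : ℕ) (ρ : StarRep S K d) where
  open StarRing S hiding (sum; zero) renaming
      (refl to ≈-refl; sym to ≈-sym; trans to ≈-trans; reflexive to ≈-reflexive)
  open StarRingProperties S
  open PowerSums S
  module G = FiniteGroup K
  open G using (order; element)
  open StarRep ρ
  open ≈-Reasoning

  index : G.Carrier → Fin order
  index = Inverse.to G.enumeration

  index-element : ∀ i → index (element i) ≡ i
  index-element = Inverse.strictlyInverseˡ G.enumeration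

  element-index : ∀ x → element (index x) G.≈ x
  element-index = Inverse.strictlyInverseʳ G.enumeration

  index-cong : ∀ {x y} → x G.≈ y → index x ≡ index y
  index-cong = Inverse.to-cong G.enumeration

  left-mul : G.Carrier → Permutation order order
  left-mul x = permutation (mul x) (mul (x G.⁻¹))
    (mul-inverse x (x G.⁻¹) (G.inverseʳ x)) (mul-inverse (x G.⁻¹) x (G.inverseˡ x))
    where
    mul : G.Carrier → Fin order → Fin order
    mul x y = index (x G.∙ element y)
    mul-inverse : ∀ x x′ → x G.∙ x′ G.≈ G.ε → ∀ y → mul x (mul x′ y) ≡ y
    mul-inverse x x′ xx′≈ε y = trans (index-cong (G.trans (G.∙-congˡ (element-index _))
      (G.trans (G.sym (G.assoc x x′ (element y))) (G.trans (G.∙-congʳ xx′≈ε) (G.identityˡ (element y))))))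
      (index-element y)

  inversion : Permutation order order
  inversion = permutation inv inv inv-inv inv-inv
    where
    inv : Fin order → Fin order
    inv y = index (element y G.⁻¹)
    inv-inv : ∀ y → inv (inv y) ≡ y
    inv-inv y = trans (index-cong (G.trans (G.⁻¹-cong (element-index _))
        (GroupProperties.⁻¹-involutive G.group (element y))))
      (index-element y)

  -- U* = U* (U U⁻¹) = (U* U) U⁻¹ = U⁻¹.
  adj-⟦⟧ : ∀ x → adj ⟦ x ⟧ ≈ₘ ⟦ x G.⁻¹ ⟧
  adj-⟦⟧ x i j = begin
    adj ⟦ x ⟧ i j                               ≈⟨ ∙-identityʳ (adj ⟦ x ⟧) i j ⟨
    (adj ⟦ x ⟧ ∙ δ) i j
      ≈⟨ ∙-cong {A = adj ⟦ x ⟧} (λ _ _ → ≈-refl) (λ k l → ≈-trans (≈-sym (⟦⟧-ε k l))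
                                                      (≈-trans (⟦⟧-cong (G.sym (G.inverseʳ x)) k l)
                                                          (⟦⟧-∙ x (x G.⁻¹) k l))) i j ⟩
    (adj ⟦ x ⟧ ∙ (⟦ x ⟧ ∙ ⟦ x G.⁻¹ ⟧)) i j      ≈⟨ ∙-assoc (adj ⟦ x ⟧) ⟦ x ⟧ ⟦ x G.⁻¹ ⟧ i j ⟨
    ((adj ⟦ x ⟧ ∙ ⟦ x ⟧) ∙ ⟦ x G.⁻¹ ⟧) i j      ≈⟨ ∙-cong {B = ⟦ x G.⁻¹ ⟧} (adjˡ x) (λ _ _ → ≈-refl) i j ⟩
    (δ ∙ ⟦ x G.⁻¹ ⟧) i j                        ≈⟨ ∙-identityˡ ⟦ x G.⁻¹ ⟧ i j ⟩
    ⟦ x G.⁻¹ ⟧ i j                              ∎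

  Σₘ : ∀ {N s} → (Fin N → Mat s) → Mat s
  Σₘ M i j = sum (λ y → M y i j)

  -- Averaging argument: B only permutes the summands. Read columnwise, it makes every column of the
  -- sum a vector fixed by B.
  Σₘ-invariant : ∀ {N s} (B : Mat s) (M : Fin N → Mat s) (π : Permutation N N) →
    (∀ y → B ∙ M y ≈ₘ M (π ⟨$⟩ʳ y)) → B ∙ Σₘ M ≈ₘ Σₘ M
  Σₘ-invariant B M π h i k = begin
    sum (λ j → B i j * sum (λ y → M y j k))     ≈⟨ sum-cong (λ j → *-distribˡ-sum (B i j) (λ y → M y j k)) ⟩
    sum (λ j → sum (λ y → B i j * M y j k))     ≈⟨ ∑-comm (λ j y → B i j * M y j k) ⟩
    sum (λ y → sum (λ j → B i j * M y j k))     ≈⟨ sum-cong (λ y → h y i k) ⟩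
    sum (λ y → M (π ⟨$⟩ʳ y) i k)                ≈⟨ sum-permute (λ y → M y i k) π ⟨
    sum (λ y → M y i k)                         ∎

  ⨂ρ : ∀ n → Vector G.Carrier n → Mat (d ℕ.^ n)
  ⨂ρ n g = ⨂ n (λ l → ⟦ g l ⟧)

  ⨂ρ-cong : ∀ n {g h : Vector G.Carrier n} → (∀ l → g l G.≈ h l) → ⨂ρ n g ≈ₘ ⨂ρ n h
  ⨂ρ-cong n g≈h = ⨂-cong n (λ l → ⟦⟧-cong (g≈h l))

  ⨂ρ-∙ : ∀ n (g h : Vector G.Carrier n) → ⨂ρ n g ∙ ⨂ρ n h ≈ₘ ⨂ρ n (λ l → g l G.∙ h l)
  ⨂ρ-∙ n g h i j = ≈-trans (⨂-∙ n (λ l → ⟦ g l ⟧) (λ l → ⟦ h l ⟧) i j)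
    (⨂-cong n (λ l a b → ≈-sym (⟦⟧-∙ (g l) (h l) a b)) i j)

  ⨂ρ-adj : ∀ n g → adj (⨂ρ n g) ≈ₘ ⨂ρ n (λ l → g l G.⁻¹)
  ⨂ρ-adj n g i j = ≈-trans (⨂-adj n (λ l → ⟦ g l ⟧) i j) (⨂-cong n (λ l → adj-⟦⟧ (g l)) i j)

  ⨂ρ-isometry : ∀ n g → adj (⨂ρ n g) ∙ ⨂ρ n g ≈ₘ δ
  ⨂ρ-isometry n g i j = begin
    (adj (⨂ρ n g) ∙ ⨂ρ n g) i j
      ≈⟨ ∙-cong {B = ⨂ρ n g} (⨂-adj n (λ l → ⟦ g l ⟧)) (λ _ _ → ≈-refl) i j ⟩
    (⨂ n (λ l → adj ⟦ g l ⟧) ∙ ⨂ρ n g) i j               ≈⟨ ⨂-∙ n (λ l → adj ⟦ g l ⟧) (λ l → ⟦ g l ⟧) i j ⟩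
    ⨂ n (λ l → adj ⟦ g l ⟧ ∙ ⟦ g l ⟧) i j                ≈⟨ ⨂-cong n (λ l → adjˡ (g l)) i j ⟩
    ⨂ n (λ _ → δ) i j                                    ≈⟨ ⨂-δ n i j ⟩
    δ i j                                                ∎

  χ : G.Carrier → Carrier
  χ x = tr ⟦ x ⟧

  χ-cong : ∀ {x y} → x G.≈ y → χ x ≈ χ y
  χ-cong x≈y = sum-cong (λ i → ⟦⟧-cong x≈y i i)

  T : ∀ k → G.Carrier → Mat (d ℕ.^ k)
  T k x = ⨂ρ k (λ _ → x)

  -- P k is |K| times the projection onto the invariants of ρ^⊗k, and a k its trace.
  P : ∀ k → Mat (d ℕ.^ k)
  P k = Σₘ (λ x → T k (element x))

  a : ℕ → Carrier
  a k = sum (λ x → χ (element x) ↑ k)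

  P-invariant : ∀ k x → T k x ∙ P k ≈ₘ P k
  P-invariant k x = Σₘ-invariant (T k x) (λ y → T k (element y)) (left-mul x) λ y i j → ≈-trans
    (⨂ρ-∙ k (λ _ → x) (λ _ → element y) i j) (⨂ρ-cong k (λ _ → G.sym (element-index _)) i j)

  P-adj : ∀ k → adj (P k) ≈ₘ P k
  P-adj k i j = begin
    star (sum (λ x → T k (element x) j i))           ≈⟨ star-sum (λ x → T k (element x) j i) ⟩
    sum (λ x → star (T k (element x) j i))           ≈⟨ sum-cong (λ x → ⨂ρ-adj k (λ _ → element x) i j) ⟩
    sum (λ x → T k (element x G.⁻¹) i j)
      ≈⟨ sum-cong (λ x → ⨂ρ-cong k {λ _ → element (inversion ⟨$⟩ʳ x)} {λ _ → element x G.⁻¹}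
          (λ _ → element-index _) i j) ⟨
    sum (λ x → T k (element (inversion ⟨$⟩ʳ x)) i j) ≈⟨ sum-permute (λ x → T k (element x) i j) inversion ⟨
    sum (λ x → T k (element x) i j)                  ∎

  P∙P : ∀ k i j → (P k ∙ P k) i j ≈ (order ⨯ 1#) * P k i j
  P∙P k i j = begin
    sum (λ b → sum (λ x → T k (element x) i b) * P k b j)
      ≈⟨ sum-cong (λ b → *-distribʳ-sum (P k b j) (λ x → T k (element x) i b)) ⟩
    sum (λ b → sum (λ x → T k (element x) i b * P k b j))
      ≈⟨ ∑-comm (λ b x → T k (element x) i b * P k b j) ⟩
    sum (λ x → sum (λ b → T k (element x) i b * P k b j))
      ≈⟨ sum-cong (λ x → P-invariant k (element x) i j) ⟩
    sum {order} (λ _ → P k i j)                               ≈⟨ sum-const order (P k i j) ⟩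
    (order ⨯ 1#) * P k i j                                    ∎

  tr-P : ∀ k → tr (P k) ≈ a k
  tr-P k = begin
    sum (λ i → sum (λ x → T k (element x) i i))   ≈⟨ ∑-comm (λ i x → T k (element x) i i) ⟩
    sum (λ x → tr (T k (element x)))
      ≈⟨ sum-cong (λ x → ≈-trans (⨂-tr k (λ _ → ⟦ element x ⟧)) (prod-const k (χ (element x)))) ⟩
    sum (λ x → χ (element x) ↑ k)                 ∎

  definite₂ : ∀ {m n} (A : Fin m → Fin n → Carrier) →
    sum (λ i → sum (λ j → A i j * star (A i j))) ≈ 0# → ∀ i j → A i j ≈ 0#
  definite₂ {m} {n} A h i j = begin
    A i j                             ≈⟨ ≈-reflexive (cong entry (Finₚ.remQuot-combine {m} {n} i j)) ⟨
    entry (remQuot n (combine i j))   ≈⟨ definite (entry ∘ remQuot n)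
                                           (≈-trans (sum-remQuot m n (λ p → entry p * star (entry p))) h)
                                               (combine i j) ⟩
    0#                                ∎
    where
    entry : Fin m × Fin n → Carrier
    entry (i , j) = A i j

  -- The squared Frobenius norm of P is tr (P P*) = tr (P²) = |K| tr P = |K| a(k), and a sum of
  -- squared absolute values vanishes only termwise.
  a≈0⇒P≈0 : ∀ k → a k ≈ 0# → ∀ i j → P k i j ≈ 0#
  a≈0⇒P≈0 k ak≈0 = definite₂ (P k) (begin
    sum (λ i → sum (λ j → P k i j * star (P k i j)))
      ≈⟨ sum-cong (λ i → sum-cong (λ j → *-congˡ {P k i j} (P-adj k j i))) ⟩
    sum (λ i → (P k ∙ P k) i i)
      ≈⟨ sum-cong (λ i → P∙P k i i) ⟩
    sum (λ i → (order ⨯ 1#) * P k i i)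
      ≈⟨ *-distribˡ-sum (order ⨯ 1#) (λ i → P k i i) ⟨
    (order ⨯ 1#) * tr (P k)
      ≈⟨ *-congˡ (≈-trans (tr-P k) ak≈0) ⟩
    (order ⨯ 1#) * 0#
      ≈⟨ zeroʳ (order ⨯ 1#) ⟩
    0# ∎)

  order≉0 : ¬ order ⨯ 1# ≈ 0#
  order≉0 = subst (λ n → ¬ n ⨯ 1# ≈ 0#) (ℕₚ.suc-pred order {{G.order≢0}}) (×1-≉0 (ℕ.pred order))

  -- Concatenation of digits: the index of a basis tensor of the (j + l)-th power built from one of
  -- the j-th and one of the l-th.
  join : ∀ j l → Fin (d ℕ.^ j) → Fin (d ℕ.^ l) → Fin (d ℕ.^ (j ℕ.+ l))
  join j l p q = funToFin (finToFun {d} {j} p ++ finToFun {d} {l} q)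

  digit-joinˡ : ∀ j l p q i → finToFun {d} {j ℕ.+ l} (join j l p q) (i ↑ˡ l) ≡ finToFun {d} {j} p i
  digit-joinˡ j l p q i = trans (Finₚ.finToFun-funToFin {j ℕ.+ l} {d} _ (i ↑ˡ l))
    (cong [ finToFun {d} {j} p , finToFun {d} {l} q ] (Finₚ.splitAt-↑ˡ j i l))

  digit-joinʳ : ∀ j l p q i → finToFun {d} {j ℕ.+ l} (join j l p q) (j ↑ʳ i) ≡ finToFun {d} {l} q i
  digit-joinʳ j l p q i = trans (Finₚ.finToFun-funToFin {j ℕ.+ l} {d} _ (j ↑ʳ i))
    (cong [ finToFun {d} {j} p , finToFun {d} {l} q ] (Finₚ.splitAt-↑ʳ j l i))

  T-join : ∀ j l x p p′ q q′ → T (j ℕ.+ l) x (join j l p q) (join j l p′ q′) ≈ T j x p p′ * T l x q q′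
  T-join j l x p p′ q q′ = ≈-trans (Π.sum-+ j {l} _) (*-cong
    (Π.sum-cong (λ i → ≈-reflexive (cong₂ ⟦ x ⟧ (digit-joinˡ j l p q i) (digit-joinˡ j l p′ q′ i))))
    (Π.sum-cong (λ i → ≈-reflexive (cong₂ ⟦ x ⟧ (digit-joinʳ j l p q i) (digit-joinʳ j l p′ q′ i)))))

  -- |K| P_j ⊗ P_l = ∑ₓ (T_j x ⊗ T_l x)(P_j ⊗ P_l) = P_{j+l} (P_j ⊗ P_l).
  P+≈0⇒P*P≈0 : ∀ j l → (∀ p q → P (j ℕ.+ l) p q ≈ 0#) → ∀ p p′ q q′ → P j p p′ * P l q q′ ≈ 0#
  P+≈0⇒P*P≈0 j l h p p′ q q′ = *-≈0ʳ order≉0 (begin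
    (order ⨯ 1#) * (P j p p′ * P l q q′)
      ≈⟨ sum-const order (P j p p′ * P l q q′) ⟨
    sum {order} (λ _ → P j p p′ * P l q q′)
      ≈⟨ sum-cong (λ x → *-cong (P-invariant j (element x) p p′) (P-invariant l (element x) q q′)) ⟨
    sum (λ x → (T j (element x) ∙ P j) p p′ * (T l (element x) ∙ P l) q q′)
      ≈⟨ sum-cong (λ x → sum-* (λ b → T j (element x) p b * P j b p′) (λ b → T l (element x) q b * P l b q′)) ⟩
    sum (λ x → sum (λ b → sum (λ b′ → (T j (element x) p b * P j b p′) * (T l (element x) q b′ * P l b′ q′))))
      ≈⟨ ∑-comm (λ x b → sum (λ b′ → (T j (element x) p b * P j b p′) * (T l (element x) q b′ * P l b′ q′))) ⟩
    sum (λ b → sum (λ x → sum (λ b′ → (T j (element x) p b * P j b p′) * (T l (element x) q b′ * P l b′ q′))))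
      ≈⟨ sum-zero _ (λ b → ≈-trans (∑-comm (λ x b′ → (T j (element x) p b * P j b p′) *
          (T l (element x) q b′ * P l b′ q′)))
                             (sum-zero _ (vanish b))) ⟩
    0# ∎)
    where
    vanish : ∀ b b′ → sum (λ x → (T j (element x) p b * P j b p′) * (T l (element x) q b′ * P l b′ q′)) ≈ 0#
    vanish b b′ = begin
      sum (λ x → (T j (element x) p b * P j b p′) * (T l (element x) q b′ * P l b′ q′))
        ≈⟨ sum-cong (λ x → ≈-trans (RS.solve 4
            (λ s t u v → (s RS.:* t) RS.:* (u RS.:* v) RS.:= (s RS.:* u) RS.:* (t RS.:* v)) ≈-refl
             (T j (element x) p b) (P j b p′) (T l (element x) q b′) (P l b′ q′))
             (*-congʳ (≈-sym (T-join j l (element x) p b q b′)))) ⟩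
      sum (λ x → T (j ℕ.+ l) (element x) (join j l p q) (join j l b b′) * (P j b p′ * P l b′ q′))
        ≈⟨ *-distribʳ-sum (P j b p′ * P l b′ q′) (λ x → T (j ℕ.+ l) (element x) (join j l p q) (join j l b b′)) ⟨
      P (j ℕ.+ l) (join j l p q) (join j l b b′) * (P j b p′ * P l b′ q′)
        ≈⟨ ≈-trans (*-congʳ (h (join j l p q) (join j l b b′))) (zeroˡ _) ⟩
      0# ∎

  -- If a(j + l) = 0, then P_{j+l} = 0, so P_j ⊗ P_l = 0; but the trace of the latter is a(j) a(l).
  a-+-≉0 : ∀ j l → ¬ a j ≈ 0# → ¬ a l ≈ 0# → ¬ a (j ℕ.+ l) ≈ 0#
  a-+-≉0 j l aj≉0 al≉0 h = *-≉0 aj≉0 al≉0 (begin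
    a j * a l                                 ≈⟨ *-cong (tr-P j) (tr-P l) ⟨
    tr (P j) * tr (P l)                       ≈⟨ sum-* (λ p → P j p p) (λ q → P l q q) ⟩
    sum (λ p → sum (λ q → P j p p * P l q q))
      ≈⟨ sum-zero _ (λ p → sum-zero _ (λ q → P+≈0⇒P*P≈0 j l (a≈0⇒P≈0 (j ℕ.+ l) h) p p q q)) ⟩
    0#                                        ∎)

  a-multiple-≉0 : ∀ j m s → ¬ a j ≈ 0# → ¬ a m ≈ 0# → ¬ a (j ℕ.+ s ℕ.* m) ≈ 0#
  a-multiple-≉0 j m zero    aj≉0 am≉0 = subst (λ k → ¬ a k ≈ 0#) (sym (ℕₚ.+-identityʳ j)) aj≉0
  a-multiple-≉0 j m (suc s) aj≉0 am≉0 = subst (λ k → ¬ a k ≈ 0#)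
    (trans (ℕₚ.+-assoc j (s ℕ.* m) m) (cong (j ℕ.+_) (ℕₚ.+-comm (s ℕ.* m) m)))
    (a-+-≉0 (j ℕ.+ s ℕ.* m) m (a-multiple-≉0 j m s aj≉0 am≉0) am≉0)

-- Nonvanishing of a(k) for large k

module LargePowers (S : StarRing) {c ℓ : Level} (K : FiniteGroup c ℓ) (d : ℕ) (ρ : StarRep S K (suc d)) where
  open StarRing S hiding (sum; zero) renaming
      (refl to ≈-refl; sym to ≈-sym; trans to ≈-trans; reflexive to ≈-reflexive)
  open StarRingProperties S
  open PowerSums S
  open Characters S K (suc d) ρ
  open StarRep ρ
  open G using (order; element)
  open ≈-Reasoning

  D : Carrier
  D = suc d ⨯ 1#

  D≉0 : ¬ D ≈ 0#
  D≉0 = ×1-≉0 d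

  χ-ε : χ G.ε ≈ D
  χ-ε = begin
    sum (λ i → ⟦ G.ε ⟧ i i)    ≈⟨ sum-cong (λ i → ≈-trans (⟦⟧-ε i i) (δ-refl i)) ⟩
    sum {suc d} (λ _ → 1#)     ≈⟨ sum-const (suc d) 1# ⟩
    D * 1#                     ≈⟨ *-identityʳ D ⟩
    D                          ∎

  D*D : D * D ≈ (suc d ℕ.* suc d) ⨯ 1#
  D*D = ≈-sym (×1-homo-* (suc d) (suc d))

  χ^≈D^⇒χχ*≈D*D : ∀ x m → χ x ↑ suc m ≈ D ↑ suc m → χ x * star (χ x) ≈ D * D
  -- `d + d * suc d` is the predecessor of (d + 1)², the integer that |χ|² is compared with.
  χ^≈D^⇒χχ*≈D*D x m h = ≈-trans (root-unique (χ x) (d ℕ.+ d ℕ.* suc d) m (begin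
    (χ x * star (χ x)) ↑ suc m              ≈⟨ ^-distrib-* (χ x) (star (χ x)) (suc m) ⟩
    χ x ↑ suc m * star (χ x) ↑ suc m        ≈⟨ *-cong h (≈-trans (≈-sym (star-^ (χ x) (suc m)))
                                                 (≈-trans (star-cong h) (star-^ D (suc m)))) ⟩
    D ↑ suc m * star D ↑ suc m              ≈⟨ *-congˡ (^-congˡ (suc m) (star-× (suc d))) ⟩
    D ↑ suc m * D ↑ suc m                   ≈⟨ ^-distrib-* D D (suc m) ⟨
    (D * D) ↑ suc m                         ≈⟨ ^-congˡ (suc m) D*D ⟩
    ((suc d ℕ.* suc d) ⨯ 1#) ↑ suc m        ∎)) (≈-sym D*D)

  star-1⁻ : star (- 1#) ≈ - 1#
  star-1⁻ = begin
    star (- 1#)                   ≈⟨ +-identityʳ _ ⟨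
    star (- 1#) + 0#              ≈⟨ +-congˡ (-‿inverseʳ 1#) ⟨
    star (- 1#) + (1# + - 1#)     ≈⟨ +-assoc _ 1# (- 1#) ⟨
    (star (- 1#) + 1#) + - 1#     ≈⟨ +-congʳ (+-congˡ star-1) ⟨
    (star (- 1#) + star 1#) + - 1# ≈⟨ +-congʳ (star-+ (- 1#) 1#) ⟨
    star (- 1# + 1#) + - 1#       ≈⟨ +-congʳ (≈-trans (star-cong (-‿inverseˡ 1#)) star-0) ⟩
    0# + - 1#                     ≈⟨ +-identityˡ (- 1#) ⟩
    - 1#                          ∎

  -- -1 is handed to the semiring solver as an atom n; this relation then removes the factor 1 + n.
  1+-1*x : ∀ x → (1# + - 1#) * x ≈ 0#
  1+-1*x x = ≈-trans (*-congʳ (-‿inverseʳ 1#)) (zeroˡ x)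

  -- Equality case of Cauchy–Schwarz: ∑ᵢⱼ |D Uᵢⱼ − χ δᵢⱼ|² = D (D² − |χ|²) for U = ρ(x).
  ∣χ∣≈D⇒scalar : ∀ x → χ x * star (χ x) ≈ D * D → ∀ i j → D * ⟦ x ⟧ i j ≈ χ x * δ i j
  ∣χ∣≈D⇒scalar x h i j = begin
    D * U i j                                      ≈⟨ +-identityʳ _ ⟨
    D * U i j + 0#                                 ≈⟨ +-congˡ (1+-1*x (X * δ i j)) ⟨
    D * U i j + (1# + n) * (X * δ i j)
      ≈⟨ RS.solve 3 (λ u n v → u RS.:+ (RS.con 1 RS.:+ n) RS.:* v RS.:= (u RS.:+ n RS.:* v) RS.:+ v)
                                                        ≈-refl (D * U i j) n (X * δ i j) ⟩
    W i j + X * δ i j                              ≈⟨ +-congʳ (definite₂ W ΣΣ≈0 i j) ⟩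
    0# + X * δ i j                                 ≈⟨ +-identityˡ _ ⟩
    X * δ i j                                      ∎
    where
    U = ⟦ x ⟧
    X = χ x
    X* = star (χ x)
    n = - 1#
    W : Mat (suc d)
    W i j = D * U i j + n * (X * δ i j)
    star-W : ∀ i j → star (W i j) ≈ D * star (U i j) + n * (X* * δ i j)
    star-W i j = begin
      star (D * U i j + n * (X * δ i j))                     ≈⟨ star-+ _ _ ⟩
      star (D * U i j) + star (n * (X * δ i j))              ≈⟨ +-cong (star-* D (U i j)) (star-* n _) ⟩
      star D * star (U i j) + star n * star (X * δ i j)      ≈⟨ +-cong (*-congʳ (star-× (suc d)))
                                                                  (*-cong star-1⁻ (≈-trans (star-* X (δ i j))
                                                                      (*-congˡ (star-δ i j)))) ⟩
      D * star (U i j) + n * (X* * δ i j)                    ∎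
    α β γ : Fin (suc d) → Fin (suc d) → Carrier
    α i j = U i j * star (U i j)
    β i j = δ i j * U i j
    γ i j = δ i j * star (U i j)
    row : ∀ i → sum (λ j → W i j * star (W i j)) ≈ D * D + (n * D * X*) * U i i +
        ((n * D * X) * star (U i i) + n * n * (X * X*))
    row i = begin
      sum (λ j → W i j * star (W i j))
        ≈⟨ sum-cong (λ j → ≈-trans (*-congˡ (star-W i j))
             (RS.solve 7 (λ D U U* n X X* e →
                 (D RS.:* U RS.:+ n RS.:* (X RS.:* e)) RS.:* (D RS.:* U* RS.:+ n RS.:* (X* RS.:* e))
                 RS.:= (D RS.:* D) RS.:* (U RS.:* U*) RS.:+ (n RS.:* D RS.:* X*) RS.:* (e RS.:* U)
                   RS.:+ ((n RS.:* D RS.:* X) RS.:* (e RS.:* U*) RS.:+ (n RS.:* n RS.:* (X RS.:* X*)) RS.:*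
                       (e RS.:* e)))
               ≈-refl D (U i j) (star (U i j)) n X X* (δ i j))) ⟩
      sum (λ j → (D * D) * α i j + (n * D * X*) * β i j +
          ((n * D * X) * γ i j + (n * n * (X * X*)) * (δ i j * δ i j)))
        ≈⟨ ∑-distrib-+ (λ j → (D * D) * α i j + (n * D * X*) * β i j)
            (λ j → (n * D * X) * γ i j + (n * n * (X * X*)) * (δ i j * δ i j)) ⟩
      sum (λ j → (D * D) * α i j + (n * D * X*) * β i j) + sum
          (λ j → (n * D * X) * γ i j + (n * n * (X * X*)) * (δ i j * δ i j))
        ≈⟨ +-cong (∑-distrib-+ (λ j → (D * D) * α i j) (λ j → (n * D * X*) * β i j))
                  (∑-distrib-+ (λ j → (n * D * X) * γ i j) (λ j → (n * n * (X * X*)) * (δ i j * δ i j))) ⟩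
      (sum (λ j → (D * D) * α i j) + sum (λ j → (n * D * X*) * β i j)) +
          (sum (λ j → (n * D * X) * γ i j) + sum (λ j → (n * n * (X * X*)) * (δ i j * δ i j)))
        ≈⟨ +-cong
             (+-cong (≈-trans (≈-sym (*-distribˡ-sum (D * D) (α i)))
                 (≈-trans (*-congˡ (≈-trans (adjʳ x i i) (δ-refl i))) (*-identityʳ (D * D))))
                     (≈-trans (≈-sym (*-distribˡ-sum (n * D * X*) (β i))) (*-congˡ (sum-δˡ i (U i)))))
             (+-cong (≈-trans (≈-sym (*-distribˡ-sum (n * D * X) (γ i))) (*-congˡ (sum-δˡ i (λ j → star (U i j)))))
                     (≈-trans (≈-sym (*-distribˡ-sum (n * n * (X * X*)) (λ j → δ i j * δ i j)))
                       (≈-trans (*-congˡ (≈-trans (sum-δˡ i (δ i)) (δ-refl i))) (*-identityʳ _)))) ⟩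
      D * D + (n * D * X*) * U i i + ((n * D * X) * star (U i i) + n * n * (X * X*)) ∎
    ΣΣ≈0 : sum (λ i → sum (λ j → W i j * star (W i j))) ≈ 0#
    ΣΣ≈0 = begin
      sum (λ i → sum (λ j → W i j * star (W i j)))
        ≈⟨ sum-cong row ⟩
      sum (λ i → D * D + (n * D * X*) * U i i + ((n * D * X) * star (U i i) + n * n * (X * X*)))
        ≈⟨ ∑-distrib-+ (λ i → D * D + (n * D * X*) * U i i) (λ i → (n * D * X) * star (U i i) + n * n * (X * X*)) ⟩
      sum (λ i → D * D + (n * D * X*) * U i i) + sum (λ i → (n * D * X) * star (U i i) + n * n * (X * X*))
        ≈⟨ +-cong (∑-distrib-+ (λ _ → D * D) (λ i → (n * D * X*) * U i i))
                  (∑-distrib-+ (λ i → (n * D * X) * star (U i i)) (λ _ → n * n * (X * X*))) ⟩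
      (sum {suc d} (λ _ → D * D) + sum (λ i → (n * D * X*) * U i i)) +
          (sum (λ i → (n * D * X) * star (U i i)) + sum {suc d} (λ _ → n * n * (X * X*)))
        ≈⟨ +-cong (+-cong (sum-const (suc d) (D * D)) (≈-sym (*-distribˡ-sum (n * D * X*) (λ i → U i i))))
                  (+-cong (≈-trans (≈-sym (*-distribˡ-sum (n * D * X) (λ i → star (U i i))))
                      (*-congˡ (≈-sym (star-sum (λ i → U i i)))))
                          (≈-trans (sum-const (suc d) (n * n * (X * X*))) (*-congˡ (*-congˡ h)))) ⟩
      (D * (D * D) + (n * D * X*) * X) + ((n * D * X) * X* + D * (n * n * (D * D)))
        ≈⟨ RS.solve 4 (λ D n X X* → (D RS.:* (D RS.:* D) RS.:+ (n RS.:* D RS.:* X*) RS.:* X) RS.:+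
            ((n RS.:* D RS.:* X) RS.:* X* RS.:+ D RS.:* (n RS.:* n RS.:* (D RS.:* D)))
              RS.:= D RS.:* ((D RS.:* D) RS.:+ n RS.:* n RS.:* (D RS.:* D) RS.:+ (n RS.:+ n) RS.:*
                  (X RS.:* X*))) ≈-refl D n X X* ⟩
      D * (D * D + n * n * (D * D) + (n + n) * (X * X*))
        ≈⟨ *-congˡ (+-congˡ (*-congˡ h)) ⟩
      D * (D * D + n * n * (D * D) + (n + n) * (D * D))
        ≈⟨ RS.solve 2 (λ D n → D RS.:* (D RS.:* D RS.:+ n RS.:* n RS.:* (D RS.:* D) RS.:+ (n RS.:+ n) RS.:*
            (D RS.:* D))
              RS.:= (RS.con 1 RS.:+ n) RS.:* (D RS.:* (D RS.:* D) RS.:* (RS.con 1 RS.:+ n))) ≈-refl D n ⟩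
      (1# + n) * (D * (D * D) * (1# + n))
        ≈⟨ 1+-1*x _ ⟩
      0# ∎

  scalar-commutes : ∀ (U V : Mat (suc d)) X → (∀ i j → D * U i j ≈ X * δ i j) → U ∙ V ≈ₘ V ∙ U
  scalar-commutes U V X h i k = *-cancel D≉0 (begin
    D * (U ∙ V) i k                     ≈⟨ *-distribˡ-sum D (λ j → U i j * V j k) ⟩
    sum (λ j → D * (U i j * V j k))     ≈⟨ sum-cong (λ j → ≈-trans (≈-sym (*-assoc D (U i j) (V j k)))
                                             (≈-trans (*-congʳ (h i j)) (*-assoc X (δ i j) (V j k)))) ⟩
    sum (λ j → X * (δ i j * V j k))     ≈⟨ *-distribˡ-sum X (λ j → δ i j * V j k) ⟨
    X * (δ ∙ V) i k                     ≈⟨ *-congˡ (≈-trans (∙-identityˡ V i k) (≈-sym (∙-identityʳ V i k))) ⟩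
    X * (V ∙ δ) i k                     ≈⟨ *-distribˡ-sum X (λ j → V i j * δ j k) ⟩
    sum (λ j → X * (V i j * δ j k))     ≈⟨ sum-cong (λ j → begin
      X * (V i j * δ j k)
        ≈⟨ RS.solve 3 (λ x v e → x RS.:* (v RS.:* e) RS.:= v RS.:* (x RS.:* e)) ≈-refl X (V i j) (δ j k) ⟩
      V i j * (X * δ j k)    ≈⟨ *-congˡ (h j k) ⟨
      V i j * (D * U j k)
        ≈⟨ RS.solve 3 (λ v D u → v RS.:* (D RS.:* u) RS.:= D RS.:* (v RS.:* u)) ≈-refl (V i j) D (U j k) ⟩
      D * (V i j * U j k)    ∎) ⟩
    sum (λ j → D * (V i j * U j k))     ≈⟨ *-distribˡ-sum D (λ j → V i j * U j k) ⟨
    D * (V ∙ U) i k                     ∎)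

  χ^≈D^⇒commutes : ∀ x m → χ x ↑ suc m ≈ D ↑ suc m → ∀ y → ⟦ x G.∙ y ⟧ ≈ₘ ⟦ y G.∙ x ⟧
  χ^≈D^⇒commutes x m h y i k = begin
    ⟦ x G.∙ y ⟧ i k        ≈⟨ ⟦⟧-∙ x y i k ⟩
    (⟦ x ⟧ ∙ ⟦ y ⟧) i k    ≈⟨ scalar-commutes ⟦ x ⟧ ⟦ y ⟧ (χ x) (∣χ∣≈D⇒scalar x (χ^≈D^⇒χχ*≈D*D x m h)) i k ⟩
    (⟦ y ⟧ ∙ ⟦ x ⟧) i k    ≈⟨ ⟦⟧-∙ y x i k ⟨
    ⟦ y G.∙ x ⟧ i k        ∎

  -- An upper bound for f (e + 1) whenever e, f ≤ |K|, so that f steps of length e + 1 always fit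
  -- below k.
  threshold : ℕ
  threshold = suc order ℕ.* suc order

  -- Splitting χ^(c + (m+1) e) as χ^c · (χ^(m+1))^e turns the values of `a` along the progression
  -- into power sums with weights χ^c and nodes χ^(m+1). The node D^(m+1) belongs to the identity
  -- alone, and its weight D^c is not 0.
  a-progression : ∀ c m → (∀ x → χ x ↑ suc m ≈ D ↑ suc m → x G.≈ G.ε) →
    ¬ (∀ e → e ℕ.≤ order → a (c ℕ.+ suc m ℕ.* e) ≈ 0#)
  a-progression c m central h = some-power-sum-≉0 (λ x → χ (element x) ↑ suc m) (λ x → χ (element x) ↑ c) o
    (λ eq → ^-≉0 D≉0 c (≈-trans (≈-sym (^-congˡ c χ-o)) eq))
    (λ x x≢o eq → x≢o (trans (sym (index-element x))
        (index-cong (central (element x) (≈-trans eq (^-congˡ (suc m) χ-o))))))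
    (λ e e≤N → ≈-trans (sum-cong (λ x → ≈-sym (≈-trans (^-homo-* (χ (element x)) c (suc m ℕ.* e))
      (*-congˡ (≈-sym (^-assocʳ (χ (element x)) (suc m) e)))))) (h e e≤N))
    where
    o = index G.ε
    χ-o : χ (element o) ≈ D
    χ-o = ≈-trans (χ-cong (element-index G.ε)) χ-ε

  -- Some m ≤ order + 1 has a m ≠ 0; the residue class of k mod m then contains an exponent
  -- c + m e ≤ k with a (c + m e) ≠ 0, and k is reached from it by adding multiples of m.
  a-≉0 : (∀ x → (∀ y → ⟦ x G.∙ y ⟧ ≈ₘ ⟦ y G.∙ x ⟧) → x G.≈ G.ε) → ∀ k → threshold ℕ.≤ k → ¬ a k ≈ 0#
  -- The exponents here are 1 + e. Starting from 1 excludes the exponent 0, where `a` is nonzero for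
  -- a trivial reason but which cannot serve as a modulus.
  a-≉0 central k t≤k ak≈0 = a-progression 1 0 (λ x h → central x (χ^≈D^⇒commutes x 0 h)) λ e e≤N →
    subst (λ m → a (suc m) ≈ 0#) (sym (ℕₚ.+-identityʳ e)) (stable λ am≉0 →
      a-progression (k ℕ.% suc e) e (λ x h → central x (χ^≈D^⇒commutes x e h)) λ f f≤N → stable λ aj≉0 →
        a-multiple-≉0 (k ℕ.% suc e ℕ.+ suc e ℕ.* f) (suc e) (k ℕ./ suc e ℕ.∸ f) aj≉0 am≉0
          (subst (λ j → a j ≈ 0#) (sym (split e f e≤N f≤N)) ak≈0))
    where
    split : ∀ e f → e ℕ.≤ order → f ℕ.≤ order → (k ℕ.% suc e ℕ.+ suc e ℕ.* f) ℕ.+ (k ℕ./ suc e ℕ.∸ f) ℕ.* suc e ≡ k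
    split e f e≤N f≤N = ≡.begin
      (k ℕ.% suc e ℕ.+ suc e ℕ.* f) ℕ.+ (k ℕ./ suc e ℕ.∸ f) ℕ.* suc e
        ≡.≡⟨ ℕₚ.+-assoc (k ℕ.% suc e) (suc e ℕ.* f) _ ⟩
      k ℕ.% suc e ℕ.+ (suc e ℕ.* f ℕ.+ (k ℕ./ suc e ℕ.∸ f) ℕ.* suc e)
        ≡.≡⟨ cong (λ z → k ℕ.% suc e ℕ.+ (z ℕ.+ (k ℕ./ suc e ℕ.∸ f) ℕ.* suc e)) (ℕₚ.*-comm (suc e) f) ⟩
      k ℕ.% suc e ℕ.+ (f ℕ.* suc e ℕ.+ (k ℕ./ suc e ℕ.∸ f) ℕ.* suc e)
        ≡.≡⟨ cong (k ℕ.% suc e ℕ.+_) (ℕₚ.*-distribʳ-+ (suc e) f (k ℕ./ suc e ℕ.∸ f)) ⟨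
      k ℕ.% suc e ℕ.+ (f ℕ.+ (k ℕ./ suc e ℕ.∸ f)) ℕ.* suc e
        ≡.≡⟨ cong (λ z → k ℕ.% suc e ℕ.+ z ℕ.* suc e) (ℕₚ.m+[n∸m]≡n f≤k/m) ⟩
      k ℕ.% suc e ℕ.+ k ℕ./ suc e ℕ.* suc e
        ≡.≡⟨ DivMod.m≡m%n+[m/n]*n k (suc e) ⟨
      k ≡.∎
      where
      module ≡ = ≡-Reasoning
      f≤k/m : f ℕ.≤ k ℕ./ suc e
      f≤k/m = subst (ℕ._≤ k ℕ./ suc e) (DivMod.m*n/n≡m f (suc e))
        (DivMod./-monoˡ-≤ (suc e) (ℕₚ.≤-trans (ℕₚ.*-mono-≤ (ℕₚ.m≤n⇒m≤1+n f≤N) (ℕ.s≤s e≤N)) t≤k))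

-- Tensor factors coloured by columns

count : ∀ {m n} → (Fin n → Fin m) → Fin m → ℕ
count {n = zero}  f u = 0
count {n = suc n} f u = (if does (f zero Finₚ.≟ u) then 1 else 0) ℕ.+ count (f ∘ suc) u

module Colourings (S : StarRing) {c ℓ : Level} (K : FiniteGroup c ℓ) (d : ℕ) (ρ : StarRep S K d) where
  open StarRing S hiding (sum; zero) renaming
      (refl to ≈-refl; sym to ≈-sym; trans to ≈-trans; reflexive to ≈-reflexive)
  open StarRingProperties S
  open Characters S K d ρ
  open StarRep ρ
  open G using (order; element)
  open ≈-Reasoning

  prod-^-indicator : ∀ {m} (F : Vector Carrier m) v → prod (λ u → F u ↑ (if does (v Finₚ.≟ u) then 1 else 0)) ≈ F v
  prod-^-indicator F v = ≈-trans (Π.sum-single (λ u → F u ↑ (if does (v Finₚ.≟ u) then 1 else 0)) v off) on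
    where
    off : ∀ u → u ≢ v → F u ↑ (if does (v Finₚ.≟ u) then 1 else 0) ≈ 1#
    off u u≢v with v Finₚ.≟ u
    ... | yes v≡u = contradiction (sym v≡u) u≢v
    ... | no _    = ≈-refl
    on : F v ↑ (if does (v Finₚ.≟ v) then 1 else 0) ≈ F v
    on with v Finₚ.≟ v
    ... | yes _  = *-identityʳ (F v)
    ... | no v≢v = contradiction refl v≢v

  prod-count : ∀ {m n} (F : Vector Carrier m) (f : Fin n → Fin m) →
    prod (λ i → F (f i)) ≈ prod (λ u → F u ↑ count f u)
  prod-count {m} {zero}  F f = ≈-sym (Π.sum-replicate-zero m)
  prod-count {m} {suc n} F f = ≈-sym (begin
    prod (λ u → F u ↑ (e u ℕ.+ count (f ∘ suc) u))
      ≈⟨ Π.sum-cong (λ u → ^-homo-* (F u) (e u) (count (f ∘ suc) u)) ⟩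
    prod (λ u → F u ↑ e u * F u ↑ count (f ∘ suc) u)
      ≈⟨ Π.∑-distrib-+ (λ u → F u ↑ e u) (λ u → F u ↑ count (f ∘ suc) u) ⟩
    prod (λ u → F u ↑ e u) * prod (λ u → F u ↑ count (f ∘ suc) u)
      ≈⟨ *-cong (prod-^-indicator F (f zero)) (≈-sym (prod-count F (f ∘ suc))) ⟩
    F (f zero) * prod (λ i → F (f (suc i))) ∎)
    where
    e : Fin m → ℕ
    e u = if does (f zero Finₚ.≟ u) then 1 else 0

  module _ {m n : ℕ} (f : Fin n → Fin m) where

    colour : Fin (order ℕ.^ m) → Fin m → G.Carrier
    colour y u = element (finToFun {order} {m} y u)

    -- Sum over the group K^m, acting on the i-th tensor factor through its f(i)-th coordinate.
    Q : Mat (d ℕ.^ n)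
    Q = Σₘ (λ y → ⨂ρ n (colour y ∘ f))

    Q-invariant : ∀ (g : Fin m → G.Carrier) → ⨂ρ n (g ∘ f) ∙ Q ≈ₘ Q
    Q-invariant g = Σₘ-invariant (⨂ρ n (g ∘ f)) (λ y → ⨂ρ n (colour y ∘ f))
      (lift-permutation m (left-mul ∘ g)) λ y i j → ≈-trans
        (⨂ρ-∙ n (g ∘ f) (colour y ∘ f) i j)
        (⨂ρ-cong n (λ l → G.sym (G.trans
          (G.reflexive (cong element (Finₚ.finToFun-funToFin {m} {order} _ (f l))))
          (element-index (g (f l) G.∙ colour y (f l))))) i j)

    tr-Q : tr Q ≈ prod (λ u → a (count f u))
    tr-Q = begin
      sum (λ i → sum (λ y → ⨂ρ n (colour y ∘ f) i i))
        ≈⟨ ∑-comm (λ i y → ⨂ρ n (colour y ∘ f) i i) ⟩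
      sum (λ y → tr (⨂ρ n (colour y ∘ f)))
        ≈⟨ sum-cong (λ y → ≈-trans (⨂-tr n (λ i → ⟦ colour y (f i) ⟧)) (prod-count (χ ∘ colour y) f)) ⟩
      sum (λ y → prod (λ u → χ (colour y u) ↑ count f u))
        ≈⟨ sum-finToFun m (λ u x → χ (element x) ↑ count f u) ⟩
      prod (λ u → a (count f u)) ∎

    -- Every column of Q is a fixed vector. If all fixed vectors were 0, then Q and its trace would
    -- be 0, against the product formula `tr-Q`.
    invariants-nonzero : (∀ u → ¬ a (count f u) ≈ 0#) →
      ¬ (∀ v → (∀ g i → sum (λ j → ⨂ρ n (g ∘ f) i j * v j) ≈ v i) → ∀ i → v i ≈ 0#)
    invariants-nonzero a≉0 h = prod-≉0 (λ u → a (count f u)) a≉0 (≈-trans (≈-sym tr-Q)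
      (sum-zero _ (λ i → h (λ j → Q j i) (λ g j → Q-invariant g j i) i)))

-- Operator norms of averages

≤ʳ-trans : ∀ {x y z} → x ≤ʳ y → y ≤ʳ z → x ≤ʳ z
≤ʳ-trans {x} {y} {z} (mk≤ x≤y) (mk≤ y≤z) = mk≤ λ ε 0<ε →
  let M , b = x≤y (½ ℚ.* ε) (½*-pos 0<ε)
      N , c = y≤z (½ ℚ.* ε) (½*-pos 0<ε)
  in M ℕ.⊔ N , λ i h → begin
       seq x i                                    ≤⟨ b i (ℕₚ.m⊔n≤o⇒m≤o M N h) ⟩
       seq y i ℚ.+ ½ ℚ.* ε                        ≤⟨ ℚₚ.+-monoˡ-≤ (½ ℚ.* ε) (c i (ℕₚ.m⊔n≤o⇒n≤o M N h)) ⟩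
       (seq z i ℚ.+ ½ ℚ.* ε) ℚ.+ ½ ℚ.* ε          ≡⟨ ℚₚ.+-assoc (seq z i) (½ ℚ.* ε) (½ ℚ.* ε) ⟩
       seq z i ℚ.+ (½ ℚ.* ε ℚ.+ ½ ℚ.* ε)          ≡⟨ cong (seq z i ℚ.+_) (½*+½* ε) ⟩
       seq z i ℚ.+ ε                              ∎
  where open ℚₚ.≤-Reasoning

∣p-q∣≤ε⇒p≤q+ε : ∀ {ε} p q → ℚ.∣ p ℚ.- q ∣ ℚ.≤ ε → p ℚ.≤ q ℚ.+ ε
∣p-q∣≤ε⇒p≤q+ε {ε} p q h = begin
  p                  ≡⟨ solve 2 (λ a b → a := b :+ (a :- b)) refl p q ⟩
  q ℚ.+ (p ℚ.- q)    ≤⟨ ℚₚ.+-monoʳ-≤ q (ℚₚ.≤-trans (p≤∣p∣ (p ℚ.- q)) h) ⟩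
  q ℚ.+ ε            ∎
  where open ℚₚ.≤-Reasoning

≈ʳ⇒≤ʳ : ∀ {x y} → x ≈ʳ y → x ≤ʳ y
≈ʳ⇒≤ʳ {x} {y} (mk≈ x≈y) = mk≤ λ ε 0<ε → let N , b = x≈y ε 0<ε in
  N , λ i N≤i → ∣p-q∣≤ε⇒p≤q+ε (seq x i) (seq y i) (ℚₚ.<⇒≤ (b i N≤i))

pointwise-≤ : ∀ {x y} → (∀ i → seq x i ℚ.≤ seq y i) → x ≤ʳ y
pointwise-≤ x≤y = mk≤ λ ε 0<ε → 0 , λ i _ → ℚₚ.≤-trans (x≤y i) (p≤p+q (ℚₚ.<⇒≤ 0<ε))

-- For given ε a single late term of x is compared with 1 - ε/2, which is decidable over ℚ; a term
-- below it would make x < 1 by a margin of ε/4.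
≮1⇒1≤ : ∀ x → ¬ x <ʳ 1ʳ → 1ʳ ≤ʳ x
≮1⇒1≤ x x≮1 = mk≤ λ ε 0<ε → go ε 0<ε (cauchy x (½ ℚ.* (½ ℚ.* ε)) (½*-pos (½*-pos 0<ε)))
  where
  open ℚₚ.≤-Reasoning
  go : ∀ ε → 0ℚ ℚ.< ε → (∃[ N ] ∀ i j → N ℕ.≤ i → N ℕ.≤ j → ℚ.∣ seq x i ℚ.- seq x j ∣ ℚ.< ½ ℚ.* (½ ℚ.* ε)) →
    ∃[ N ] ∀ i → N ℕ.≤ i → 1ℚ ℚ.≤ seq x i ℚ.+ ε
  go ε 0<ε (N , b) with 1ℚ ℚₚ.≤? seq x N ℚ.+ ½ ℚ.* ε
  ... | yes 1≤ = N , λ i N≤i → begin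
    1ℚ                                             ≤⟨ 1≤ ⟩
    seq x N ℚ.+ ½ ℚ.* ε
      ≤⟨ ℚₚ.+-mono-≤ (∣p-q∣≤ε⇒p≤q+ε (seq x N) (seq x i) (ℚₚ.<⇒≤ (b N i ℕₚ.≤-refl N≤i)))
                                                       (ℚₚ.≤-refl {½ ℚ.* ε}) ⟩
    (seq x i ℚ.+ ½ ℚ.* (½ ℚ.* ε)) ℚ.+ ½ ℚ.* ε      ≤⟨ p≤p+q (ℚₚ.<⇒≤ (½*-pos (½*-pos 0<ε))) ⟩
    (seq x i ℚ.+ ½ ℚ.* (½ ℚ.* ε)) ℚ.+ ½ ℚ.* ε ℚ.+ ½ ℚ.* (½ ℚ.* ε)
      ≡⟨ solve 2 (λ x e → (x :+ con ½ :* (con ½ :* e)) :+ con ½ :* e :+ con ½ :* (con ½ :* e) := x :+ e) refl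
          (seq x i) ε ⟩
    seq x i ℚ.+ ε                                  ∎
  ... | no 1≰ = contradiction (mk< (½ ℚ.* (½ ℚ.* ε) , ½*-pos (½*-pos 0<ε) , N , λ i N≤i → begin
    seq x i ℚ.+ ½ ℚ.* (½ ℚ.* ε)                           ≤⟨ ℚₚ.+-monoˡ-≤ (½ ℚ.* (½ ℚ.* ε))
                                                             (∣p-q∣≤ε⇒p≤q+ε (seq x i) (seq x N)
                                                                 (ℚₚ.<⇒≤ (b i N N≤i ℕₚ.≤-refl))) ⟩
    (seq x N ℚ.+ ½ ℚ.* (½ ℚ.* ε)) ℚ.+ ½ ℚ.* (½ ℚ.* ε)
      ≡⟨ solve 2 (λ x e → (x :+ con ½ :* (con ½ :* e)) :+ con ½ :* (con ½ :* e) := x :+ con ½ :* e) refl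
          (seq x N) ε ⟩
    seq x N ℚ.+ ½ ℚ.* ε                                   ≤⟨ ℚₚ.<⇒≤ (ℚₚ.≰⇒> 1≰) ⟩
    1ℚ                                                    ∎)) x≮1

*-mono-nonneg : ∀ {p q r} → 0ℚ ℚ.≤ p → q ℚ.≤ r → p ℚ.* q ℚ.≤ p ℚ.* r
*-mono-nonneg {p} 0≤p = ℚₚ.*-monoˡ-≤-nonNeg p {{ℚ.nonNegative 0≤p}}

-- If 0 ≤ b ≤ 1 − δ then 1 − b² ≥ δ/2, the lower bound on b being used as b ≥ −1/2.
s≤b²s⇒s≈0 : ∀ b s → 0ʳ ≤ʳ b → b <ʳ 1ʳ → Nonneg s → s ≤ʳ (b *ʳ b) *ʳ s → s ≈ʳ 0ʳ
s≤b²s⇒s≈0 b s (mk≤ 0≤b) (mk< (δ , 0<δ , L , b<1)) 0≤s (mk≤ s≤b²s) = ≈0-intro s λ ε 0<ε →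
  let η       = (½ ℚ.* δ) ℚ.* (½ ℚ.* ε)
      0<½δ    = ½*-pos 0<δ
      0<½ε    = ½*-pos 0<ε
      M , -½≤ = 0≤b ½ (ℚₚ.positive⁻¹ ½)
      N , s≤  = s≤b²s η (ℚₚ.positive⁻¹ η {{ℚₚ.pos*pos⇒pos (½ ℚ.* δ) {{ℚ.positive 0<½δ}} (½ ℚ.* ε)
          {{ℚ.positive 0<½ε}}}})
  in L ℕ.⊔ (M ℕ.⊔ N) , λ i h →
    let L≤i  = ℕₚ.m⊔n≤o⇒m≤o L (M ℕ.⊔ N) h
        MN≤i = ℕₚ.m⊔n≤o⇒n≤o L (M ℕ.⊔ N) h
        B    = seq b i
        σ    = seq s i
        δ≤1-B : δ ℚ.≤ 1ℚ ℚ.- B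
        δ≤1-B = begin
          δ                     ≡⟨ solve 2 (λ d b → d := (b :+ d) :- b) refl δ B ⟩
          (B ℚ.+ δ) ℚ.- B       ≤⟨ ℚₚ.+-monoˡ-≤ (ℚ.- B) (b<1 i L≤i) ⟩
          1ℚ ℚ.- B              ∎
        ½≤1+B : ½ ℚ.≤ 1ℚ ℚ.+ B
        ½≤1+B = begin
          ½                     ≤⟨ ℚₚ.+-monoʳ-≤ ½ (-½≤ i (ℕₚ.m⊔n≤o⇒m≤o M N MN≤i)) ⟩
          ½ ℚ.+ (B ℚ.+ ½)       ≡⟨ solve 1 (λ b → con ½ :+ (b :+ con ½) := con 1ℚ :+ b) refl B ⟩
          1ℚ ℚ.+ B              ∎
        ½δσ≤η : (½ ℚ.* δ) ℚ.* σ ℚ.≤ η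
        ½δσ≤η = begin
          (½ ℚ.* δ) ℚ.* σ
            ≤⟨ ℚₚ.*-monoʳ-≤-nonNeg σ {{ℚ.nonNegative (0≤s i)}}
                (*-mono-≤ℚ (ℚₚ.nonNegative⁻¹ ½) (ℚₚ.<⇒≤ 0<δ) ½≤1+B δ≤1-B) ⟩
          ((1ℚ ℚ.+ B) ℚ.* (1ℚ ℚ.- B)) ℚ.* σ
            ≡⟨ solve 2 (λ b s → ((con 1ℚ :+ b) :* (con 1ℚ :- b)) :* s := s :- b :* b :* s) refl B σ ⟩
          σ ℚ.- B ℚ.* B ℚ.* σ
            ≤⟨ ℚₚ.+-monoˡ-≤ (ℚ.- (B ℚ.* B ℚ.* σ)) (s≤ i (ℕₚ.m⊔n≤o⇒n≤o M N MN≤i)) ⟩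
          (B ℚ.* B ℚ.* σ ℚ.+ η) ℚ.- B ℚ.* B ℚ.* σ
            ≡⟨ solve 2 (λ a e → (a :+ e) :- a := e) refl (B ℚ.* B ℚ.* σ) η ⟩
          η ∎
    in ℚₚ.≤-<-trans (ℚₚ.≤-reflexive (ℚₚ.0≤p⇒∣p∣≡p (0≤s i))) (ℚₚ.≤-<-trans
         (ℚₚ.*-cancelˡ-≤-pos (½ ℚ.* δ) {{ℚ.positive 0<½δ}} ½δσ≤η) (½ε<ε 0<ε))
  where
  open ℚₚ.≤-Reasoning
  ½ε<ε : ∀ {ε} → 0ℚ ℚ.< ε → ½ ℚ.* ε ℚ.< ε
  ½ε<ε {ε} 0<ε = begin-strict
    ½ ℚ.* ε                  ≡⟨ ℚₚ.+-identityʳ _ ⟨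
    ½ ℚ.* ε ℚ.+ 0ℚ           <⟨ ℚₚ.+-monoʳ-< (½ ℚ.* ε) (½*-pos 0<ε) ⟩
    ½ ℚ.* ε ℚ.+ ½ ℚ.* ε      ≡⟨ ½*+½* ε ⟩
    ε                        ∎

module ℚΣ = SemiringSum (CommutativeRing.semiring ℚₚ.+-*-commutativeRing)
module ℝR = CommutativeRing ℝ-commutativeRing
module ℝΣ where
  open SemiringSum ℝR.semiring public
  open FiniteSums ℝR.+-commutativeMonoid public using (sum-cong)
module ℂΣ where
  open SemiringSum ℂR.semiring public
  open FiniteSums ℂR.+-commutativeMonoid public using (sum-cong)

seq-sumʳ : ∀ {n} (f : Vector ℝ n) i → seq (sumʳ f) i ≡ ℚΣ.sum (λ j → seq (f j) i)
seq-sumʳ {zero}  f i = refl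
seq-sumʳ {suc n} f i = cong (seq (f zero) i ℚ.+_) (seq-sumʳ (f ∘ suc) i)

im-sumᶜ : ∀ {n} (f : Vector ℂ n) → im (sumᶜ f) ≡ sumʳ (im ∘ f)
im-sumᶜ {zero}  f = refl
im-sumᶜ {suc n} f = cong (im (f zero) +ʳ_) (im-sumᶜ (f ∘ suc))

fromℕ-+ : ∀ m n → fromℕ (m ℕ.+ n) ≡ fromℕ m ℚ.+ fromℕ n
fromℕ-+ m n = ℚₚ.toℚᵘ-injective (ℚᵘₚ.≃-trans
  (ℚᵘ.*≡* (ℤS.solve 2 (λ a b → (a ℤS.:+ b) ℤS.:* ℤS.con (ℤ.+ 1)
    ℤS.:= (a ℤS.:* ℤS.con (ℤ.+ 1) ℤS.:+ b ℤS.:* ℤS.con (ℤ.+ 1)) ℤS.:* ℤS.con (ℤ.+ 1)) refl (ℤ.+ m) (ℤ.+ n)))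
  (ℚᵘₚ.≃-sym (ℚₚ.toℚᵘ-homo-+ (fromℕ m) (fromℕ n))))

-- The expansion of ∑ (μ - xⱼ)² ≥ 0. With μ independent of x the inequality goes through by
-- induction on n.
2μΣx≤ : ∀ {n} μ (x : Fin n → ℚ) →
  μ ℚ.* ℚΣ.sum x ℚ.+ μ ℚ.* ℚΣ.sum x ℚ.≤ fromℕ n ℚ.* (μ ℚ.* μ) ℚ.+ ℚΣ.sum (λ j → x j ℚ.* x j)
2μΣx≤ {zero}  μ x = ℚₚ.≤-reflexive (solve 1 (λ m → m :* con 0ℚ :+ m :* con 0ℚ
                      := con 0ℚ :* (m :* m) :+ con 0ℚ) refl μ)
2μΣx≤ {suc n} μ x = begin
  μ ℚ.* (y ℚ.+ σ) ℚ.+ μ ℚ.* (y ℚ.+ σ)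
    ≤⟨ p≤p+q (0≤p*p (μ ℚ.- y)) ⟩
  μ ℚ.* (y ℚ.+ σ) ℚ.+ μ ℚ.* (y ℚ.+ σ) ℚ.+ (μ ℚ.- y) ℚ.* (μ ℚ.- y)
    ≡⟨ solve 3 (λ m y s → m :* (y :+ s) :+ m :* (y :+ s) :+ (m :- y) :* (m :- y)
         := (m :* s :+ m :* s) :+ (m :* m :+ y :* y)) refl μ y σ ⟩
  (μ ℚ.* σ ℚ.+ μ ℚ.* σ) ℚ.+ (μ ℚ.* μ ℚ.+ y ℚ.* y)
    ≤⟨ ℚₚ.+-monoˡ-≤ (μ ℚ.* μ ℚ.+ y ℚ.* y) (2μΣx≤ μ (x ∘ suc)) ⟩
  (fromℕ n ℚ.* (μ ℚ.* μ) ℚ.+ τ) ℚ.+ (μ ℚ.* μ ℚ.+ y ℚ.* y)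
    ≡⟨ solve 4 (λ n m t y → (n :* (m :* m) :+ t) :+ (m :* m :+ y :* y)
         := (con 1ℚ :+ n) :* (m :* m) :+ (y :* y :+ t)) refl (fromℕ n) μ τ y ⟩
  (1ℚ ℚ.+ fromℕ n) ℚ.* (μ ℚ.* μ) ℚ.+ (y ℚ.* y ℚ.+ τ)
    ≡⟨ cong (λ z → z ℚ.* (μ ℚ.* μ) ℚ.+ (y ℚ.* y ℚ.+ τ)) (sym (fromℕ-+ 1 n)) ⟩
  fromℕ (suc n) ℚ.* (μ ℚ.* μ) ℚ.+ (y ℚ.* y ℚ.+ τ) ∎
  where
  open ℚₚ.≤-Reasoning
  y = x zero
  σ = ℚΣ.sum (x ∘ suc)
  τ = ℚΣ.sum (λ j → x (suc j) ℚ.* x (suc j))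

-- `2μΣx≤` with μ the mean of x, divided by t; the two μ² terms combine because the sum of x is t μ.
square-mean : ∀ t .{{_ : ℕ.NonZero t}} (x : Fin t → ℚ) → let q = ℤ.+ 1 ℚ./ t in
  (q ℚ.* ℚΣ.sum x) ℚ.* (q ℚ.* ℚΣ.sum x) ℚ.≤ q ℚ.* ℚΣ.sum (λ j → x j ℚ.* x j)
square-mean (suc t) x = begin
  μ ℚ.* μ
    ≡⟨ solve 1 (λ m → m :* m := (m :* m :+ m :* m) :- m :* m) refl μ ⟩
  (μ ℚ.* μ ℚ.+ μ ℚ.* μ) ℚ.- μ ℚ.* μ
    ≡⟨ solve 3 (λ m q s → (m :* (q :* s) :+ m :* (q :* s)) :- m :* m
                      := q :* (m :* s :+ m :* s) :- m :* m) refl μ q σ ⟩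
  q ℚ.* (μ ℚ.* σ ℚ.+ μ ℚ.* σ) ℚ.- μ ℚ.* μ
    ≤⟨ ℚₚ.+-monoˡ-≤ (ℚ.- (μ ℚ.* μ)) (*-mono-nonneg (ℚₚ.nonNegative⁻¹ q {{1/suc-nonNeg t}}) (2μΣx≤ μ x)) ⟩
  q ℚ.* (fromℕ (suc t) ℚ.* (μ ℚ.* μ) ℚ.+ τ) ℚ.- μ ℚ.* μ
    ≡⟨ solve 4 (λ q n m t → q :* (n :* (m :* m) :+ t) :- m :* m
                      := (n :* q) :* (m :* m) :+ q :* t :- m :* m) refl q (fromℕ (suc t)) μ τ ⟩
  (fromℕ (suc t) ℚ.* q) ℚ.* (μ ℚ.* μ) ℚ.+ q ℚ.* τ ℚ.- μ ℚ.* μ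
    ≡⟨ cong (λ z → z ℚ.* (μ ℚ.* μ) ℚ.+ q ℚ.* τ ℚ.- μ ℚ.* μ) (*-1/suc t) ⟩
  1ℚ ℚ.* (μ ℚ.* μ) ℚ.+ q ℚ.* τ ℚ.- μ ℚ.* μ
    ≡⟨ solve 2 (λ m u → con 1ℚ :* (m :* m) :+ u :- m :* m := u) refl μ (q ℚ.* τ) ⟩
  q ℚ.* τ ∎
  where
  open ℚₚ.≤-Reasoning
  q = ℤ.+ 1 ℚ./ suc t
  σ = ℚΣ.sum x
  μ = q ℚ.* σ
  τ = ℚΣ.sum (λ j → x j ℚ.* x j)

starRep : ∀ {c ℓ} {K : FiniteGroup c ℓ} {d} → UnitaryRep K d → StarRep ℂ-starRing K d
starRep ρ = record
  { ⟦_⟧ = ⟦_⟧ ; ⟦⟧-cong = ⟦⟧-cong ; ⟦⟧-∙ = homo ; ⟦⟧-ε = ε-homo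
  ; adjˡ = proj₁ ∘ unitary ; adjʳ = proj₂ ∘ unitary }
  where open UnitaryRep ρ

module ℂM = StarRingProperties ℂ-starRing

-- `_⊗_` splits an index by `remQuot`, which is also how `finToFun` produces its first digit; hence
-- the recursions agree factor by factor.
tensorPower≈⨂ : ∀ {c ℓ} {K : FiniteGroup c ℓ} {d} (ρ : UnitaryRep K d) n g →
  tensorPower ρ n g ≈ᴹ ℂM.⨂ n (λ l → UnitaryRep.⟦_⟧ ρ (g l))
tensorPower≈⨂ ρ zero    g zero zero = ≈ᶜ-refl
tensorPower≈⨂ {d = d} ρ (suc n) g i j = ℂR.*-congˡ
  (tensorPower≈⨂ ρ n (tail g) (remainder {d} (d ℕ.^ n) i) (remainder {d} (d ℕ.^ n) j))

abs²-cong : ∀ {z w} → z ≈ᶜ w → abs² z ≈ʳ abs² w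
abs²-cong (p , q) = +ʳ-cong (*ʳ-cong p p) (*ʳ-cong q q)

‖‖²-cong : ∀ {n} {v w : ℂ^ n} → v ≈ᵛ w → ‖ v ‖² ≈ʳ ‖ w ‖²
‖‖²-cong {v = v} {w} v≈w = ℝΣ.sum-cong (λ i → abs²-cong {v i} {w i} (v≈w i))

Isometry : ∀ {n} → Matrix n → Set
Isometry A = ∀ v → ‖ A *ᵛ v ‖² ≈ʳ ‖ v ‖²

*ᵛ-cong : ∀ {n} {A B : Matrix n} → A ≈ᴹ B → ∀ v → (A *ᵛ v) ≈ᵛ (B *ᵛ v)
*ᵛ-cong A≈B v i = ℂΣ.sum-cong (λ j → ℂR.*-congʳ {v j} (A≈B i j))

A†A≈1⇒isometry : ∀ {n} (A : Matrix n) → A † *ᴹ A ≈ᴹ 1ᴹ → Isometry A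
A†A≈1⇒isometry A A†A v = ≈ʳ-trans (≈ʳ-sym (≋⇒≈ʳ (‖‖²-≋ (A *ᵛ v))))
  (≈ʳ-trans (proj₁ (ℂM.isometry A A†A v)) (≋⇒≈ʳ (‖‖²-≋ v)))

scale : ∀ t .{{_ : ℕ.NonZero t}} → ℂ
scale t = fromℚ (ℤ.+ 1 ℚ./ t) +i 0ʳ

average-*ᵛ : ∀ {n} t .{{_ : ℕ.NonZero t}} (A : Fin t → Matrix n) v →
  (average t A *ᵛ v) ≈ᵛ (λ i → scale t *ᶜ sumᶜ (λ m → (A m *ᵛ v) i))
average-*ᵛ t A v i = begin
  sumᶜ (λ j → scale t *ᶜ sumᶜ (λ m → A m i j) *ᶜ v j)
    ≈⟨ ℂΣ.sum-cong (λ j → ℂR.trans (ℂR.*-assoc (scale t) _ (v j))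
        (ℂR.*-congˡ {scale t} (ℂΣ.*-distribʳ-sum (v j) (λ m → A m i j)))) ⟩
  sumᶜ (λ j → scale t *ᶜ sumᶜ (λ m → A m i j *ᶜ v j))
    ≈⟨ ℂΣ.*-distribˡ-sum (scale t) (λ j → sumᶜ (λ m → A m i j *ᶜ v j)) ⟨
  scale t *ᶜ sumᶜ (λ j → sumᶜ (λ m → A m i j *ᶜ v j))
    ≈⟨ ℂR.*-congˡ {scale t} (ℂΣ.∑-comm (λ j m → A m i j *ᶜ v j)) ⟩
  scale t *ᶜ sumᶜ (λ m → (A m *ᵛ v) i) ∎
  where open Relation.Binary.Reasoning.Setoid ℂR.setoid

abs²-mean : ∀ t .{{_ : ℕ.NonZero t}} (z : Fin t → ℂ) i →
  seq (abs² (scale t *ᶜ sumᶜ z)) i ℚ.≤ seq (fromℚ (ℤ.+ 1 ℚ./ t) *ʳ sumʳ (abs² ∘ z)) i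
abs²-mean t z i = begin
  (q ℚ.* X ℚ.- 0ℚ ℚ.* Y) ℚ.* (q ℚ.* X ℚ.- 0ℚ ℚ.* Y) ℚ.+ (q ℚ.* Y ℚ.+ 0ℚ ℚ.* X) ℚ.* (q ℚ.* Y ℚ.+ 0ℚ ℚ.* X)
    ≡⟨ solve 3 (λ q X Y → (q :* X :- con 0ℚ :* Y) :* (q :* X :- con 0ℚ :* Y)
                     :+ (q :* Y :+ con 0ℚ :* X) :* (q :* Y :+ con 0ℚ :* X)
                     := (q :* X) :* (q :* X) :+ (q :* Y) :* (q :* Y)) refl q X Y ⟩
  (q ℚ.* X) ℚ.* (q ℚ.* X) ℚ.+ (q ℚ.* Y) ℚ.* (q ℚ.* Y)
    ≡⟨ cong₂ (λ X Y → (q ℚ.* X) ℚ.* (q ℚ.* X) ℚ.+ (q ℚ.* Y) ℚ.* (q ℚ.* Y))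
         (trans (cong (λ r → seq r i) (re-sumᶜ z)) (seq-sumʳ (re ∘ z) i))
         (trans (cong (λ r → seq r i) (im-sumᶜ z)) (seq-sumʳ (im ∘ z) i)) ⟩
  (q ℚ.* ℚΣ.sum x) ℚ.* (q ℚ.* ℚΣ.sum x) ℚ.+ (q ℚ.* ℚΣ.sum y) ℚ.* (q ℚ.* ℚΣ.sum y)
    ≤⟨ ℚₚ.+-mono-≤ (square-mean t x) (square-mean t y) ⟩
  q ℚ.* ℚΣ.sum (λ m → x m ℚ.* x m) ℚ.+ q ℚ.* ℚΣ.sum (λ m → y m ℚ.* y m)
    ≡⟨ ℚₚ.*-distribˡ-+ q (ℚΣ.sum (λ m → x m ℚ.* x m)) (ℚΣ.sum (λ m → y m ℚ.* y m)) ⟨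
  q ℚ.* (ℚΣ.sum (λ m → x m ℚ.* x m) ℚ.+ ℚΣ.sum (λ m → y m ℚ.* y m))
    ≡⟨ cong (q ℚ.*_) (sym (trans (seq-sumʳ (abs² ∘ z) i)
        (ℚΣ.∑-distrib-+ (λ m → x m ℚ.* x m) (λ m → y m ℚ.* y m)))) ⟩
  q ℚ.* seq (sumʳ (abs² ∘ z)) i ∎
  where
  open ℚₚ.≤-Reasoning
  q = ℤ.+ 1 ℚ./ t
  X = seq (re (sumᶜ z)) i
  Y = seq (im (sumᶜ z)) i
  x y : Fin t → ℚ
  x m = seq (re (z m)) i
  y m = seq (im (z m)) i

sumʳ-mono : ∀ {n} (f g : Vector ℝ n) i → (∀ j → seq (f j) i ℚ.≤ seq (g j) i) → seq (sumʳ f) i ℚ.≤ seq (sumʳ g) i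
sumʳ-mono {zero}  f g i f≤g = ℚₚ.≤-refl
sumʳ-mono {suc n} f g i f≤g = ℚₚ.+-mono-≤ (f≤g zero) (sumʳ-mono (f ∘ suc) (g ∘ suc) i (f≤g ∘ suc))

sumʳ-const : ∀ n x → sumʳ {n} (λ _ → x) ≋ fromℚ (fromℕ n) *ʳ x
sumʳ-const zero    x i = sym (ℚₚ.*-zeroˡ (seq x i))
sumʳ-const (suc n) x i = begin
  seq x i ℚ.+ seq (sumʳ {n} (λ _ → x)) i       ≡⟨ cong (seq x i ℚ.+_) (sumʳ-const n x i) ⟩
  seq x i ℚ.+ fromℕ n ℚ.* seq x i
    ≡⟨ solve 2 (λ x n → x :+ n :* x := (con 1ℚ :+ n) :* x) refl (seq x i) (fromℕ n) ⟩
  (1ℚ ℚ.+ fromℕ n) ℚ.* seq x i                 ≡⟨ cong (ℚ._* seq x i) (fromℕ-+ 1 n) ⟨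
  fromℕ (suc n) ℚ.* seq x i                    ∎
  where open ≡-Reasoning

mean-const : ∀ t .{{_ : ℕ.NonZero t}} x → fromℚ (ℤ.+ 1 ℚ./ t) *ʳ sumʳ {t} (λ _ → x) ≋ x
mean-const (suc t) x i = begin
  q ℚ.* seq (sumʳ {suc t} (λ _ → x)) i      ≡⟨ cong (q ℚ.*_) (sumʳ-const (suc t) x i) ⟩
  q ℚ.* (fromℕ (suc t) ℚ.* seq x i)
    ≡⟨ solve 3 (λ q n x → q :* (n :* x) := (n :* q) :* x) refl q (fromℕ (suc t)) (seq x i) ⟩
  (fromℕ (suc t) ℚ.* q) ℚ.* seq x i         ≡⟨ cong (ℚ._* seq x i) (*-1/suc t) ⟩
  1ℚ ℚ.* seq x i                            ≡⟨ ℚₚ.*-identityˡ (seq x i) ⟩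
  seq x i                                   ∎
  where
  open ≡-Reasoning
  q = ℤ.+ 1 ℚ./ suc t

-- Convexity of ‖·‖².
average-contracts : ∀ {n} t .{{_ : ℕ.NonZero t}} (A : Fin t → Matrix n) → (∀ m → Isometry (A m)) →
  ∀ v → ‖ average t A *ᵛ v ‖² ≤ʳ ‖ v ‖²
average-contracts t A iso v = ≤ʳ-trans (≈ʳ⇒≤ʳ (‖‖²-cong (average-*ᵛ t A v)))
  (≤ʳ-trans (pointwise-≤ {sumʳ (λ i → abs² (scale t *ᶜ sumᶜ (λ m → (A m *ᵛ v) i)))}
                         {sumʳ (λ i → q *ʳ sumʳ (λ m → abs² ((A m *ᵛ v) i)))}
              (λ k → sumʳ-mono _ (λ i → q *ʳ sumʳ (λ m → abs² ((A m *ᵛ v) i))) k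
                  (λ i → abs²-mean t (λ m → (A m *ᵛ v) i) k)))
    (≈ʳ⇒≤ʳ (begin
      sumʳ (λ i → q *ʳ sumʳ (λ m → abs² ((A m *ᵛ v) i)))
        ≈⟨ ℝΣ.*-distribˡ-sum q (λ i → sumʳ (λ m → abs² ((A m *ᵛ v) i))) ⟨
      q *ʳ sumʳ (λ i → sumʳ (λ m → abs² ((A m *ᵛ v) i)))
        ≈⟨ *ʳ-cong {q} ≈ʳ-refl (ℝΣ.∑-comm (λ i m → abs² ((A m *ᵛ v) i))) ⟩
      q *ʳ sumʳ (λ m → ‖ A m *ᵛ v ‖²)
        ≈⟨ *ʳ-cong {q} ≈ʳ-refl (ℝΣ.sum-cong (λ m → iso m v)) ⟩
      q *ʳ sumʳ {t} (λ _ → ‖ v ‖²)                         ≈⟨ ≋⇒≈ʳ (mean-const t ‖ v ‖²) ⟩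
      ‖ v ‖²                                               ∎)))
  where
  open Relation.Binary.Reasoning.Setoid ℝR.setoid
  q = fromℚ (ℤ.+ 1 ℚ./ t)

scale-const : ∀ t .{{_ : ℕ.NonZero t}} z → scale t *ᶜ sumᶜ {t} (λ _ → z) ≈ᶜ z
scale-const t z = ≋⇒≈ᶜ
  (λ k → trans (cong (λ r → q ℚ.* seq r k ℚ.- 0ℚ ℚ.* seq (im s) k) (re-sumᶜ {t} (λ _ → z)))
    (trans (solve 2 (λ a b → a :- con 0ℚ :* b := a) refl (q ℚ.* seq (sumʳ {t} (λ _ → re z)) k) (seq (im s) k))
           (mean-const t (re z) k)))
  (λ k → trans (cong (λ r → q ℚ.* seq r k ℚ.+ 0ℚ ℚ.* seq (re s) k) (im-sumᶜ {t} (λ _ → z)))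
    (trans (solve 2 (λ a b → a :+ con 0ℚ :* b := a) refl (q ℚ.* seq (sumʳ {t} (λ _ → im z)) k) (seq (re s) k))
           (mean-const t (im z) k)))
  where
  q = ℤ.+ 1 ℚ./ t
  s = sumᶜ {t} (λ _ → z)

average-fixes : ∀ {n} t .{{_ : ℕ.NonZero t}} (A : Fin t → Matrix n) v → (∀ m → (A m *ᵛ v) ≈ᵛ v) →
  (average t A *ᵛ v) ≈ᵛ v
average-fixes t A v fix i = ≈ᶜ-trans (average-*ᵛ t A v i) (≈ᶜ-trans
  (ℂR.*-congˡ {scale t} (ℂΣ.sum-cong {t} {λ m → (A m *ᵛ v) i} {λ _ → v i} (λ m → fix m i)))
  (scale-const t (v i)))

-- The upper bound is contraction. For the lower one, a bound b < 1 applied to a vector v fixed by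
-- all A m, hence by the average, gives ‖v‖² ≤ b²‖v‖² and so v = 0, contrary to the hypothesis.
average-norm≡1 : ∀ {n} t .{{_ : ℕ.NonZero t}} (A : Fin t → Matrix n) → (∀ m → Isometry (A m)) →
  ¬ (∀ v → (∀ m → (A m *ᵛ v) ≈ᵛ v) → ∀ i → v i ≈ᶜ 0ᶜ) → IsOpNorm (average t A) 1ʳ
average-norm≡1 t A iso nonzero =
  ( pointwise-≤ (λ _ → ℚₚ.<⇒≤ 0<1)
  , λ v → ≤ʳ-trans (average-contracts t A iso v)
      (≈ʳ⇒≤ʳ (≋⇒≈ʳ {‖ v ‖²} {(1ʳ *ʳ 1ʳ) *ʳ ‖ v ‖²} λ i → sym (ℚₚ.*-identityˡ (seq ‖ v ‖² i)))) ) ,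
  λ b (0≤b , bound) → ≮1⇒1≤ b λ b<1 → nonzero λ v fix → ‖‖²≈0⇒≈0 v
    (s≤b²s⇒s≈0 b ‖ v ‖² 0≤b b<1 (sumʳ-nonneg (abs² ∘ v) (λ j → 0≤abs² (v j)))
      (≤ʳ-trans (≈ʳ⇒≤ʳ (≈ʳ-sym (‖‖²-cong (average-fixes t A v fix)))) (bound v)))

-- The exponential function

suc*expTerm : ∀ q j → fromℕ (suc j) ℚ.* expTerm q (suc j) ≡ q ℚ.* expTerm q j
suc*expTerm q j = begin
  fromℕ (suc j) ℚ.* (expTerm q j ℚ.* (q ℚ.* r))
    ≡⟨ solve 4 (λ n t q r → n :* (t :* (q :* r)) := (n :* r) :* (q :* t)) refl (fromℕ (suc j)) (expTerm q j) q r ⟩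
  (fromℕ (suc j) ℚ.* r) ℚ.* (q ℚ.* expTerm q j)     ≡⟨ cong (ℚ._* (q ℚ.* expTerm q j)) (*-1/suc j) ⟩
  1ℚ ℚ.* (q ℚ.* expTerm q j)                        ≡⟨ ℚₚ.*-identityˡ _ ⟩
  q ℚ.* expTerm q j                                 ∎
  where
  open ≡-Reasoning
  r = ℤ.+ 1 ℚ./ suc j

suc*-injective : ∀ j {p q} → fromℕ (suc j) ℚ.* p ≡ fromℕ (suc j) ℚ.* q → p ≡ q
suc*-injective j {p} {q} h = begin
  p                                   ≡⟨ ℚₚ.*-identityˡ p ⟨
  1ℚ ℚ.* p                            ≡⟨ cong (ℚ._* p) (*-1/suc j) ⟨
  (fromℕ (suc j) ℚ.* r) ℚ.* p
    ≡⟨ solve 3 (λ n r p → (n :* r) :* p := r :* (n :* p)) refl (fromℕ (suc j)) r p ⟩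
  r ℚ.* (fromℕ (suc j) ℚ.* p)         ≡⟨ cong (r ℚ.*_) h ⟩
  r ℚ.* (fromℕ (suc j) ℚ.* q)
    ≡⟨ solve 3 (λ n r p → r :* (n :* p) := (n :* r) :* p) refl (fromℕ (suc j)) r q ⟩
  (fromℕ (suc j) ℚ.* r) ℚ.* q         ≡⟨ cong (ℚ._* q) (*-1/suc j) ⟩
  1ℚ ℚ.* q                            ≡⟨ ℚₚ.*-identityˡ q ⟩
  q                                   ∎
  where
  open ≡-Reasoning
  r = ℤ.+ 1 ℚ./ suc j

-- segment q i n = ∑_{s<n} q^(i+s)/(i+s)!
segment : ℚ → ℕ → ℕ → ℚ
segment q i zero    = 0ℚ
segment q i (suc n) = expTerm q i ℚ.+ segment q (suc i) n

segment-suc : ∀ q i n → segment q i (suc n) ≡ segment q i n ℚ.+ expTerm q (i ℕ.+ n)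
segment-suc q i zero    = trans (ℚₚ.+-comm (expTerm q i) 0ℚ)
    (cong (λ k → 0ℚ ℚ.+ expTerm q k) (sym (ℕₚ.+-identityʳ i)))
segment-suc q i (suc n) = trans (cong (expTerm q i ℚ.+_) (segment-suc q (suc i) n))
  (trans (sym (ℚₚ.+-assoc (expTerm q i) (segment q (suc i) n) _))
    (cong (λ k → (expTerm q i ℚ.+ segment q (suc i) n) ℚ.+ expTerm q k) (sym (ℕₚ.+-suc i n))))

segment≡expPartial : ∀ q n → segment q 0 n ≡ expPartial q n
segment≡expPartial q zero    = refl
segment≡expPartial q (suc n) = trans (segment-suc q 0 n) (cong (ℚ._+ expTerm q n) (segment≡expPartial q n))

expTerm-nonneg : ∀ {q} → 0ℚ ℚ.≤ q → ∀ j → 0ℚ ℚ.≤ expTerm q j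
expTerm-nonneg 0≤q zero    = ℚₚ.<⇒≤ 0<1
expTerm-nonneg 0≤q (suc j) = 0≤p*q (expTerm-nonneg 0≤q j) (0≤p*q 0≤q (ℚₚ.nonNegative⁻¹ _ {{1/suc-nonNeg j}}))

expPartial-nonneg : ∀ {q} → 0ℚ ℚ.≤ q → ∀ j → 0ℚ ℚ.≤ expPartial q j
expPartial-nonneg 0≤q zero    = ℚₚ.≤-refl
expPartial-nonneg 0≤q (suc j) = 0≤p+q (expPartial-nonneg 0≤q j) (expTerm-nonneg 0≤q j)

∣expTerm∣≡ : ∀ q j → ℚ.∣ expTerm q j ∣ ≡ expTerm ℚ.∣ q ∣ j
∣expTerm∣≡ q zero    = refl
∣expTerm∣≡ q (suc j) = trans (∣expTerm∣ q j) (cong (ℚ._* (ℚ.∣ q ∣ ℚ.* (ℤ.+ 1 ℚ./ suc j))) (∣expTerm∣≡ q j))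

module _ (x y : ℚ) where
  open ≡-Reasoning

  -- conv i l = ∑_{s≤l} x^(i+s)/(i+s)! · y^(l-s)/(l-s)!
  conv : ℕ → ℕ → ℚ
  conv i zero    = expTerm x i ℚ.* expTerm y 0
  conv i (suc l) = expTerm x i ℚ.* expTerm y (suc l) ℚ.+ conv (suc i) l

  -- triangle i n = ∑_{s<n} x^(i+s)/(i+s)! · ∑_{r<n-s} y^r/r!
  triangle : ℕ → ℕ → ℚ
  triangle i zero    = 0ℚ
  triangle i (suc n) = expTerm x i ℚ.* expPartial y (suc n) ℚ.+ triangle (suc i) n

  -- The total degree i + l + 1 of each term is the sum of its degrees in x and in y, and
  -- multiplying by a degree lowers that factor by one (`suc*expTerm`). Only the first term has no
  -- predecessor in x; it leaves the boundary term with coefficient i, which is absent for i = 0.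
  conv-step : ∀ i l → fromℕ (i ℕ.+ suc l) ℚ.* conv i (suc l) ≡
    fromℕ i ℚ.* (expTerm x i ℚ.* expTerm y (suc l)) ℚ.+ (x ℚ.+ y) ℚ.* conv i l
  conv-step i zero = begin
    fromℕ (i ℕ.+ 1) ℚ.* (t ℚ.* u₁ ℚ.+ t₁ ℚ.* 1ℚ)
      ≡⟨ cong (ℚ._* (t ℚ.* u₁ ℚ.+ t₁ ℚ.* 1ℚ)) (fromℕ-+ i 1) ⟩
    (n ℚ.+ 1ℚ) ℚ.* (t ℚ.* u₁ ℚ.+ t₁ ℚ.* 1ℚ)
      ≡⟨ solve 4 (λ n t u₁ t₁ → (n :+ con 1ℚ) :* (t :* u₁ :+ t₁ :* con 1ℚ)
           := n :* (t :* u₁) :+ (t :* (con 1ℚ :* u₁) :+ (con 1ℚ :+ n) :* t₁)) refl n t u₁ t₁ ⟩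
    n ℚ.* (t ℚ.* u₁) ℚ.+ (t ℚ.* (1ℚ ℚ.* u₁) ℚ.+ (1ℚ ℚ.+ n) ℚ.* t₁)
      ≡⟨ cong₂ (λ a b → n ℚ.* (t ℚ.* u₁) ℚ.+ (t ℚ.* a ℚ.+ b)) (suc*expTerm y 0)
           (trans (cong (ℚ._* t₁) (sym (fromℕ-+ 1 i))) (suc*expTerm x i)) ⟩
    n ℚ.* (t ℚ.* u₁) ℚ.+ (t ℚ.* (y ℚ.* 1ℚ) ℚ.+ x ℚ.* t)
      ≡⟨ cong (n ℚ.* (t ℚ.* u₁) ℚ.+_) (solve 3
          (λ t x y → t :* (y :* con 1ℚ) :+ x :* t := (x :+ y) :* (t :* con 1ℚ)) refl t x y) ⟩
    n ℚ.* (t ℚ.* u₁) ℚ.+ (x ℚ.+ y) ℚ.* (t ℚ.* 1ℚ) ∎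
    where
    n = fromℕ i
    t = expTerm x i
    t₁ = expTerm x (suc i)
    u₁ = expTerm y 1
  conv-step i (suc l) = begin
    fromℕ (i ℕ.+ suc (suc l)) ℚ.* (t ℚ.* u₂ ℚ.+ C₁)
      ≡⟨ solve 3 (λ N p q → N :* (p :+ q) := N :* p :+ N :* q) refl (fromℕ (i ℕ.+ suc (suc l))) (t ℚ.* u₂) C₁ ⟩
    fromℕ (i ℕ.+ suc (suc l)) ℚ.* (t ℚ.* u₂) ℚ.+ fromℕ (i ℕ.+ suc (suc l)) ℚ.* C₁
      ≡⟨ cong₂ (λ a b → a ℚ.* (t ℚ.* u₂) ℚ.+ fromℕ b ℚ.* C₁) (fromℕ-+ i (suc (suc l))) (ℕₚ.+-suc i (suc l)) ⟩
    (n ℚ.+ m) ℚ.* (t ℚ.* u₂) ℚ.+ fromℕ (suc i ℕ.+ suc l) ℚ.* C₁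
      ≡⟨ cong₂ ℚ._+_ (solve 4 (λ n m t u → (n :+ m) :* (t :* u) := n :* (t :* u) :+ t :*
          (m :* u)) refl n m t u₂) (conv-step (suc i) l) ⟩
    (n ℚ.* (t ℚ.* u₂) ℚ.+ t ℚ.* (m ℚ.* u₂)) ℚ.+ (fromℕ (suc i) ℚ.* (t₁ ℚ.* u₁) ℚ.+ (x ℚ.+ y) ℚ.* C)
      ≡⟨ cong₂ (λ a b → (n ℚ.* (t ℚ.* u₂) ℚ.+ t ℚ.* a) ℚ.+ (b ℚ.+ (x ℚ.+ y) ℚ.* C)) (suc*expTerm y (suc l))
           (trans (sym (ℚₚ.*-assoc (fromℕ (suc i)) t₁ u₁)) (cong (ℚ._* u₁) (suc*expTerm x i))) ⟩
    (n ℚ.* (t ℚ.* u₂) ℚ.+ t ℚ.* (y ℚ.* u₁)) ℚ.+ (x ℚ.* t ℚ.* u₁ ℚ.+ (x ℚ.+ y) ℚ.* C)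
      ≡⟨ solve 6 (λ w t u x y C → (w :+ t :* (y :* u)) :+ (x :* t :* u :+ (x :+ y) :* C)
           := w :+ (x :+ y) :* (t :* u :+ C)) refl (n ℚ.* (t ℚ.* u₂)) t u₁ x y C ⟩
    n ℚ.* (t ℚ.* u₂) ℚ.+ (x ℚ.+ y) ℚ.* (t ℚ.* u₁ ℚ.+ C) ∎
    where
    n = fromℕ i
    m = fromℕ (suc (suc l))
    t = expTerm x i
    t₁ = expTerm x (suc i)
    u₁ = expTerm y (suc l)
    u₂ = expTerm y (suc (suc l))
    C = conv (suc i) l
    C₁ = conv (suc i) (suc l)

  -- Both sides satisfy (l + 1) c(l + 1) = (x + y) c(l) with c(0) = 1: the binomial theorem without
  -- binomial coefficients.
  conv≡expTerm : ∀ l → conv 0 l ≡ expTerm (x ℚ.+ y) l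
  conv≡expTerm zero    = refl
  conv≡expTerm (suc l) = suc*-injective l (begin
    fromℕ (suc l) ℚ.* conv 0 (suc l)                                             ≡⟨ conv-step 0 l ⟩
    0ℚ ℚ.* (1ℚ ℚ.* expTerm y (suc l)) ℚ.+ (x ℚ.+ y) ℚ.* conv 0 l
      ≡⟨ cong₂ ℚ._+_ (ℚₚ.*-zeroˡ (1ℚ ℚ.* expTerm y (suc l))) (cong ((x ℚ.+ y) ℚ.*_) (conv≡expTerm l)) ⟩
    0ℚ ℚ.+ (x ℚ.+ y) ℚ.* expTerm (x ℚ.+ y) l                                     ≡⟨ ℚₚ.+-identityˡ _ ⟩
    (x ℚ.+ y) ℚ.* expTerm (x ℚ.+ y) l                                            ≡⟨ suc*expTerm (x ℚ.+ y) l ⟨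
    fromℕ (suc l) ℚ.* expTerm (x ℚ.+ y) (suc l)                                  ∎)

  triangle-suc : ∀ i n → triangle i (suc n) ≡ triangle i n ℚ.+ conv i n
  triangle-suc i zero    = solve 1 (λ t → t :* (con 0ℚ :+ con 1ℚ) :+ con 0ℚ := con 0ℚ :+ t :* con 1ℚ) refl
      (expTerm x i)
  triangle-suc i (suc n) = begin
    t ℚ.* (e ℚ.+ u) ℚ.+ triangle (suc i) (suc n)
      ≡⟨ cong (t ℚ.* (e ℚ.+ u) ℚ.+_) (triangle-suc (suc i) n) ⟩
    t ℚ.* (e ℚ.+ u) ℚ.+ (triangle (suc i) n ℚ.+ conv (suc i) n)
      ≡⟨ solve 5 (λ t e u T C → t :* (e :+ u) :+ (T :+ C) := (t :* e :+ T) :+ (t :* u :+ C))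
                                                                           refl t e u (triangle (suc i) n)
                                                                               (conv (suc i) n) ⟩
    (t ℚ.* e ℚ.+ triangle (suc i) n) ℚ.+ (t ℚ.* u ℚ.+ conv (suc i) n) ∎
    where
    t = expTerm x i
    e = expPartial y (suc n)
    u = expTerm y (suc n)

  triangle≡expPartial : ∀ n → triangle 0 n ≡ expPartial (x ℚ.+ y) n
  triangle≡expPartial zero    = refl
  triangle≡expPartial (suc n) = trans (triangle-suc 0 n) (cong₂ ℚ._+_ (triangle≡expPartial n) (conv≡expTerm n))

  -- The part of the square [i, i+n) × [0, N) outside the triangle.
  rest : ℕ → ℕ → ℕ → ℚ
  rest N i n = segment x i n ℚ.* expPartial y N ℚ.- triangle i n

  rest-suc : ∀ N i n → rest N i (suc n) ≡ expTerm x i ℚ.* (expPartial y N ℚ.- expPartial y (suc n)) ℚ.+ rest N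
      (suc i) n
  rest-suc N i n = solve 5 (λ t s e f T → (t :+ s) :* e :- (t :* f :+ T)
    := t :* (e :- f) :+ (s :* e :- T)) refl
    (expTerm x i) (segment x (suc i) n) (expPartial y N) (expPartial y (suc n)) (triangle (suc i) n)

expPartial-diff-bound : ∀ y m k → ℚ.∣ expPartial y (k ℕ.+ m) ℚ.- expPartial y m ∣ ℚ.≤ expPartial ℚ.∣ y ∣
    (k ℕ.+ m) ℚ.- expPartial ℚ.∣ y ∣ m
expPartial-diff-bound y m zero    = ℚₚ.≤-reflexive
    (trans (cong ℚ.∣_∣ (ℚₚ.+-inverseʳ (expPartial y m))) (sym (ℚₚ.+-inverseʳ (expPartial ℚ.∣ y ∣ m))))
expPartial-diff-bound y m (suc k) = begin
  ℚ.∣ (e ℚ.+ t) ℚ.- e₀ ∣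
    ≡⟨ cong ℚ.∣_∣ (solve 3 (λ e t e₀ → (e :+ t) :- e₀ := (e :- e₀) :+ t) refl e t e₀) ⟩
  ℚ.∣ (e ℚ.- e₀) ℚ.+ t ∣              ≤⟨ ℚₚ.∣p+q∣≤∣p∣+∣q∣ (e ℚ.- e₀) t ⟩
  ℚ.∣ e ℚ.- e₀ ∣ ℚ.+ ℚ.∣ t ∣
    ≤⟨ ℚₚ.+-mono-≤ (expPartial-diff-bound y m k) (ℚₚ.≤-reflexive (∣expTerm∣≡ y (k ℕ.+ m))) ⟩
  (E ℚ.- E₀) ℚ.+ T                    ≡⟨ solve 3 (λ e t e₀ → (e :- e₀) :+ t := (e :+ t) :- e₀) refl E T E₀ ⟩
  (E ℚ.+ T) ℚ.- E₀                    ∎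
  where
  open ℚₚ.≤-Reasoning
  e = expPartial y (k ℕ.+ m)
  t = expTerm y (k ℕ.+ m)
  e₀ = expPartial y m
  E = expPartial ℚ.∣ y ∣ (k ℕ.+ m)
  T = expTerm ℚ.∣ y ∣ (k ℕ.+ m)
  E₀ = expPartial ℚ.∣ y ∣ m

-- Outside the triangle there remain products of single terms, one from each series; taking absolute
-- values turns them into the same remainder for |x| and |y|. The condition n ≤ N keeps the triangle
-- inside the square.
rest-bound : ∀ x y N i n → n ℕ.≤ N → ℚ.∣ rest x y N i n ∣ ℚ.≤ rest ℚ.∣ x ∣ ℚ.∣ y ∣ N i n
rest-bound x y N i zero    n≤N = ℚₚ.≤-reflexive (trans
  (cong ℚ.∣_∣ (solve 1 (λ e → con 0ℚ :* e :- con 0ℚ := con 0ℚ) refl (expPartial y N)))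
  (solve 1 (λ e → con 0ℚ := con 0ℚ :* e :- con 0ℚ) refl (expPartial ℚ.∣ y ∣ N)))
rest-bound x y N i (suc n) n<N = begin
  ℚ.∣ rest x y N i (suc n) ∣                           ≡⟨ cong ℚ.∣_∣ (rest-suc x y N i n) ⟩
  ℚ.∣ t ℚ.* (e N ℚ.- e (suc n)) ℚ.+ rest x y N (suc i) n ∣
    ≤⟨ ℚₚ.∣p+q∣≤∣p∣+∣q∣ (t ℚ.* (e N ℚ.- e (suc n))) (rest x y N (suc i) n) ⟩
  ℚ.∣ t ℚ.* (e N ℚ.- e (suc n)) ∣ ℚ.+ ℚ.∣ rest x y N (suc i) n ∣
    ≤⟨ ℚₚ.+-mono-≤ (begin
         ℚ.∣ t ℚ.* (e N ℚ.- e (suc n)) ∣               ≡⟨ ℚₚ.∣p*q∣≡∣p∣*∣q∣ t (e N ℚ.- e (suc n)) ⟩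
         ℚ.∣ t ∣ ℚ.* ℚ.∣ e N ℚ.- e (suc n) ∣           ≤⟨ *-mono-nonneg (ℚₚ.0≤∣p∣ t)
                                                            (subst (λ z → ℚ.∣ e z ℚ.- e (suc n) ∣ ℚ.≤ E z ℚ.- E
                                                                (suc n)) (ℕₚ.m∸n+n≡m n<N)
                                                              (expPartial-diff-bound y (suc n) (N ℕ.∸ suc n))) ⟩
         ℚ.∣ t ∣ ℚ.* (E N ℚ.- E (suc n))               ≡⟨ cong (ℚ._* (E N ℚ.- E (suc n))) (∣expTerm∣≡ x i) ⟩
         expTerm ℚ.∣ x ∣ i ℚ.* (E N ℚ.- E (suc n))     ∎)
       (rest-bound x y N (suc i) n (ℕₚ.<⇒≤ n<N)) ⟩
  expTerm ℚ.∣ x ∣ i ℚ.* (E N ℚ.- E (suc n)) ℚ.+ rest ℚ.∣ x ∣ ℚ.∣ y ∣ N (suc i) n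
    ≡⟨ rest-suc ℚ.∣ x ∣ ℚ.∣ y ∣ N i n ⟨
  rest ℚ.∣ x ∣ ℚ.∣ y ∣ N i (suc n) ∎
  where
  open ℚₚ.≤-Reasoning
  t = expTerm x i
  e = expPartial y
  E = expPartial ℚ.∣ y ∣

expPartial-mono : ∀ {q} → 0ℚ ℚ.≤ q → ∀ m k → expPartial q m ℚ.≤ expPartial q (k ℕ.+ m)
expPartial-mono 0≤q m zero    = ℚₚ.≤-refl
expPartial-mono 0≤q m (suc k) = ℚₚ.≤-trans (expPartial-mono 0≤q m k) (p≤p+q (expTerm-nonneg 0≤q (k ℕ.+ m)))

triangle-nonneg : ∀ {x y} → 0ℚ ℚ.≤ x → 0ℚ ℚ.≤ y → ∀ i n → 0ℚ ℚ.≤ triangle x y i n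
triangle-nonneg 0≤x 0≤y i zero    = ℚₚ.≤-refl
triangle-nonneg 0≤x 0≤y i (suc n) = 0≤p+q (0≤p*q (expTerm-nonneg 0≤x i) (expPartial-nonneg 0≤y (suc n)))
    (triangle-nonneg 0≤x 0≤y (suc i) n)

-- All terms are nonnegative, and an n × N rectangle fits into the triangle of side n + N.
square≤triangle : ∀ {x y} → 0ℚ ℚ.≤ x → 0ℚ ℚ.≤ y → ∀ N i n → segment x i n ℚ.* expPartial y N ℚ.≤ triangle x y i
    (n ℕ.+ N)
square≤triangle {x} {y} 0≤x 0≤y N i zero    = ℚₚ.≤-trans (ℚₚ.≤-reflexive (ℚₚ.*-zeroˡ (expPartial y N)))
    (triangle-nonneg 0≤x 0≤y i N)
square≤triangle {x} {y} 0≤x 0≤y N i (suc n) = ℚₚ.≤-trans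
    (ℚₚ.≤-reflexive (ℚₚ.*-distribʳ-+ (expPartial y N) (expTerm x i) (segment x (suc i) n)))
  (ℚₚ.+-mono-≤ (*-mono-nonneg (expTerm-nonneg 0≤x i) (expPartial-mono 0≤y N (suc n)))
      (square≤triangle 0≤x 0≤y N (suc i) n))

-- The Cauchy product differs from the product of partial sums by the terms in the square outside
-- the triangle. Taken absolutely, these are dominated by the terms from N to 2N of the series for
-- exp(|x| + |y|), which tend to 0.
exp-+-error : ∀ x y N → let z = ℚ.∣ x ∣ ℚ.+ ℚ.∣ y ∣ in
  ℚ.∣ expPartial x N ℚ.* expPartial y N ℚ.- expPartial (x ℚ.+ y) N ∣ ℚ.≤ expPartial z (N ℕ.+ N) ℚ.- expPartial z N
exp-+-error x y N = begin
  ℚ.∣ expPartial x N ℚ.* expPartial y N ℚ.- expPartial (x ℚ.+ y) N ∣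
    ≡⟨ cong₂ (λ a b → ℚ.∣ a ℚ.* expPartial y N ℚ.- b ∣) (segment≡expPartial x N) (triangle≡expPartial x y N) ⟨
  ℚ.∣ rest x y N 0 N ∣
    ≤⟨ rest-bound x y N 0 N ℕₚ.≤-refl ⟩
  rest ℚ.∣ x ∣ ℚ.∣ y ∣ N 0 N
    ≤⟨ ℚₚ.+-monoˡ-≤ (ℚ.- triangle ℚ.∣ x ∣ ℚ.∣ y ∣ 0 N) (square≤triangle (ℚₚ.0≤∣p∣ x) (ℚₚ.0≤∣p∣ y) N 0 N) ⟩
  triangle ℚ.∣ x ∣ ℚ.∣ y ∣ 0 (N ℕ.+ N) ℚ.- triangle ℚ.∣ x ∣ ℚ.∣ y ∣ 0 N
    ≡⟨ cong₂ ℚ._-_ (triangle≡expPartial ℚ.∣ x ∣ ℚ.∣ y ∣ (N ℕ.+ N)) (triangle≡expPartial ℚ.∣ x ∣ ℚ.∣ y ∣ N) ⟩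
  expPartial (ℚ.∣ x ∣ ℚ.+ ℚ.∣ y ∣) (N ℕ.+ N) ℚ.- expPartial (ℚ.∣ x ∣ ℚ.+ ℚ.∣ y ∣) N ∎
  where open ℚₚ.≤-Reasoning

exp-+ : ∀ x y → expℚ x *ʳ expℚ y ≈ʳ expℚ (x ℚ.+ y)
exp-+ x y = mk≈ λ ε 0<ε → let M , b = expPartial-cauchy (ℚ.∣ x ∣ ℚ.+ ℚ.∣ y ∣) ε 0<ε in
  M , λ N M≤N → ℚₚ.≤-<-trans (exp-+-error x y N)
    (ℚₚ.≤-<-trans (p≤∣p∣ _) (b (N ℕ.+ N) N (ℕₚ.≤-trans M≤N (ℕₚ.m≤m+n N N)) M≤N))

1/suc≤1 : ∀ j → ℤ.+ 1 ℚ./ suc j ℚ.≤ 1ℚ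
1/suc≤1 j = begin
  r                        ≡⟨ ℚₚ.*-identityˡ r ⟨
  1ℚ ℚ.* r                 ≤⟨ ℚₚ.*-monoʳ-≤-nonNeg r {{1/suc-nonNeg j}} (fromℕ-mono-≤ (ℕ.s≤s (ℕ.z≤n {j}))) ⟩
  fromℕ (suc j) ℚ.* r      ≡⟨ *-1/suc j ⟩
  1ℚ                       ∎
  where
  open ℚₚ.≤-Reasoning
  r = ℤ.+ 1 ℚ./ suc j

-- The terms alternate in sign and decrease in absolute value.
alternating : ∀ {h} → 0ℚ ℚ.≤ h → h ℚ.≤ 1ℚ → ∀ j n →
  ∃[ r ] 0ℚ ℚ.≤ r × r ℚ.≤ 1ℚ × segment (ℚ.- h) j n ≡ expTerm (ℚ.- h) j ℚ.* r
alternating {h} 0≤h h≤1 j zero    = 0ℚ , ℚₚ.≤-refl , ℚₚ.<⇒≤ 0<1 , sym (ℚₚ.*-zeroʳ (expTerm (ℚ.- h) j))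
alternating {h} 0≤h h≤1 j (suc n) with alternating 0≤h h≤1 (suc j) n
... | r , 0≤r , r≤1 , eq = 1ℚ ℚ.- (h ℚ.* u) ℚ.* r , 0≤q-p hur≤1 , 1-≤1 , (begin
    t ℚ.+ segment (ℚ.- h) (suc j) n     ≡⟨ cong (t ℚ.+_) eq ⟩
    t ℚ.+ (t ℚ.* (ℚ.- h ℚ.* u)) ℚ.* r   ≡⟨ solve 4 (λ t h u r → t :+ (t :* ((:- h) :* u)) :* r
                                             := t :* (con 1ℚ :- (h :* u) :* r)) refl t h u r ⟩
    t ℚ.* (1ℚ ℚ.- (h ℚ.* u) ℚ.* r)      ∎)
  where
  open ≡-Reasoning
  t = expTerm (ℚ.- h) j
  u = ℤ.+ 1 ℚ./ suc j
  0≤u : 0ℚ ℚ.≤ u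
  0≤u = ℚₚ.nonNegative⁻¹ u {{1/suc-nonNeg j}}
  hur≤1 : (h ℚ.* u) ℚ.* r ℚ.≤ 1ℚ
  hur≤1 = *-mono-≤ℚ (0≤p*q 0≤h 0≤u) 0≤r (*-mono-≤ℚ 0≤h 0≤u h≤1 (1/suc≤1 j)) r≤1
  1-≤1 : 1ℚ ℚ.- (h ℚ.* u) ℚ.* r ℚ.≤ 1ℚ
  1-≤1 = ℚₚ.≤-trans (ℚₚ.+-monoʳ-≤ 1ℚ (ℚₚ.neg-antimono-≤ (0≤p*q (0≤p*q 0≤h 0≤u) 0≤r))) (ℚₚ.≤-reflexive (-0ℚ 1ℚ))

-- Beyond 1 - h the alternating series starts with h²/2, and its tail is this term times some r ≥ 0.
1-h≤expPartial : ∀ {h} → 0ℚ ℚ.≤ h → h ℚ.≤ 1ℚ → ∀ n → 1ℚ ℚ.- h ℚ.≤ expPartial (ℚ.- h) (2 ℕ.+ n)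
1-h≤expPartial {h} 0≤h h≤1 n with alternating 0≤h h≤1 2 n
... | r , 0≤r , r≤1 , eq = begin
  1ℚ ℚ.- h
    ≤⟨ p≤p+q (0≤p*q (0≤p*q (0≤p*p h) (ℚₚ.nonNegative⁻¹ ½)) 0≤r) ⟩
  (1ℚ ℚ.- h) ℚ.+ (h ℚ.* h) ℚ.* ½ ℚ.* r
    ≡⟨ solve 2 (λ h r → (con 1ℚ :- h) :+ (h :* h) :* con ½ :* r
         := con 1ℚ :+ (con 1ℚ :* ((:- h) :* con (ℤ.+ 1 ℚ./ 1))
           :+ ((con 1ℚ :* ((:- h) :* con (ℤ.+ 1 ℚ./ 1))) :* ((:- h) :* con (ℤ.+ 1 ℚ./ 2))) :* r)) refl h r ⟩
  expTerm (ℚ.- h) 0 ℚ.+ (expTerm (ℚ.- h) 1 ℚ.+ expTerm (ℚ.- h) 2 ℚ.* r)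
    ≡⟨ cong (λ z → expTerm (ℚ.- h) 0 ℚ.+ (expTerm (ℚ.- h) 1 ℚ.+ z)) eq ⟨
  segment (ℚ.- h) 0 (2 ℕ.+ n)
    ≡⟨ segment≡expPartial (ℚ.- h) (2 ℕ.+ n) ⟩
  expPartial (ℚ.- h) (2 ℕ.+ n) ∎
  where open ℚₚ.≤-Reasoning

expPower : ℚ → ℕ → ℝ
expPower q zero    = expℚ (ℚ.- 0ℚ)
expPower q (suc n) = expℚ q *ʳ expPower q n

expPower≈ : ∀ h n → expPower (ℚ.- h) n ≈ʳ expℚ (ℚ.- (fromℕ n ℚ.* h))
expPower≈ h zero    = ≋⇒≈ʳ (λ i → cong (λ z → expPartial (ℚ.- z) i) (sym (ℚₚ.*-zeroˡ h)))
expPower≈ h (suc n) = ≈ʳ-trans (*ʳ-cong {expℚ (ℚ.- h)} ≈ʳ-refl (expPower≈ h n))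
  (≈ʳ-trans (exp-+ (ℚ.- h) (ℚ.- (fromℕ n ℚ.* h))) (≋⇒≈ʳ (λ i → cong (λ z → expPartial z i) (begin
    ℚ.- h ℚ.+ ℚ.- (fromℕ n ℚ.* h)
      ≡⟨ solve 2 (λ h n → (:- h) :+ (:- (n :* h)) := :- ((con 1ℚ :+ n) :* h)) refl h (fromℕ n) ⟩
    ℚ.- ((1ℚ ℚ.+ fromℕ n) ℚ.* h)        ≡⟨ cong (λ z → ℚ.- (z ℚ.* h)) (fromℕ-+ 1 n) ⟨
    ℚ.- (fromℕ (suc n) ℚ.* h)           ∎))))
  where open ≡-Reasoning

^≤expPower : ∀ {h} → 0ℚ ℚ.≤ h → h ℚ.≤ 1ℚ → ∀ n i → (1ℚ ℚ.- h) ^ℚ n ℚ.≤ seq (expPower (ℚ.- h) n) (2 ℕ.+ i)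
^≤expPower 0≤h h≤1 zero    i = 1-h≤expPartial {0ℚ} ℚₚ.≤-refl (ℚₚ.<⇒≤ 0<1) i
^≤expPower 0≤h h≤1 (suc n) i = *-mono-≤ℚ (0≤q-p h≤1) (0≤^ℚ (0≤q-p h≤1) n) (1-h≤expPartial 0≤h h≤1 i)
    (^≤expPower 0≤h h≤1 n i)

^≤exp : ∀ {h} → 0ℚ ℚ.≤ h → h ℚ.≤ 1ℚ → ∀ n → fromℚ ((1ℚ ℚ.- h) ^ℚ n) ≤ʳ expℚ (ℚ.- (fromℕ n ℚ.* h))
^≤exp {h} 0≤h h≤1 n = ≤ʳ-trans
  -- The termwise bound holds from index 2 on, where the partial sums contain 1 - h.
  (mk≤ λ ε 0<ε → 2 , λ i 2≤i → ℚₚ.≤-trans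
    (subst (λ k → (1ℚ ℚ.- h) ^ℚ n ℚ.≤ seq (expPower (ℚ.- h) n) k) (ℕₚ.m+[n∸m]≡n 2≤i)
        (^≤expPower 0≤h h≤1 n (i ℕ.∸ 2)))
    (p≤p+q (ℚₚ.<⇒≤ 0<ε)))
  (≈ʳ⇒≤ʳ (expPower≈ h n))

-- Counting columns

module ℕΣ = FiniteSums ℕₚ.+-0-commutativeMonoid

indicator : Bool → ℕ
indicator b = if b then 1 else 0

-- Counts the words of length n over m letters in which u occurs fewer than k times. As a sum of
-- indicators it can be split by the first letter.
rare : ∀ m → ℕ → ℕ → Fin m → ℕ
rare m n k u = ℕΣ.sum (λ (w : Fin (m ℕ.^ n)) → indicator (does (count (finToFun {m} {n} w) u ℕₚ.<? k)))

ℕsum-const : ∀ n x → ℕΣ.sum {n} (λ _ → x) ≡ n ℕ.* x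
ℕsum-const zero    x = refl
ℕsum-const (suc n) x = cong (x ℕ.+_) (ℕsum-const n x)

ℕsum-mono : ∀ {n} {f g : Vector ℕ n} → (∀ i → f i ℕ.≤ g i) → ℕΣ.sum f ℕ.≤ ℕΣ.sum g
ℕsum-mono {zero}  f≤g = ℕ.z≤n
ℕsum-mono {suc n} f≤g = ℕₚ.+-mono-≤ (f≤g zero) (ℕsum-mono (f≤g ∘ suc))

term≤ℕsum : ∀ {n} (f : Vector ℕ n) i → f i ℕ.≤ ℕΣ.sum f
term≤ℕsum f zero    = ℕₚ.m≤m+n (f zero) _
term≤ℕsum f (suc i) = ℕₚ.≤-trans (term≤ℕsum (f ∘ suc) i) (ℕₚ.m≤n+m _ (f zero))

ℕsum-but-one : ∀ {m} (f : Vector ℕ (suc m)) u y → (∀ a → a ≢ u → f a ≡ y) → ℕΣ.sum f ≡ f u ℕ.+ m ℕ.* y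
ℕsum-but-one {m} f u y h = trans (ℕΣ.sum-remove {i = u} f) (cong (f u ℕ.+_)
  (trans (ℕΣ.sum-cong (λ j → h _ (Finₚ.punchInᵢ≢i u j))) (ℕsum-const m y)))

-- By the first letter: u uses up one of the allowed occurrences, each of the m other letters uses
-- up none.
rare-suc : ∀ m n k u → rare (suc m) (suc n) (suc k) u ≡ rare (suc m) n k u ℕ.+ m ℕ.* rare (suc m) n (suc k) u
rare-suc m n k u = trans (ℕΣ.sum-remQuot (suc m) (suc m ℕ.^ n) F) (trans
  (ℕsum-but-one (λ a → ℕΣ.sum (λ b → F (a , b))) u (rare (suc m) n (suc k) u) off)
  (cong (ℕ._+ m ℕ.* rare (suc m) n (suc k) u) on))
  where
  F : Fin (suc m) × Fin (suc m ℕ.^ n) → ℕ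
  F (a , b) = indicator (does (indicator (does (a Finₚ.≟ u)) ℕ.+ count (finToFun {suc m} {n} b) u ℕₚ.<? suc k))
  off : ∀ a → a ≢ u → ℕΣ.sum (λ b → F (a , b)) ≡ rare (suc m) n (suc k) u
  off a a≢u with a Finₚ.≟ u
  ... | yes a≡u = contradiction a≡u a≢u
  ... | no _    = refl
  on : ℕΣ.sum (λ b → F (u , b)) ≡ rare (suc m) n k u
  on with u Finₚ.≟ u
  ... | yes _  = refl
  ... | no u≢u = contradiction refl u≢u

-- A crude form of ∑_{i<k} C(n,i) m^(n-i) ≤ (n + 1)^k m^n. In the induction the first summand of
-- `rare-suc` lacks a factor m, which costs nothing as m ≥ 1; together the two summands give the
-- factor n + 2.
rare-bound : ∀ m .{{_ : ℕ.NonZero m}} n k u → rare (suc m) n k u ℕ.≤ suc n ℕ.^ k ℕ.* m ℕ.^ n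
rare-bound m n zero u = ℕₚ.≤-trans (ℕₚ.≤-reflexive (ℕΣ.sum-replicate-zero (suc m ℕ.^ n))) ℕ.z≤n
rare-bound m zero (suc k) u = ℕₚ.≤-reflexive (sym (trans (ℕₚ.*-identityʳ (1 ℕ.^ suc k)) (ℕₚ.^-zeroˡ (suc k))))
rare-bound m (suc n) (suc k) u = begin
  rare (suc m) (suc n) (suc k) u
    ≡⟨ rare-suc m n k u ⟩
  rare (suc m) n k u ℕ.+ m ℕ.* rare (suc m) n (suc k) u
    ≤⟨ ℕₚ.+-mono-≤ (rare-bound m n k u) (ℕₚ.*-monoʳ-≤ m (rare-bound m n (suc k) u)) ⟩
  p ℕ.* q ℕ.+ m ℕ.* (suc n ℕ.* p ℕ.* q)
    ≤⟨ ℕₚ.+-monoˡ-≤ (m ℕ.* (suc n ℕ.* p ℕ.* q)) (ℕₚ.m≤n*m (p ℕ.* q) m) ⟩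
  m ℕ.* (p ℕ.* q) ℕ.+ m ℕ.* (suc n ℕ.* p ℕ.* q)
    ≡⟨ ℕS.solve 4 (λ m p q s → m ℕS.:* (p ℕS.:* q) ℕS.:+ m ℕS.:* (s ℕS.:* p ℕS.:* q)
         ℕS.:= ((ℕS.con 1 ℕS.:+ s) ℕS.:* p) ℕS.:* (m ℕS.:* q)) refl m p q (suc n) ⟩
  (suc (suc n) ℕ.* p) ℕ.* (m ℕ.* q)
    ≤⟨ ℕₚ.*-monoˡ-≤ (m ℕ.* q) (ℕₚ.*-monoʳ-≤ (suc (suc n)) (ℕₚ.^-monoˡ-≤ k (ℕₚ.n≤1+n (suc n)))) ⟩
  suc (suc n) ℕ.^ suc k ℕ.* m ℕ.^ suc n ∎
  where
  open ℕₚ.≤-Reasoning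
  p = suc n ℕ.^ k
  q = m ℕ.^ n

Abundant : ∀ {m n} → ℕ → (Fin n → Fin m) → Set
Abundant k f = ∀ u → k ℕ.≤ count f u

abundant? : ∀ {m n} k (f : Fin n → Fin m) → Dec (Abundant k f)
abundant? k f = Finₚ.all? (λ u → k ℕₚ.≤? count f u)

indicator-not≤ : ∀ {A : Set} (A? : Dec A) {x} → (¬ A → 1 ℕ.≤ x) → indicator (not (does A?)) ℕ.≤ x
indicator-not≤ (yes _) h = ℕ.z≤n
indicator-not≤ (no ¬a) h = h ¬a

1≤indicator : ∀ {A : Set} (A? : Dec A) → A → 1 ℕ.≤ indicator (does A?)
1≤indicator (yes _) _ = ℕₚ.≤-refl
1≤indicator (no ¬a) a = contradiction a ¬a

does-true : ∀ {A : Set} (A? : Dec A) → does A? ≡ true → A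
does-true (yes a) _ = a

¬abundant-bound : ∀ {m n} k (f : Fin n → Fin m) →
  indicator (not (does (abundant? k f))) ℕ.≤ ℕΣ.sum (λ u → indicator (does (count f u ℕₚ.<? k)))
¬abundant-bound k f = indicator-not≤ (abundant? k f) λ ¬abundant →
  let u , k≰ = Finₚ.¬∀⟶∃¬ _ _ (λ u → k ℕₚ.≤? count f u) ¬abundant
  in ℕₚ.≤-trans (1≤indicator (count f u ℕₚ.<? k) (ℕₚ.≰⇒> k≰))
      (term≤ℕsum (λ u → indicator (does (count f u ℕₚ.<? k))) u)

-- Union bound over the m + 1 letters.
not-abundant-count : ∀ m .{{_ : ℕ.NonZero m}} n k →
  ℕΣ.sum (λ (w : Fin (suc m ℕ.^ n)) → indicator (not (does (abundant? k (finToFun {suc m} {n} w))))) ℕ.≤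
  suc m ℕ.* (suc n ℕ.^ k ℕ.* m ℕ.^ n)
not-abundant-count m n k = begin
  ℕΣ.sum (λ (w : Fin (suc m ℕ.^ n)) → indicator (not (does (abundant? k (finToFun {suc m} {n} w)))))
    ≤⟨ ℕsum-mono (λ w → ¬abundant-bound k (finToFun {suc m} {n} w)) ⟩
  ℕΣ.sum (λ (w : Fin (suc m ℕ.^ n)) → ℕΣ.sum (λ u → indicator (does (count (finToFun {suc m} {n} w) u ℕₚ.<? k))))
    ≡⟨ ℕΣ.∑-comm (λ (w : Fin (suc m ℕ.^ n)) u → indicator (does (count (finToFun {suc m} {n} w) u ℕₚ.<? k))) ⟩
  ℕΣ.sum (λ u → rare (suc m) n k u)
    ≤⟨ ℕsum-mono (λ u → rare-bound m n k u) ⟩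
  ℕΣ.sum {suc m} (λ _ → suc n ℕ.^ k ℕ.* m ℕ.^ n)
    ≡⟨ ℕsum-const (suc m) (suc n ℕ.^ k ℕ.* m ℕ.^ n) ⟩
  suc m ℕ.* (suc n ℕ.^ k ℕ.* m ℕ.^ n) ∎
  where open ℕₚ.≤-Reasoning

∣tabulate∣ : ∀ {n} (f : Fin n → Bool) → ∣ Vec.tabulate f ∣ ≡ ℕΣ.sum (indicator ∘ f)
∣tabulate∣ {zero}  f = refl
∣tabulate∣ {suc n} f with f zero
... | true  = cong suc (∣tabulate∣ (f ∘ suc))
... | false = ∣tabulate∣ (f ∘ suc)

sum-indicator-not : ∀ {n} (f : Fin n → Bool) → ℕΣ.sum (indicator ∘ f) ℕ.+ ℕΣ.sum (indicator ∘ not ∘ f) ≡ n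
sum-indicator-not {n} f = trans (sym (ℕΣ.∑-distrib-+ (indicator ∘ f) (indicator ∘ not ∘ f)))
  (trans (ℕΣ.sum-cong (λ i → complementary (f i))) (trans (ℕsum-const n 1) (ℕₚ.*-identityʳ n)))
  where
  complementary : ∀ b → indicator b ℕ.+ indicator (not b) ≡ 1
  complementary true  = refl
  complementary false = refl

-- The same array of digits, read as n columns of height t instead of t rows of length n. As a
-- bijection it carries counts of words over K^t back to counts of outcomes.
transpose : ∀ a n t → Fin ((a ℕ.^ n) ℕ.^ t) → Fin ((a ℕ.^ t) ℕ.^ n)
transpose a n t ω = funToFin {n} {a ℕ.^ t} (λ i → funToFin {t} {a}
    (λ m → finToFun {a} {n} (finToFun {a ℕ.^ n} {t} ω m) i))

transpose-entry : ∀ a n t ω i m →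
  finToFun {a} {t} (finToFun {a ℕ.^ t} {n} (transpose a n t ω) i) m ≡ finToFun {a} {n}
      (finToFun {a ℕ.^ n} {t} ω m) i
transpose-entry a n t ω i m = trans
  (cong (λ z → finToFun {a} {t} z m) (Finₚ.finToFun-funToFin {n} {a ℕ.^ t} _ i))
  (Finₚ.finToFun-funToFin {t} {a} _ m)

transpose-involutive : ∀ a n t ω → transpose a t n (transpose a n t ω) ≡ ω
transpose-involutive a n t ω = finToFun-injective {a ℕ.^ n} {t} _ _ λ m → finToFun-injective {a} {n} _ _ λ i →
  trans (transpose-entry a t n (transpose a n t ω) m i) (transpose-entry a n t ω i m)

transposition : ∀ a n t → Permutation ((a ℕ.^ n) ℕ.^ t) ((a ℕ.^ t) ℕ.^ n)
transposition a n t = permutation (transpose a n t) (transpose a t n) (transpose-involutive a t n)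
    (transpose-involutive a n t)

-- columns ω i lists the i-th coordinates of the t elements of K^n encoded by ω.
columns : ∀ a n t → Fin ((a ℕ.^ n) ℕ.^ t) → Fin n → Fin (a ℕ.^ t)
columns a n t ω = finToFun {a ℕ.^ t} {n} (transpose a n t ω)

abundantSet : ∀ a n t → ℕ → Subset ((a ℕ.^ n) ℕ.^ t)
abundantSet a n t k = Vec.tabulate (λ ω → does (abundant? k (columns a n t ω)))

∈abundantSet : ∀ a n t k {ω} → ω ∈ abundantSet a n t k → Abundant k (columns a n t ω)
∈abundantSet a n t k {ω} ω∈ = does-true (abundant? k (columns a n t ω))
  (trans (sym (Vecₚ.lookup∘tabulate (λ ω → does (abundant? k (columns a n t ω))) ω)) (Vecₚ.[]=⇒lookup ω∈))

abundantSet-size : ∀ a n t k → 2 ℕ.≤ a ℕ.^ t →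
  (a ℕ.^ n) ℕ.^ t ℕ.≤ ∣ abundantSet a n t k ∣ ℕ.+ a ℕ.^ t ℕ.* (suc n ℕ.^ k ℕ.* ℕ.pred (a ℕ.^ t) ℕ.^ n)
abundantSet-size a n t k 2≤M = begin
  (a ℕ.^ n) ℕ.^ t
    ≡⟨ sum-indicator-not good ⟨
  ℕΣ.sum (indicator ∘ good) ℕ.+ ℕΣ.sum (indicator ∘ not ∘ good)
    ≡⟨ cong₂ ℕ._+_ (∣tabulate∣ good) (ℕΣ.sum-permute
        (λ w → indicator (not (does (abundant? k (finToFun {a ℕ.^ t} {n} w))))) (transposition a n t)) ⟨
  ∣ abundantSet a n t k ∣ ℕ.+ ℕΣ.sum (λ w → indicator (not (does (abundant? k (finToFun {a ℕ.^ t} {n} w)))))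
    ≤⟨ ℕₚ.+-monoʳ-≤ ∣ abundantSet a n t k ∣ (bound (a ℕ.^ t) 2≤M) ⟩
  ∣ abundantSet a n t k ∣ ℕ.+ a ℕ.^ t ℕ.* (suc n ℕ.^ k ℕ.* ℕ.pred (a ℕ.^ t) ℕ.^ n) ∎
  where
  open ℕₚ.≤-Reasoning
  good : Fin ((a ℕ.^ n) ℕ.^ t) → Bool
  good ω = does (abundant? k (columns a n t ω))
  -- Stated for arbitrary M, because a ^ t itself cannot be matched against a successor.
  bound : ∀ M → 2 ℕ.≤ M → ℕΣ.sum (λ w → indicator (not (does (abundant? k (finToFun {M} {n} w))))) ℕ.≤
    M ℕ.* (suc n ℕ.^ k ℕ.* ℕ.pred M ℕ.^ n)
  bound (suc (suc m)) _ = not-abundant-count (suc m) n k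
  bound (suc zero) (ℕ.s≤s ())

-- For n = 1 the right-hand side exceeds M, so the bound is trivial there; for n ≥ 2, n + 1 ≤ n².
abundantSet-size′ : ∀ a n t k .{{_ : ℕ.NonZero n}} → 2 ℕ.≤ a ℕ.^ t → let M = a ℕ.^ t in
  M ℕ.^ n ℕ.≤ ∣ abundantSet a n t k ∣ ℕ.+ (n ℕ.^ (2 ℕ.* k) ℕ.* M) ℕ.* ℕ.pred M ℕ.^ n
abundantSet-size′ a (suc zero) t k 2≤M = begin
  M ℕ.* 1                                 ≡⟨ ℕₚ.*-identityʳ M ⟩
  M                                       ≤⟨ ℕₚ.m≤m*n M (ℕ.pred M ℕ.^ 1)
      {{ℕₚ.m^n≢0 (ℕ.pred M) 1 {{ℕ.>-nonZero (ℕₚ.pred-mono-≤ 2≤M)}}}} ⟩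
  M ℕ.* ℕ.pred M ℕ.^ 1
    ≡⟨ cong (ℕ._* ℕ.pred M ℕ.^ 1) (trans (sym (ℕₚ.*-identityˡ M)) (cong (ℕ._* M) (sym (ℕₚ.^-zeroˡ (2 ℕ.* k))))) ⟩
  (1 ℕ.^ (2 ℕ.* k) ℕ.* M) ℕ.* ℕ.pred M ℕ.^ 1 ≤⟨ ℕₚ.m≤n+m _ ∣ abundantSet a 1 t k ∣ ⟩
  ∣ abundantSet a 1 t k ∣ ℕ.+ (1 ℕ.^ (2 ℕ.* k) ℕ.* M) ℕ.* ℕ.pred M ℕ.^ 1 ∎
  where
  open ℕₚ.≤-Reasoning
  M = a ℕ.^ t
abundantSet-size′ a n@(suc (suc j)) t k 2≤M = begin
  M ℕ.^ n
    ≡⟨ trans (ℕₚ.^-*-assoc a t n) (trans (cong (a ℕ.^_) (ℕₚ.*-comm t n)) (sym (ℕₚ.^-*-assoc a n t))) ⟩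
  (a ℕ.^ n) ℕ.^ t                                                     ≤⟨ abundantSet-size a n t k 2≤M ⟩
  ∣ S ∣ ℕ.+ M ℕ.* (suc n ℕ.^ k ℕ.* ℕ.pred M ℕ.^ n)
    ≤⟨ ℕₚ.+-monoʳ-≤ ∣ S ∣ (ℕₚ.*-monoʳ-≤ M (ℕₚ.*-monoˡ-≤ (ℕ.pred M ℕ.^ n) n+1^k≤)) ⟩
  ∣ S ∣ ℕ.+ M ℕ.* (n ℕ.^ (2 ℕ.* k) ℕ.* ℕ.pred M ℕ.^ n)
    ≡⟨ cong (∣ S ∣ ℕ.+_) (trans (sym (ℕₚ.*-assoc M (n ℕ.^ (2 ℕ.* k)) _))
        (cong (ℕ._* ℕ.pred M ℕ.^ n) (ℕₚ.*-comm M (n ℕ.^ (2 ℕ.* k))))) ⟩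
  ∣ S ∣ ℕ.+ (n ℕ.^ (2 ℕ.* k) ℕ.* M) ℕ.* ℕ.pred M ℕ.^ n                ∎
  where
  open ℕₚ.≤-Reasoning
  M = a ℕ.^ t
  S = abundantSet a n t k
  n+1≤n² : suc n ℕ.≤ n ℕ.^ 2
  n+1≤n² = begin
    suc n               ≤⟨ ℕ.s≤s (ℕₚ.m≤m+n n (j ℕ.+ (2 ℕ.+ j) ℕ.* j)) ⟩
    suc (n ℕ.+ (j ℕ.+ (2 ℕ.+ j) ℕ.* j)) ≤⟨ ℕₚ.n≤1+n _ ⟩
    2 ℕ.+ (n ℕ.+ (j ℕ.+ (2 ℕ.+ j) ℕ.* j))
      ≡⟨ ℕS.solve 1 (λ j → ℕS.con 2 ℕS.:+ ((ℕS.con 2 ℕS.:+ j) ℕS.:+ (j ℕS.:+ (ℕS.con 2 ℕS.:+ j) ℕS.:* j))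
                                              ℕS.:= (ℕS.con 2 ℕS.:+ j) ℕS.:*
                                                  ((ℕS.con 2 ℕS.:+ j) ℕS.:* ℕS.con 1)) refl j ⟩
    n ℕ.^ 2             ∎
  n+1^k≤ : suc n ℕ.^ k ℕ.≤ n ℕ.^ (2 ℕ.* k)
  n+1^k≤ = begin
    suc n ℕ.^ k          ≤⟨ ℕₚ.^-monoˡ-≤ k n+1≤n² ⟩
    (n ℕ.^ 2) ℕ.^ k      ≡⟨ ℕₚ.^-*-assoc n 2 k ⟩
    n ℕ.^ (2 ℕ.* k)      ∎

-- From counts to proportions

fromℕ-* : ∀ m n → fromℕ (m ℕ.* n) ≡ fromℕ m ℚ.* fromℕ n
fromℕ-* zero    n = sym (ℚₚ.*-zeroˡ (fromℕ n))
fromℕ-* (suc m) n = begin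
  fromℕ (n ℕ.+ m ℕ.* n)                ≡⟨ fromℕ-+ n (m ℕ.* n) ⟩
  fromℕ n ℚ.+ fromℕ (m ℕ.* n)          ≡⟨ cong (fromℕ n ℚ.+_) (fromℕ-* m n) ⟩
  fromℕ n ℚ.+ fromℕ m ℚ.* fromℕ n
    ≡⟨ solve 2 (λ m n → n :+ m :* n := (con 1ℚ :+ m) :* n) refl (fromℕ m) (fromℕ n) ⟩
  (1ℚ ℚ.+ fromℕ m) ℚ.* fromℕ n         ≡⟨ cong (ℚ._* fromℕ n) (fromℕ-+ 1 m) ⟨
  fromℕ (suc m) ℚ.* fromℕ n            ∎
  where open ≡-Reasoning

*-/ : ∀ a N .{{_ : ℕ.NonZero N}} → fromℕ N ℚ.* (ℤ.+ a ℚ./ N) ≡ fromℕ a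
*-/ a (suc N) = ℚₚ.toℚᵘ-injective (ℚᵘₚ.≃-trans (ℚₚ.toℚᵘ-homo-* (fromℕ (suc N)) (ℤ.+ a ℚ./ suc N))
  (ℚᵘₚ.≃-trans (ℚᵘₚ.*-congˡ {ℚ.toℚᵘ (fromℕ (suc N))} (ℚₚ.toℚᵘ-fromℚᵘ (ℚᵘ.mkℚᵘ (ℤ.+ a) N)))
    (ℚᵘ.*≡* (ℤS.solve 2 (λ a n → (n ℤS.:* a) ℤS.:* ℤS.con (ℤ.+ 1) ℤS.:= a ℤS.:* (ℤS.con (ℤ.+ 1) ℤS.:* n)) refl
        (ℤ.+ a) (ℤ.+ suc N)))))

/≡*1/ : ∀ a N .{{_ : ℕ.NonZero N}} → ℤ.+ a ℚ./ N ≡ fromℕ a ℚ.* (ℤ.+ 1 ℚ./ N)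
/≡*1/ a N@(suc j) = suc*-injective j (begin
  fromℕ N ℚ.* (ℤ.+ a ℚ./ N)                  ≡⟨ *-/ a N ⟩
  fromℕ a                                    ≡⟨ ℚₚ.*-identityʳ (fromℕ a) ⟨
  fromℕ a ℚ.* 1ℚ                             ≡⟨ cong (fromℕ a ℚ.*_) (*-1/suc j) ⟨
  fromℕ a ℚ.* (fromℕ N ℚ.* (ℤ.+ 1 ℚ./ N))
    ≡⟨ solve 3 (λ a n r → a :* (n :* r) := n :* (a :* r)) refl (fromℕ a) (fromℕ N) (ℤ.+ 1 ℚ./ N) ⟩
  fromℕ N ℚ.* (fromℕ a ℚ.* (ℤ.+ 1 ℚ./ N))    ∎)
  where open ≡-Reasoning

fromℕ-^ : ∀ m n → fromℕ (suc m ℕ.^ n) ℚ.* (1ℚ ℚ.- (ℤ.+ 1 ℚ./ suc m)) ^ℚ n ≡ fromℕ (m ℕ.^ n)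
fromℕ-^ m zero    = refl
fromℕ-^ m (suc n) = begin
  fromℕ (suc m ℕ.* suc m ℕ.^ n) ℚ.* ((1ℚ ℚ.- h) ℚ.* q)
    ≡⟨ cong (ℚ._* ((1ℚ ℚ.- h) ℚ.* q)) (fromℕ-* (suc m) (suc m ℕ.^ n)) ⟩
  (M ℚ.* fromℕ (suc m ℕ.^ n)) ℚ.* ((1ℚ ℚ.- h) ℚ.* q)
    ≡⟨ solve 4 (λ M N h q → (M :* N) :* ((con 1ℚ :- h) :* q) := (M :- M :* h) :* (N :* q)) refl M
        (fromℕ (suc m ℕ.^ n)) h q ⟩
  (M ℚ.- M ℚ.* h) ℚ.* (fromℕ (suc m ℕ.^ n) ℚ.* q)
    ≡⟨ cong₂ (λ a b → (a ℚ.- b) ℚ.* (fromℕ (suc m ℕ.^ n) ℚ.* q)) (fromℕ-+ 1 m) (*-1/suc m) ⟩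
  ((1ℚ ℚ.+ fromℕ m) ℚ.- 1ℚ) ℚ.* (fromℕ (suc m ℕ.^ n) ℚ.* q)
    ≡⟨ cong₂ ℚ._*_ (solve 1 (λ m → (con 1ℚ :+ m) :- con 1ℚ := m) refl (fromℕ m)) (fromℕ-^ m n) ⟩
  fromℕ m ℚ.* fromℕ (m ℕ.^ n)
    ≡⟨ fromℕ-* m (m ℕ.^ n) ⟨
  fromℕ (m ℕ.^ suc n) ∎
  where
  open ≡-Reasoning
  h = ℤ.+ 1 ℚ./ suc m
  q = (1ℚ ℚ.- h) ^ℚ n
  M = fromℕ (suc m)

-- With M = m + 1 and N = M^n, the error C (M - 1)^n equals N · C (1 - 1/M)^n, so the count is
-- divided by N.
proportion-bound : ∀ m n N s C .{{_ : ℕ.NonZero N}} → N ≡ suc m ℕ.^ n → N ℕ.≤ s ℕ.+ C ℕ.* m ℕ.^ n →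
  1ℚ ℚ.- fromℕ C ℚ.* (1ℚ ℚ.- (ℤ.+ 1 ℚ./ suc m)) ^ℚ n ℚ.≤ ℤ.+ s ℚ./ N
proportion-bound m n N@(suc j) s C N≡ N≤ = begin
  1ℚ ℚ.- c ℚ.* q                       ≤⟨ ℚₚ.+-monoˡ-≤ (ℚ.- (c ℚ.* q)) 1≤ ⟩
  (p ℚ.+ c ℚ.* q) ℚ.- c ℚ.* q          ≡⟨ solve 2 (λ p z → (p :+ z) :- z := p) refl p (c ℚ.* q) ⟩
  p                                    ∎
  where
  open ℚₚ.≤-Reasoning
  c = fromℕ C
  q = (1ℚ ℚ.- (ℤ.+ 1 ℚ./ suc m)) ^ℚ n
  p = ℤ.+ s ℚ./ N
  N*1≤ : fromℕ N ℚ.* 1ℚ ℚ.≤ fromℕ N ℚ.* (p ℚ.+ c ℚ.* q)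
  N*1≤ = begin
    fromℕ N ℚ.* 1ℚ                            ≡⟨ ℚₚ.*-identityʳ (fromℕ N) ⟩
    fromℕ N                                   ≤⟨ fromℕ-mono-≤ N≤ ⟩
    fromℕ (s ℕ.+ C ℕ.* m ℕ.^ n)
      ≡⟨ trans (fromℕ-+ s (C ℕ.* m ℕ.^ n)) (cong (fromℕ s ℚ.+_) (fromℕ-* C (m ℕ.^ n))) ⟩
    fromℕ s ℚ.+ c ℚ.* fromℕ (m ℕ.^ n)
      ≡⟨ cong₂ (λ a b → a ℚ.+ c ℚ.* b) (*-/ s N) (trans (cong (λ z → fromℕ z ℚ.* q) N≡) (fromℕ-^ m n)) ⟨
    fromℕ N ℚ.* p ℚ.+ c ℚ.* (fromℕ N ℚ.* q)
      ≡⟨ solve 4 (λ n p c q → n :* p :+ c :* (n :* q) := n :* (p :+ c :* q)) refl (fromℕ N) p c q ⟩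
    fromℕ N ℚ.* (p ℚ.+ c ℚ.* q)               ∎
  1≤ : 1ℚ ℚ.≤ p ℚ.+ c ℚ.* q
  1≤ = ℚₚ.*-cancelˡ-≤-pos (fromℕ N) N*1≤

1-C*-antitone : ∀ {q} C y → fromℚ q ≤ʳ y → 1ʳ -ʳ fromℚ (fromℕ C) *ʳ y ≤ʳ fromℚ (1ℚ ℚ.- fromℕ C ℚ.* q)
1-C*-antitone {q} C y (mk≤ q≤y) = mk≤ λ ε 0<ε →
  -- δ = ε / (C + 1) rather than ε / C, so that C = 0 is covered.
  let δ , 0<δ , eq = divide {fromℕ (suc C)} {ε} (fromℕ-mono-< (ℕ.s≤s (ℕ.z≤n {C}))) 0<ε
      N , b = q≤y δ 0<δ
  in N , λ i N≤i → begin
    1ℚ ℚ.- fromℕ C ℚ.* seq y i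
      ≡⟨ solve 3 (λ c y d → con 1ℚ :- c :* y := (con 1ℚ :- c :* (y :+ d)) :+ c :* d) refl (fromℕ C) (seq y i) δ ⟩
    (1ℚ ℚ.- fromℕ C ℚ.* (seq y i ℚ.+ δ)) ℚ.+ fromℕ C ℚ.* δ
      ≤⟨ ℚₚ.+-mono-≤ (ℚₚ.+-monoʳ-≤ 1ℚ (ℚₚ.neg-antimono-≤ (*-mono-nonneg (fromℕ-mono-≤ (ℕ.z≤n {C})) (b i N≤i))))
           (ℚₚ.*-monoʳ-≤-nonNeg δ {{ℚ.nonNegative (ℚₚ.<⇒≤ 0<δ)}} (fromℕ-mono-≤ (ℕₚ.n≤1+n C))) ⟩
    (1ℚ ℚ.- fromℕ C ℚ.* q) ℚ.+ fromℕ (suc C) ℚ.* δ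
      ≡⟨ cong ((1ℚ ℚ.- fromℕ C ℚ.* q) ℚ.+_) eq ⟩
    (1ℚ ℚ.- fromℕ C ℚ.* q) ℚ.+ ε ∎
  where open ℚₚ.≤-Reasoning

probability-bound : ∀ M n N s C .{{_ : ℕ.NonZero M}} .{{_ : ℕ.NonZero N}} → N ≡ M ℕ.^ n
    → N ℕ.≤ s ℕ.+ C ℕ.* ℕ.pred M ℕ.^ n →
  1ʳ -ʳ fromℚ (ℤ.+ C ℚ./ 1) *ʳ expℚ (ℚ.- (ℤ.+ n ℚ./ M)) ≤ʳ fromℚ (ℤ.+ s ℚ./ N)
probability-bound (suc m) n N s C N≡ N≤ = ≤ʳ-trans
  (≈ʳ⇒≤ʳ (≋⇒≈ʳ {1ʳ -ʳ fromℚ (ℤ.+ C ℚ./ 1) *ʳ expℚ (ℚ.- (ℤ.+ n ℚ./ suc m))}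
      {1ʳ -ʳ fromℚ (fromℕ C) *ʳ expℚ (ℚ.- (fromℕ n ℚ.* h))}
    (λ i → cong₂ (λ a b → 1ℚ ℚ.- a ℚ.* expPartial (ℚ.- b) i)
      (trans (/≡*1/ C 1) (ℚₚ.*-identityʳ (fromℕ C))) (/≡*1/ n (suc m)))))
  (≤ʳ-trans (1-C*-antitone C (expℚ (ℚ.- (fromℕ n ℚ.* h)))
      (^≤exp (ℚₚ.nonNegative⁻¹ h {{1/suc-nonNeg m}}) (1/suc≤1 m) n))
    (pointwise-≤ (λ _ → proportion-bound m n N s C N≡ N≤)))
  where h = ℤ.+ 1 ℚ./ suc m

-- The probability bound for the random average

nonabelian⇒2≤order : ∀ {c ℓ} (K : FiniteGroup c ℓ) → FiniteGroup.NonAbelian K → 2 ℕ.≤ FiniteGroup.order K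
nonabelian⇒2≤order K nonabelian with 2 ℕₚ.≤? FiniteGroup.order K
... | yes 2≤  = 2≤
... | no 2≰   = contradiction (λ x y → all-equal (x ∙ y) (y ∙ x)) nonabelian
  where
  open FiniteGroup K using (_∙_; _≈_; order; enumeration) renaming
      (trans to ≈-trans; sym to ≈-sym; reflexive to ≈-reflexive)
  open Inverse enumeration using (to; from; strictlyInverseʳ)
  Fin-unique : ∀ {k} → ¬ 2 ℕ.≤ k → (i j : Fin k) → i ≡ j
  Fin-unique {suc zero}    2≰ zero zero = refl
  Fin-unique {suc (suc k)} 2≰ i    j    = contradiction (ℕ.s≤s (ℕ.s≤s ℕ.z≤n)) 2≰
  all-equal : ∀ x y → x ≈ y
  all-equal x y = ≈-trans (≈-sym (strictlyInverseʳ x))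
    (≈-trans (≈-reflexive (cong from (Fin-unique 2≰ (to x) (to y)))) (strictlyInverseʳ y))

module _ {c ℓ : Level} (K : FiniteGroup c ℓ) (d : ℕ) (ρ : UnitaryRep K (suc d)) where
  open Characters ℂ-starRing K (suc d) (starRep ρ)
  open LargePowers ℂ-starRing K d (starRep ρ)
  open Colourings ℂ-starRing K (suc d) (starRep ρ)

  isometry-tensorPower : ∀ n g → Isometry (tensorPower ρ n g)
  isometry-tensorPower n g v = ≈ʳ-trans (‖‖²-cong (*ᵛ-cong (tensorPower≈⨂ ρ n g) v))
    (A†A≈1⇒isometry (⨂ρ n g) (⨂ρ-isometry n g) v)

  abundant⇒norm≡1 : Faithful ρ → G.TrivialCenter → ∀ n t .{{_ : ℕ.NonZero t}} ω →
    Abundant threshold (columns G.order n t ω) →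
    IsOpNorm (average t (λ m → tensorPower ρ n (Sampling.sample K t n ω m))) 1ʳ
  abundant⇒norm≡1 faithful centerless n t ω abundant =
    average-norm≡1 t A (λ m → isometry-tensorPower n (sample ω m)) λ h →
      invariants-nonzero f a≉0 λ v fixed → h v λ m i → ≈ᶜ-trans
        (*ᵛ-cong (λ j k → ≈ᶜ-trans (tensorPower≈⨂ ρ n (sample ω m) j k) (⨂ρ-cong n (agree m) j k)) v i)
        -- The m-th sampled element acts through the group of colourings: its l-th coordinate is the
        -- m-th entry of the l-th column, so the colour u is sent to its m-th entry.
        (fixed (λ u → G.element (finToFun {G.order} {t} u m)) i)
    where
    open Sampling K t n using (sample)
    A : Fin t → Matrix (suc d ℕ.^ n)
    A m = tensorPower ρ n (sample ω m)
    f : Fin n → Fin (G.order ℕ.^ t)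
    f = columns G.order n t ω
    a≉0 : ∀ u → ¬ a (count f u) ≈ᶜ 0ᶜ
    -- If the image of x commutes with all images, faithfulness makes x central, hence trivial.
    a≉0 u = a-≉0 (λ x commutes → centerless x (λ y → faithful (commutes y))) (count f u) (abundant u)
    agree : ∀ m l → sample ω m l G.≈ G.element (finToFun {G.order} {t} (f l) m)
    agree m l = G.reflexive (cong G.element (sym (transpose-entry G.order n t ω l m)))

open import Data.Integer.Base using (+_)
open import Data.Nat.Base using (NonZero; _≤_; _*_; _^_)
open import Data.Rational.Base using (_/_; -_)

theorem1 : ∀ {c ℓ} (K : FiniteGroup c ℓ) → FiniteGroup.NonAbelian K → FiniteGroup.TrivialCenter K →
    ∀ (d : ℕ) → 2 ≤ d → (ρ : UnitaryRep K d) → Faithful ρ → Irreducible ρ →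
    let open FiniteGroup K using (order) in
    ∃[ κ ] 2 ≤ κ × (∀ (n t : ℕ) .{{_ : NonZero n}} .{{_ : NonZero t}} →
    let open Sampling K t n in
    Pr[ (λ ω → IsOpNorm (average t (λ m → tensorPower ρ n (sample ω m))) 1ʳ) ]≥
    (1ʳ -ʳ fromℚ (+ (n ^ κ * order ^ t) / 1) *ʳ expℚ (- (+ n / order ^ t))))
theorem1 K nonabelian centerless (suc d) 2≤d ρ faithful _ =
  -- The factor 2 absorbs (n + 1)^k into n^(2k) for n ≥ 2; k = (|K| + 1)² is positive, whence 2 ≤
  -- 2k.
  2 * k , ℕₚ.m≤m*n 2 k , λ n t →
    let open FiniteGroup K using (order; order≢0)
        open Sampling K t n
        -- Makes |K|^t - 1 positive, as the count of arrays with a rare column requires; nonabelian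
        -- gives |K| ≥ 2 and t > 0 does the rest.
        2≤M : 2 ≤ order ^ t
        2≤M = ℕₚ.≤-trans (nonabelian⇒2≤order K nonabelian)
          (ℕₚ.≤-trans (ℕₚ.≤-reflexive (sym (ℕₚ.^-identityʳ order))) (ℕₚ.^-monoʳ-≤ order (ℕ.>-nonZero⁻¹ t)))
        N≡M^n : (order ^ n) ^ t ≡ (order ^ t) ^ n
        N≡M^n = trans (ℕₚ.^-*-assoc order n t)
            (trans (cong (order ^_) (ℕₚ.*-comm n t)) (sym (ℕₚ.^-*-assoc order t n)))
    in abundantSet order n t k
     , (λ {ω} ω∈ → abundant⇒norm≡1 K d ρ faithful centerless n t ω (∈abundantSet order n t k ω∈))
     , probability-bound (order ^ t) n ((order ^ n) ^ t) ∣ abundantSet order n t k ∣ (n ^ (2 * k) * order ^ t) N≡M^n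
         (ℕₚ.≤-trans (ℕₚ.≤-reflexive N≡M^n) (abundantSet-size′ order n t k 2≤M))
  where
  k = LargePowers.threshold ℂ-starRing K d (starRep ρ)
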